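{- Let $n,t,\delta$ be integers with $n\ge 3$ and $2\le t\le \delta\le \left\lfloor \frac{n+t-3}{2}\right\rfloor$, let $\alpha\in[0,1)$, and let $h=\left\lfloor \frac{n+t-3}{2}\right\rfloor$. Put $$f_2(n,t,\delta,2)=\binom{n+t-\delta-2}{2}+(\delta-t+2)\delta,\qquad g_2(n,t,\delta,2)=\binom{n+t-h-2}{2}+(h-t+1)h+\delta,$$ and $h_2=\max\{f_2(n,t,\delta,2),\,g_2(n,t,\delta,2)\}$. Let $G$ be a finite, simple, connected graph of order $n$ with minimum degree $\delta$. If $$\lambda_\alpha(G)>\frac{\delta+\alpha n-\alpha\delta-1+\sqrt{(\delta+\alpha n-\alpha\delta-1)^2+4(1-\alpha)(2h_2-n\delta+\delta)}}{2},$$ then $G$ is one-to-one $t$-disjoint path coverable.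
   Context: The order of a graph is its number of vertices. For $\alpha\in[0,1)$, $A_\alpha(G)=\alpha D(G)+(1-\alpha)A(G)$, where $A(G)$ is the adjacency matrix and $D(G)$ the diagonal matrix of vertex degrees of $G$; the $\alpha$-spectral radius $\lambda_\alpha(G)$ is the largest eigenvalue of $A_\alpha(G)$. A graph $G$ is one-to-one $t$-disjoint path coverable if for any two distinct vertices $u,v$ of $G$ there exist $t$ distinct paths in $G$, each joining $u$ and $v$, such that every vertex of $G$ lies on at least one of the paths and any two of the paths have no common vertices other than $u$ and $v$. -}

module Defs where

open import Data.Bool.Base using (if_then_else_)
open import Data.Fin.Base using (Fin)
import Data.Fin.Properties as Fin
open import Data.Integer.Base using (+_)
open import Data.List.Base using (List; length; filter; allFin; head; last)
open import Data.List.Membership.Propositional using (_∈_)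
open import Data.List.Relation.Unary.Linked using (Linked)
open import Data.List.Relation.Unary.Unique.Propositional using (Unique)
open import Data.Maybe.Base using (just)
open import Data.Nat.Base as ℕ using (ℕ; _⊔_)
open import Data.Nat.Combinatorics using (_C_)
open import Data.Nat.DivMod using (_/_)
import Data.Nat.Properties as ℕ
open import Data.Product.Base using (∃-syntax; Σ-syntax; _×_; _,_)
open import Data.Rational.Base as ℚ using (ℚ; 0ℚ; 1ℚ; ½)
import Data.Rational.Properties as ℚ
open import Data.Rational.Solver using (module +-*-Solver)
open import Data.Sum.Base using (_⊎_)
open import Data.Vec.Functional using (Vector; foldr)
open import Level using (0ℓ)
open import Relation.Binary.Construct.Closure.ReflexiveTransitive using (Star)
open import Relation.Binary.Core using (Rel)
open import Relation.Binary.Definitions using (Decidable; Irreflexive; Symmetric)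
open import Relation.Binary.PropositionalEquality
  using (_≡_; _≢_; refl; sym; trans; cong; cong₂; subst)
open import Relation.Nullary.Decidable using (does)
open import Relation.Nullary.Negation using (¬_)

-- Real numbers are Cauchy sequences of rationals, with operations taken
-- termwise. Equality of reals is the relation _≃_, not _≡_.

IsCauchy : (ℕ → ℚ) → Set
IsCauchy x = ∀ ε → 0ℚ ℚ.< ε →
  ∃[ N ] (∀ m n → N ℕ.≤ m → N ℕ.≤ n → ℚ.∣ x m ℚ.- x n ∣ ℚ.≤ ε)

record ℝ : Set where
  constructor mkℝ
  field
    seq      : ℕ → ℚ
    isCauchy : IsCauchy seq

open ℝ public

infix 4 _≃_ _≤_ _<_

_≃_ : Rel ℝ 0ℓ
x ≃ y = ∀ ε → 0ℚ ℚ.< ε →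
  ∃[ N ] (∀ n → N ℕ.≤ n → ℚ.∣ seq x n ℚ.- seq y n ∣ ℚ.≤ ε)

_≤_ : Rel ℝ 0ℓ
x ≤ y = ∀ ε → 0ℚ ℚ.< ε →
  ∃[ N ] (∀ n → N ℕ.≤ n → seq x n ℚ.≤ seq y n ℚ.+ ε)

_<_ : Rel ℝ 0ℓ
x < y = ∃[ ε ] (0ℚ ℚ.< ε ×
  ∃[ N ] (∀ n → N ℕ.≤ n → seq x n ℚ.+ ε ℚ.≤ seq y n))

private
  half-pos : ∀ {ε} → 0ℚ ℚ.< ε → 0ℚ ℚ.< ε ℚ.* ½
  half-pos {ε} 0<ε =
    subst (ℚ._< ε ℚ.* ½) (ℚ.*-zeroˡ ½) (ℚ.*-monoˡ-<-pos ½ 0<ε)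

  halves : ∀ ε → ε ℚ.* ½ ℚ.+ ε ℚ.* ½ ≡ ε
  halves ε = trans (sym (ℚ.*-distribˡ-+ ε ½ ½)) (ℚ.*-identityʳ ε)

  ≤⊔ˡ : ∀ {a b k} → a ⊔ b ℕ.≤ k → a ℕ.≤ k
  ≤⊔ˡ {a} {b} = ℕ.≤-trans (ℕ.m≤m⊔n a b)

  ≤⊔ʳ : ∀ {a b k} → a ⊔ b ℕ.≤ k → b ℕ.≤ k
  ≤⊔ʳ {a} {b} = ℕ.≤-trans (ℕ.m≤n⊔m a b)

  open +-*-Solver

  const-cauchy : ∀ q → IsCauchy (λ _ → q)
  const-cauchy q ε 0<ε = 0 , λ _ _ _ _ →
    subst (ℚ._≤ ε) (sym (cong ℚ.∣_∣ (ℚ.+-inverseʳ q))) (ℚ.<⇒≤ 0<ε)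

  +-cauchy : ∀ {x y} → IsCauchy x → IsCauchy y → IsCauchy (λ n → x n ℚ.+ y n)
  +-cauchy {x} {y} cx cy ε 0<ε with cx _ (half-pos 0<ε) | cy _ (half-pos 0<ε)
  ... | M , hx | N , hy = M ⊔ N , λ m n m≥ n≥ → begin
    ℚ.∣ (x m ℚ.+ y m) ℚ.- (x n ℚ.+ y n) ∣
      ≡⟨ cong ℚ.∣_∣ (rearrange (x m) (y m) (x n) (y n)) ⟩
    ℚ.∣ (x m ℚ.- x n) ℚ.+ (y m ℚ.- y n) ∣
      ≤⟨ ℚ.∣p+q∣≤∣p∣+∣q∣ (x m ℚ.- x n) (y m ℚ.- y n) ⟩
    ℚ.∣ x m ℚ.- x n ∣ ℚ.+ ℚ.∣ y m ℚ.- y n ∣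
      ≤⟨ ℚ.+-mono-≤ (hx m n (≤⊔ˡ m≥) (≤⊔ˡ n≥)) (hy m n (≤⊔ʳ {M} m≥) (≤⊔ʳ {M} n≥)) ⟩
    ε ℚ.* ½ ℚ.+ ε ℚ.* ½
      ≡⟨ halves ε ⟩
    ε ∎
    where
    open ℚ.≤-Reasoning
    rearrange : ∀ a b c d →
      (a ℚ.+ b) ℚ.- (c ℚ.+ d) ≡ (a ℚ.- c) ℚ.+ (b ℚ.- d)
    rearrange = solve 4 (λ a b c d →
      (a :+ b) :- (c :+ d) := (a :- c) :+ (b :- d)) refl

  neg-cauchy : ∀ {x} → IsCauchy x → IsCauchy (λ n → ℚ.- x n)
  neg-cauchy {x} cx ε 0<ε with cx ε 0<ε
  ... | N , hx = N , λ m n m≥ n≥ →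
    subst (ℚ._≤ ε) (sym (flip (x m) (x n))) (hx m n m≥ n≥)
    where
    flip : ∀ a b → ℚ.∣ ℚ.- a ℚ.- ℚ.- b ∣ ≡ ℚ.∣ a ℚ.- b ∣
    flip a b = trans
      (cong ℚ.∣_∣ (solve 2 (λ a b → :- a :- :- b := :- (a :- b)) refl a b))
      (ℚ.∣-p∣≡∣p∣ (a ℚ.- b))

  eventually-bounded : ∀ {x} → IsCauchy x →
    ∃[ B ] (0ℚ ℚ.< B × ∃[ N ] (∀ n → N ℕ.≤ n → ℚ.∣ x n ∣ ℚ.≤ B))
  eventually-bounded {x} cx with cx 1ℚ (ℚ.positive⁻¹ 1ℚ)
  ... | N , hx = 1ℚ ℚ.+ ℚ.∣ x N ∣ ,
    ℚ.+-mono-<-≤ (ℚ.positive⁻¹ 1ℚ) (ℚ.0≤∣p∣ (x N)) ,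
    N , λ n n≥ → begin
      ℚ.∣ x n ∣
        ≡⟨ cong ℚ.∣_∣ (solve 2 (λ a b → a := (a :- b) :+ b) refl (x n) (x N)) ⟩
      ℚ.∣ (x n ℚ.- x N) ℚ.+ x N ∣
        ≤⟨ ℚ.∣p+q∣≤∣p∣+∣q∣ (x n ℚ.- x N) (x N) ⟩
      ℚ.∣ x n ℚ.- x N ∣ ℚ.+ ℚ.∣ x N ∣
        ≤⟨ ℚ.+-monoˡ-≤ ℚ.∣ x N ∣ (hx n N n≥ ℕ.≤-refl) ⟩
      1ℚ ℚ.+ ℚ.∣ x N ∣ ∎
    where open ℚ.≤-Reasoning

  shrink : ∀ {B ε} → 0ℚ ℚ.< B → 0ℚ ℚ.< ε → ∃[ η ] (0ℚ ℚ.< η × B ℚ.* η ≡ ε)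
  shrink {B} {ε} 0<B 0<ε = ℚ.1/ B ℚ.* ε ,
    subst (ℚ._< ℚ.1/ B ℚ.* ε) (ℚ.*-zeroʳ (ℚ.1/ B)) (ℚ.*-monoʳ-<-pos (ℚ.1/ B) 0<ε) ,
    trans (sym (ℚ.*-assoc B (ℚ.1/ B) ε))
      (trans (cong (ℚ._* ε) (ℚ.*-inverseʳ B)) (ℚ.*-identityˡ ε))
    where
    instance
      _ = ℚ.positive 0<B
      _ = ℚ.pos⇒nonZero B
      _ = ℚ.1/pos⇒pos B

  ∣*∣-mono : ∀ {p q B η} → 0ℚ ℚ.< B → ℚ.∣ p ∣ ℚ.≤ B → ℚ.∣ q ∣ ℚ.≤ η →
    ℚ.∣ p ℚ.* q ∣ ℚ.≤ B ℚ.* η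
  ∣*∣-mono {p} {q} {B} {η} 0<B p≤B q≤η = begin
    ℚ.∣ p ℚ.* q ∣          ≡⟨ ℚ.∣p*q∣≡∣p∣*∣q∣ p q ⟩
    ℚ.∣ p ∣ ℚ.* ℚ.∣ q ∣    ≤⟨ ℚ.*-monoʳ-≤-nonNeg ℚ.∣ q ∣ {{ℚ.∣-∣-nonNeg q}} p≤B ⟩
    B ℚ.* ℚ.∣ q ∣          ≤⟨ ℚ.*-monoˡ-≤-nonNeg B {{ℚ.nonNegative (ℚ.<⇒≤ 0<B)}} q≤η ⟩
    B ℚ.* η                ∎
    where open ℚ.≤-Reasoning

  *-diff : ∀ a b c d →
    a ℚ.* b ℚ.- c ℚ.* d ≡ a ℚ.* (b ℚ.- d) ℚ.+ d ℚ.* (a ℚ.- c)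
  *-diff = solve 4 (λ a b c d →
    a :* b :- c :* d := a :* (b :- d) :+ d :* (a :- c)) refl

  *-estimate : ∀ {Bx By ηx ηy ε} a b c d → 0ℚ ℚ.< Bx → 0ℚ ℚ.< By →
    By ℚ.* ηx ≡ ε ℚ.* ½ → Bx ℚ.* ηy ≡ ε ℚ.* ½ →
    ℚ.∣ a ∣ ℚ.≤ Bx → ℚ.∣ d ∣ ℚ.≤ By →
    ℚ.∣ a ℚ.- c ∣ ℚ.≤ ηx → ℚ.∣ b ℚ.- d ∣ ℚ.≤ ηy →
    ℚ.∣ a ℚ.* b ℚ.- c ℚ.* d ∣ ℚ.≤ ε
  *-estimate {Bx} {By} {ηx} {ηy} {ε} a b c d 0<Bx 0<By ηx≡ ηy≡ a≤ d≤ ac≤ bd≤ = begin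
    ℚ.∣ a ℚ.* b ℚ.- c ℚ.* d ∣
      ≡⟨ cong ℚ.∣_∣ (*-diff a b c d) ⟩
    ℚ.∣ a ℚ.* (b ℚ.- d) ℚ.+ d ℚ.* (a ℚ.- c) ∣
      ≤⟨ ℚ.∣p+q∣≤∣p∣+∣q∣ (a ℚ.* (b ℚ.- d)) (d ℚ.* (a ℚ.- c)) ⟩
    ℚ.∣ a ℚ.* (b ℚ.- d) ∣ ℚ.+ ℚ.∣ d ℚ.* (a ℚ.- c) ∣
      ≤⟨ ℚ.+-mono-≤ (∣*∣-mono {a} {b ℚ.- d} 0<Bx a≤ bd≤)
                    (∣*∣-mono {d} {a ℚ.- c} 0<By d≤ ac≤) ⟩
    Bx ℚ.* ηy ℚ.+ By ℚ.* ηx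
      ≡⟨ cong₂ ℚ._+_ ηy≡ ηx≡ ⟩
    ε ℚ.* ½ ℚ.+ ε ℚ.* ½
      ≡⟨ halves ε ⟩
    ε ∎
    where open ℚ.≤-Reasoning

  *-cauchy : ∀ {x y} → IsCauchy x → IsCauchy y → IsCauchy (λ n → x n ℚ.* y n)
  *-cauchy {x} {y} cx cy ε 0<ε =
    let Bx , 0<Bx , Nx , bx = eventually-bounded {x} cx
        By , 0<By , Ny , by = eventually-bounded {y} cy
        ηx , 0<ηx , ηx≡     = shrink 0<By (half-pos 0<ε)
        ηy , 0<ηy , ηy≡     = shrink 0<Bx (half-pos 0<ε)
        Mx , hx             = cx ηx 0<ηx
        My , hy             = cy ηy 0<ηy
    in (Nx ⊔ Ny) ⊔ (Mx ⊔ My) , λ m n m≥ n≥ →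
      *-estimate (x m) (y m) (x n) (y n) 0<Bx 0<By ηx≡ ηy≡
        (bx m (≤⊔ˡ {Nx} {Ny} (≤⊔ˡ m≥)))
        (by n (≤⊔ʳ {Nx} {Ny} (≤⊔ˡ n≥)))
        (hx m n (≤⊔ˡ {Mx} (≤⊔ʳ {Nx ⊔ Ny} m≥)) (≤⊔ˡ {Mx} (≤⊔ʳ {Nx ⊔ Ny} n≥)))
        (hy m n (≤⊔ʳ {Mx} (≤⊔ʳ {Nx ⊔ Ny} m≥)) (≤⊔ʳ {Mx} (≤⊔ʳ {Nx ⊔ Ny} n≥)))

infix  8 -_
infixl 7 _*_
infixl 6 _+_ _-_

fromℚ : ℚ → ℝ
fromℚ q = mkℝ (λ _ → q) (const-cauchy q)

fromℕ : ℕ → ℝ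
fromℕ k = fromℚ (+ k ℚ./ 1)

0ℝ 1ℝ : ℝ
0ℝ = fromℕ 0
1ℝ = fromℕ 1

_+_ : ℝ → ℝ → ℝ
x + y = mkℝ (λ n → seq x n ℚ.+ seq y n)
  (+-cauchy {seq x} {seq y} (isCauchy x) (isCauchy y))

-_ : ℝ → ℝ
- x = mkℝ (λ n → ℚ.- seq x n) (neg-cauchy {seq x} (isCauchy x))

_-_ : ℝ → ℝ → ℝ
x - y = x + - y

_*_ : ℝ → ℝ → ℝ
x * y = mkℝ (λ n → seq x n ℚ.* seq y n)
  (*-cauchy {seq x} {seq y} (isCauchy x) (isCauchy y))

_/2 : ℝ → ℝ
x /2 = x * fromℚ ½

-- The square root as a relation: s is the nonnegative real with square x.
infix 4 _IsSqrtOf_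

_IsSqrtOf_ : Rel ℝ 0ℓ
s IsSqrtOf x = 0ℝ ≤ s × s * s ≃ x

Matrix : ℕ → Set
Matrix n = Fin n → Fin n → ℝ

∑ : ∀ {n} → Vector ℝ n → ℝ
∑ = foldr _+_ 0ℝ

_·ᵥ_ : ∀ {n} → Matrix n → Vector ℝ n → Vector ℝ n
(M ·ᵥ x) i = ∑ (λ j → M i j * x j)

IsEigenvalue : ∀ {n} → Matrix n → ℝ → Set
IsEigenvalue {n} M μ = ∃[ x ]
  (¬ (∀ (i : Fin n) → x i ≃ 0ℝ) × (∀ i → (M ·ᵥ x) i ≃ μ * x i))

IsLargestEigenvalue : ∀ {n} → Matrix n → ℝ → Set
IsLargestEigenvalue M ρ =
  IsEigenvalue M ρ × (∀ μ → IsEigenvalue M μ → μ ≤ ρ)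

-- The vertex set is Fin n, so n is the order.
record Graph (n : ℕ) : Set₁ where
  field
    Adj        : Rel (Fin n) 0ℓ
    adj?       : Decidable Adj
    Adj-sym    : Symmetric Adj
    Adj-irrefl : Irreflexive _≡_ Adj

module _ {n : ℕ} (G : Graph n) where
  open Graph G

  degree : Fin n → ℕ
  degree v = length (filter (adj? v) (allFin n))

  HasMinDegree : ℕ → Set
  HasMinDegree δ = (∃[ v ] degree v ≡ δ) × (∀ v → δ ℕ.≤ degree v)

  Connected : Set
  Connected = ∀ u v → Star Adj u v

  -- A path is recorded by its vertices, listed from u to v.
  record Path (u v : Fin n) : Set where
    field
      vertices : List (Fin n)
      starts   : head vertices ≡ just u
      ends     : last vertices ≡ just v
      linked   : Linked Adj vertices
      simple   : Unique vertices

  open Path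

  OneToOneDisjointPathCoverable : ℕ → Set
  OneToOneDisjointPathCoverable t = ∀ u v → u ≢ v →
    Σ[ P ∈ (Fin t → Path u v) ]
      ( (∀ i j → i ≢ j → vertices (P i) ≢ vertices (P j))
      × (∀ w → ∃[ i ] w ∈ vertices (P i))
      × (∀ i j → i ≢ j → ∀ w → w ∈ vertices (P i) → w ∈ vertices (P j) →
           w ≡ u ⊎ w ≡ v))

  adjacencyMatrix : Matrix n
  adjacencyMatrix i j = if does (adj? i j) then 1ℝ else 0ℝ

  degreeMatrix : Matrix n
  degreeMatrix i j = if does (i Fin.≟ j) then fromℕ (degree i) else 0ℝ

  Aα : ℝ → Matrix n
  Aα α i j = α * degreeMatrix i j + (1ℝ - α) * adjacencyMatrix i j

  IsSpectralRadius : ℝ → ℝ → Set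
  IsSpectralRadius α ρ = IsLargestEigenvalue (Aα α) ρ

-- Truncated subtraction agrees with integer subtraction
-- throughout the range 3 ≤ n, 2 ≤ t ≤ δ ≤ h n t.

h : ℕ → ℕ → ℕ
h n t = (n ℕ.+ t ℕ.∸ 3) / 2

f₂ : ℕ → ℕ → ℕ → ℕ
f₂ n t δ = ((n ℕ.+ t ℕ.∸ δ ℕ.∸ 2) C 2) ℕ.+ (δ ℕ.∸ t ℕ.+ 2) ℕ.* δ

g₂ : ℕ → ℕ → ℕ → ℕ
g₂ n t δ =
  ((n ℕ.+ t ℕ.∸ h n t ℕ.∸ 2) C 2) ℕ.+ (h n t ℕ.∸ t ℕ.+ 1) ℕ.* h n t ℕ.+ δ

h₂ : ℕ → ℕ → ℕ → ℕ
h₂ n t δ = f₂ n t δ ⊔ g₂ n t δ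

{-# OPTIONS --safe #-}
-- Combinatorial part. Suppose nonadjacent x, y satisfy d(x) + d(y) ≥ n + t - 2.
-- If adding the edge xy creates t internally disjoint spanning u-v paths, then
-- G already has them: cut the path through xy at that edge and count, over the
-- edges ab of the whole system, how many of x, y are joined to the appropriate
-- ends; some edge has both, and rerouting there removes xy. Adding such edges
-- until none is left yields either the complete graph, or a nonadjacent pair
-- x, y of maximal degree sum. In the latter case k = d(x) ≤ d(y) satisfies
-- δ ≤ k ≤ h, and at least k - t + 2 vertices have degree at most k. Since one
-- vertex has degree δ, this bounds the number of edges of G by
-- C(n + t - k - 2, 2) + (k - t + 1) k + δ, which is convex in k and hence at
-- most h₂.
--
-- Spectral part. Suppose G has at most h₂ edges. Take any eigenvector x for ρ
-- and put z = |x|, S = Σ zᵢ, T = Σ dᵢ zᵢ. Since Aα has nonnegative entries,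
-- ρ z ≤ Aα z entrywise; summing this with weights 1 and dᵢ gives ρ S ≤ T and
-- ρ T ≤ b T + (1 - α) c S. If ρ exceeds the larger root of
-- ρ² - b ρ - (1 - α) c, then S = 0, so x = 0. No Perron vector is needed.
module Submission where

-- The threshold n + t - 2 is the value the count produces. Let A be the interior of the cut path,
-- and B, C₁, C₂, ... the interiors of the others. Without a rerouting, the degrees of the ends of
-- the missing edge sum to at most |A| + (|B| + 1) + Σ (|Cᵢ| + 1) = n + t - 3. The obstacle is that
-- the paths must be distinct, so a rerouting must never produce a second copy of the bare edge uv.
-- A system therefore reserves one slot for a possible bare edge. One path B is compared with the
-- cut path along all its edges; the others are tested only at edges between internal vertices, and
-- the tests this gives up account for the + 1 of each Cᵢ. In the spectral bound, b = α (n - 1) + (1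
-- - α) (δ - 1) and c = 2 h₂ - (n - 1) δ. The α part comes from dⱼ ≤ n - 1. The other part holds
-- because each vertex outside the closed neighbourhood of j uses at least δ of the degree sum. The
-- strict hypothesis enters as a rational gap η > 0, because S ≤ 0 is obtained by dividing 0 ≤ - η S
-- by η.

-- Walks, their reversal, and neighbour counts along them.

module Walks where
  open import Data.List.Base hiding (sum)
  open import Data.List.Membership.Propositional using (_∈_)
  open import Data.List.Relation.Unary.Any using (here; there)
  open import Data.List.Relation.Binary.Permutation.Propositional using (_↭_; prep; ↭-refl; ↭-trans)
  open import Data.List.Relation.Binary.Permutation.Propositional.Properties
    using (++-commutativeMonoid)
  open import Data.Nat.Base
  open import Data.Nat.ListAction using (sum)
  open import Data.Nat.Properties
  open import Data.Product.Base using (∃-syntax; _×_; _,_)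
  open import Data.Sum.Base using (_⊎_; inj₁; inj₂)
  open import Relation.Binary.Core using (Rel)
  open import Relation.Binary.Definitions using (Decidable; Symmetric)
  open import Relation.Binary.PropositionalEquality hiding ([_])
  open import Relation.Nullary
  open import Data.Bool.Base using (if_then_else_)
  open import Level using (0ℓ)
  import Algebra.Solver.CommutativeMonoid as CMSolver

  module ↭-Solver {A : Set} = CMSolver (++-commutativeMonoid {A = A})
  open ↭-Solver using (_⊕_; _⊜_) renaming (solve to ↭-solve)

  infixr 5 _∷_

  -- The list holds the vertices after the first one, the last one included.
  data Walk {V : Set} (R : Rel V 0ℓ) : V → List V → V → Set where
    []  : ∀ {a} → Walk R a [] a
    _∷_ : ∀ {a c L b} → R a c → Walk R c L b → Walk R a (c ∷ L) b

  module _ {V : Set} {R : Rel V 0ℓ} where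

    infixr 5 _++ʷ_

    _++ʷ_ : ∀ {a b c L M} → Walk R a L b → Walk R b M c → Walk R a (L ++ M) c
    []      ++ʷ w′ = w′
    (r ∷ w) ++ʷ w′ = r ∷ (w ++ʷ w′)

    -- The list of a walk omits its start, so reversal does not permute the lists themselves: only
    -- the full vertex sequences agree up to order.
    reverse-walk : Symmetric R → ∀ {a b L} → Walk R a L b →
      ∃[ L′ ] (Walk R b L′ a × b ∷ L′ ↭ a ∷ L)
    reverse-walk sym []      = [] , [] , ↭-refl
    reverse-walk sym {a} {b} {c ∷ L} (r ∷ w) with reverse-walk sym w
    ... | L′ , w′ , p = L′ ++ [ a ] , w′ ++ʷ (sym r ∷ []) ,
      ↭-trans (↭-solve 3 (λ b L′ a → b ⊕ L′ ⊕ a ⊜ a ⊕ b ⊕ L′) ↭-refl [ b ] L′ [ a ])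
              (prep a p)

    last-of-walk : ∀ {a b L} → Walk R a L b → a ≢ b → ∃[ A ] L ≡ A ++ [ b ]
    last-of-walk [] a≢b = contradiction refl a≢b
    last-of-walk {b = b} (_ ∷ []) _ = [] , refl
    last-of-walk (_∷_ {c = c} r (s ∷ w)) _ = go r (s ∷ w)
      where
      go : ∀ {a c d L b} → R a c → Walk R c (d ∷ L) b → ∃[ A ] c ∷ d ∷ L ≡ A ++ [ b ]
      go {c = c} r (s ∷ []) = c ∷ [] , refl
      go {c = c} r (s ∷ t ∷ w) with go s (t ∷ w)
      ... | A , eq = c ∷ A , cong (c ∷_) eq

    unsnoc-walk : ∀ L {a b c} → Walk R a (L ++ [ b ]) c → ∃[ z ] (Walk R a L z × R z b × b ≡ c)
    unsnoc-walk []      (r ∷ []) = _ , [] , r , refl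
    unsnoc-walk (x ∷ L) (r ∷ w) with unsnoc-walk L w
    ... | z , w′ , s , eq = z , r ∷ w′ , s , eq

    last∈ : ∀ {a b L} → Walk R a L b → b ∈ a ∷ L
    last∈ []      = here refl
    last∈ (r ∷ w) = there (last∈ w)

  module Counting {V : Set} {R : Rel V 0ℓ} (R? : Decidable R) where

    ind : V → V → ℕ
    ind a b = if does (R? a b) then 1 else 0

    ind-no : ∀ {a b} → ¬ R a b → ind a b ≡ 0
    ind-no {a} {b} ¬r with R? a b
    ... | yes r = contradiction r ¬r
    ... | no  _ = refl

    ind-yes : ∀ {a b} → R a b → ind a b ≡ 1
    ind-yes {a} {b} r with R? a b
    ... | yes _ = refl
    ... | no ¬r = contradiction r ¬r

    ind≤1 : ∀ a b → ind a b ≤ 1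
    ind≤1 a b with R? a b
    ... | yes _ = ≤-refl
    ... | no  _ = z≤n

    nbrs : V → List V → ℕ
    nbrs a L = sum (map (ind a) L)

    nbrs-++ : ∀ a L M → nbrs a (L ++ M) ≡ nbrs a L + nbrs a M
    nbrs-++ a []      M = refl
    nbrs-++ a (x ∷ L) M = trans (cong (ind a x +_) (nbrs-++ a L M)) (sym (+-assoc (ind a x) _ _))

    -- A rerouting opportunity: a step `cd` of the walk at which `q` can be attached to `c` and `p`
    -- to `d`. The vertex `c` does not occur in `split` on its own, being the end of `before`.
    record Crossing (p q a : V) (L : List V) (b : V) : Set where
      constructor crossing
      field
        {K₁ K₂} : List V
        {c d}   : V
        before  : Walk R a K₁ c
        after   : Walk R d K₂ b
        qRc     : R q c
        pRd     : R p d
        split   : L ≡ K₁ ++ d ∷ K₂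

    -- If no step `cd` has both `R q c` and `R p d`, each of the `length L` steps contributes at
    -- most 1. Over all steps, `q` is tested at every vertex but the last and `p` at every vertex
    -- but the start; `ind q b` on the right pays for the missing test of `q`.
    scan : ∀ p q {a b L} → Walk R a L b →
      Crossing p q a L b ⊎ ind q a + (nbrs q L + nbrs p L) ≤ length L + ind q b
    scan p q {a} [] = inj₂ (≤-reflexive (+-identityʳ (ind q a)))
    scan p q {a} {b} {c ∷ L} (r ∷ w) with scan p q w
    ... | inj₁ (crossing w₁ w₂ qc pd eq) = inj₁ (crossing (r ∷ w₁) w₂ qc pd (cong (c ∷_) eq))
    ... | inj₂ le with R? q a | R? p c
    ...   | yes qa | yes pc = inj₁ (crossing [] w qa pc refl)
    ...   | yes qa | no _ = inj₂ (s≤s (≤-trans (≤-reflexive (+-assoc (ind q c) _ _)) le))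
    ...   | no _   | yes _ = inj₂ (≤-trans (≤-reflexive lemma) (s≤s le))
      where lemma : ind q c + nbrs q L + suc (nbrs p L) ≡ suc (ind q c + (nbrs q L + nbrs p L))
            lemma = trans (+-suc _ _) (cong suc (+-assoc (ind q c) _ _))
    ...   | no _   | no _ = inj₂ (≤-trans (≤-reflexive (+-assoc (ind q c) _ _)) (≤-trans le (n≤1+n _)))

-- Rerouting a system of disjoint walks around a missing edge.

module Rewirings where
  open Walks
  open import Data.List.Base hiding (sum)
  open import Data.List.Properties using (++-assoc; length-++; ++-identityʳ; concat-++)
  open import Data.List.Relation.Unary.All using (All; []; _∷_)
  open import Data.List.Relation.Unary.All.Properties using () renaming (++⁺ to All++)
  open import Data.List.Relation.Binary.Permutation.Propositional using (_↭_; prep; ↭-refl; ↭-sym; ↭-trans; ↭-reflexive)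
  open import Data.List.Relation.Binary.Permutation.Propositional.Properties
    using (++⁺ˡ; ++⁺ʳ; drop-∷; map⁺; ↭-length; ↭-empty-inv)
  open import Data.Nat.Base
  open import Data.Nat.ListAction.Properties using (sum-↭)
  open import Data.Nat.Properties
  open import Data.Nat.Solver using (module +-*-Solver)
  open import Data.Product.Base using (∃-syntax; _×_; _,_)
  open import Data.Sum.Base using (_⊎_; inj₁; inj₂)
  open import Level using (0ℓ)
  open import Relation.Binary.Core using (Rel)
  open import Relation.Binary.Definitions using (Decidable; Symmetric)
  open import Relation.Binary.PropositionalEquality hiding ([_])
  open import Relation.Nullary
  open import Data.Empty using (⊥-elim)
  open ↭-Solver using (_⊕_; _⊜_) renaming (solve to ↭-solve)

  -- t internally disjoint walks from u to v covering vs, each given by its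
  -- internal vertices. At most one of them, the head, is the bare edge uv.
  record Container {V : Set} (R : Rel V 0ℓ) (vs : List V) (u v : V) (t : ℕ) : Set where
    constructor container
    field
      {first}    : List V
      {others}   : List (List V)
      first-walk : Walk R u (first ++ [ v ]) v
      walks      : All (λ A → Walk R u (A ++ [ v ]) v) others
      nonempty   : All (_≢ []) others
      size       : suc (length others) ≡ t
      covers     : u ∷ v ∷ first ++ concat others ↭ vs

  ∷ʳ-cancel-↭ : ∀ {V : Set} {v : V} A B → A ++ [ v ] ↭ B ++ [ v ] → A ↭ B
  ∷ʳ-cancel-↭ {v = v} A B p = drop-∷ (↭-trans (swap-last A) (↭-trans p (↭-sym (swap-last B))))
    where
    swap-last : ∀ L → v ∷ L ↭ L ++ [ v ]
    swap-last L = ↭-solve 2 (λ v L → v ⊕ L ⊜ L ⊕ v) ↭-refl [ v ] L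

  module _ {V : Set} {R : Rel V 0ℓ} (R? : Decidable R) (R-sym : Symmetric R)
           (R-irrefl : ∀ {a} → ¬ R a a) {u v : V} (u≢v : u ≢ v) where
    open Counting R?

    Through : List V → Set
    Through A = Walk R u (A ++ [ v ]) v

    -- The pieces left of a u-v walk when its step from `p` to `q`, not assumed to lie in `R`, is
    -- cut out. The vertex list is still that of the whole walk.
    record Broken (p q : V) (A : List V) : Set where
      constructor broken
      field
        {L₁ L₂} : List V
        front   : Walk R u L₁ p
        back    : Walk R q L₂ v
        split   : A ++ [ v ] ≡ L₁ ++ q ∷ L₂

    inner : ∀ {N} → Walk R u N v → ∃[ A ] N ≡ A ++ [ v ]
    inner w = last-of-walk w u≢v

    through : ∀ {N A} → Walk R u N v → N ≡ A ++ [ v ] → Through A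
    through w refl = w

    module _ {p q : V} (¬pq : ¬ R p q) where

      repair : ∀ {A N} → Walk R u N v → N ↭ A ++ [ v ] → ∃[ A′ ] (Through A′ × A′ ↭ A)
      repair {A} w perm with inner w
      ... | A′ , refl = A′ , w , ∷ʳ-cancel-↭ A′ A perm

      -- The sequence u ... c d ... p | q ... v becomes u ... c p ... d q ... v: the segment from
      -- `d` to `p` is reversed, which keeps the vertex set.
      repair-front : ∀ {A} (b : Broken p q A) → Crossing q p u (Broken.L₁ b) p →
        ∃[ A′ ] (Through A′ × A′ ↭ A)
      repair-front {A} (broken {L₂ = L₂} _ back split) (crossing {K₁} {K₂} {c} {d} w₁ w₂ pc qd refl)
        with reverse-walk R-sym w₂
      ... | K , w , perm = repair (w₁ ++ʷ R-sym pc ∷ w ++ʷ R-sym qd ∷ back)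
        (↭-trans (↭-solve 4 (λ K₁ pK q L₂ → K₁ ⊕ pK ⊕ q ⊕ L₂ ⊜ pK ⊕ K₁ ⊕ q ⊕ L₂) ↭-refl K₁ (p ∷ K) [ q ] L₂)
        (↭-trans (++⁺ʳ (K₁ ++ q ∷ L₂) perm)
        (↭-trans (↭-solve 4 (λ K₁ dK q L₂ → dK ⊕ K₁ ⊕ q ⊕ L₂ ⊜ (K₁ ⊕ dK) ⊕ q ⊕ L₂) ↭-refl K₁ (d ∷ K₂) [ q ] L₂)
          (↭-reflexive (sym split)))))

      -- The mirror image behind the cut: u ... p | q ... c d ... v becomes u ... p c ... q d ... v.
      repair-back : ∀ {A} (b : Broken p q A) → Crossing q p q (Broken.L₂ b) v →
        ∃[ A′ ] (Through A′ × A′ ↭ A)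
      repair-back {A} (broken {L₁} front _ split) (crossing {K₁} {K₂} {c} {d} w₁ w₂ pc qd refl)
        with reverse-walk R-sym w₁
      ... | K , w , perm = repair (front ++ʷ pc ∷ w ++ʷ qd ∷ w₂)
        (↭-trans (++⁺ˡ L₁ (++⁺ʳ (d ∷ K₂) perm)) (↭-reflexive (sym split)))

      record Exchanged (L₁ L₂ K₁ K₂ : List V) (d : V) (A B : List V) : Set where
        constructor exchanged
        field
          {A′ B′} : List V
          walkA  : Through A′
          walkB  : Through B′
          splitA : L₁ ++ d ∷ K₂ ≡ A′ ++ [ v ]
          splitB : K₁ ++ q ∷ L₂ ≡ B′ ++ [ v ]
          perm   : A′ ++ B′ ↭ A ++ B

      -- The tails are swapped: u ... p continues with d ... v, and u ... c with q ... v. Unlike a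
      -- repair inside one walk, this can leave a walk without internal vertices, so the splits are
      -- returned as evidence about emptiness.
      exchange : ∀ {A B} (b : Broken p q A) (x : Crossing p q u (B ++ [ v ]) v) →
        Exchanged (Broken.L₁ b) (Broken.L₂ b) (Crossing.K₁ x) (Crossing.K₂ x) (Crossing.d x) A B
      exchange {A} {B} (broken {L₁} {L₂} front back split) (crossing {K₁} {K₂} {c} {d} w₁ w₂ qc pd split′)
        with inner (front ++ʷ pd ∷ w₂) | inner (w₁ ++ʷ R-sym qc ∷ back)
      ... | A′ , eqA | B′ , eqB = exchanged
        (through (front ++ʷ pd ∷ w₂) eqA) (through (w₁ ++ʷ R-sym qc ∷ back) eqB) eqA eqB
        (drop-∷ (drop-∷ (↭-trans (↭-sym (both A′ B′)) (↭-trans crossed (both A B)))))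
        where
        both : ∀ A B → (A ++ [ v ]) ++ B ++ [ v ] ↭ v ∷ v ∷ A ++ B
        both A B = ↭-solve 3 (λ v A B → (A ⊕ v) ⊕ B ⊕ v ⊜ v ⊕ v ⊕ A ⊕ B) ↭-refl [ v ] A B
        crossed : (A′ ++ [ v ]) ++ B′ ++ [ v ] ↭ (A ++ [ v ]) ++ B ++ [ v ]
        crossed = ↭-trans (↭-reflexive (sym (cong₂ _++_ eqA eqB)))
          (↭-trans (↭-solve 4 (λ L₁ dK₂ K₁ qL₂ →
                      (L₁ ⊕ dK₂) ⊕ K₁ ⊕ qL₂ ⊜ (L₁ ⊕ qL₂) ⊕ K₁ ⊕ dK₂) ↭-refl L₁ (d ∷ K₂) K₁ (q ∷ L₂))
                   (↭-reflexive (sym (cong₂ _++_ split split′))))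

      -- If both new walks were the edge uv, then d = v = q, so p would be joined to q.
      exchange-nonempty : ∀ {L₁ L₂ K₁ K₂ d A B} → R p d →
        (e : Exchanged L₁ L₂ K₁ K₂ d A B) → ¬ (Exchanged.A′ e ≡ [] × Exchanged.B′ e ≡ [])
      exchange-nonempty pd (exchanged _ _ sA sB _) (refl , refl) =
        ¬pq (subst (R p) (trans (single _ sA) (sym (single _ sB))) pd)
        where
        single : ∀ L {x M} → L ++ x ∷ M ≡ [ v ] → x ≡ v
        single []          refl = refl
        single (_ ∷ [])    ()
        single (_ ∷ _ ∷ _) ()

      snoc-long : ∀ {A : List V} L {x} M → L ++ x ∷ M ++ [ v ] ≡ A ++ [ v ] → A ≢ []
      snoc-long []          []      () refl
      snoc-long []          (_ ∷ _) () refl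
      snoc-long (_ ∷ [])    _       () refl
      snoc-long (_ ∷ _ ∷ _) _       () refl

      snoc-long′ : ∀ {B : List V} {c x} K {L} → c ∷ K ++ x ∷ L ≡ B ++ [ v ] → B ≢ []
      snoc-long′ []      () refl
      snoc-long′ (_ ∷ _) () refl

      Rewired : List V → List (List V) → Set
      Rewired A Cs = ∃[ A′ ] ∃[ Cs′ ] (Through A′ × A′ ≢ [] × All Through Cs′ × All (_≢ []) Cs′
        × length Cs′ ≡ length Cs × A′ ++ concat Cs′ ↭ A ++ concat Cs)

      -- Only steps between internal vertices are tried, so both new walks keep an internal vertex:
      -- one contains `d`, the other starts with `c`. With m internal vertices there are m - 1 such
      -- steps, and the remaining tests of `q` at the last and `p` at the first internal vertex add
      -- at most 2, whence m + 1.
      scan-other : ∀ {A c C} → Broken p q A → Through (c ∷ C) →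
        Rewired A [ c ∷ C ] ⊎ nbrs q (c ∷ C) + nbrs p (c ∷ C) ≤ suc (length (c ∷ C))
      scan-other {A} {c} {C} b (r ∷ w) with unsnoc-walk C w
      ... | z , w′ , zv , _ with scan p q w′
      ... | inj₂ le = inj₂ (begin
          (ind q c + nbrs q C) + (ind p c + nbrs p C)
            ≡⟨ solve 4 (λ a b c d → (a :+ b) :+ (c :+ d) := (a :+ (b :+ d)) :+ c) refl
                 (ind q c) (nbrs q C) (ind p c) (nbrs p C) ⟩
          (ind q c + (nbrs q C + nbrs p C)) + ind p c
            ≤⟨ +-mono-≤ (≤-trans le (+-monoʳ-≤ (length C) (ind≤1 q z))) (ind≤1 p c) ⟩
          length C + 1 + 1
            ≡⟨ solve 1 (λ l → l :+ con 1 :+ con 1 := con 1 :+ (con 1 :+ l)) refl (length C) ⟩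
          suc (suc (length C)) ∎)
        where open ≤-Reasoning
              open +-*-Solver
      ... | inj₁ (crossing {K₁} {K₂} {_} {d} w₁ w₂ qc pd refl) = inj₁ (found (exchange b x))
        where
        x : Crossing p q u ((c ∷ K₁ ++ d ∷ K₂) ++ [ v ]) v
        x = crossing (r ∷ w₁) (w₂ ++ʷ zv ∷ []) qc pd (cong (c ∷_) (++-assoc K₁ (d ∷ K₂) [ v ]))
        found : Exchanged (Broken.L₁ b) (Broken.L₂ b) (c ∷ K₁) (K₂ ++ [ v ]) d A (c ∷ K₁ ++ d ∷ K₂) →
          Rewired A [ c ∷ K₁ ++ d ∷ K₂ ]
        found (exchanged {A′} {B′} wA wB sA sB perm) = A′ , [ B′ ] , wA ,
          snoc-long (Broken.L₁ b) K₂ sA , wB ∷ [] , snoc-long′ K₁ sB ∷ [] , refl ,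
          ↭-trans (↭-reflexive (cong (A′ ++_) (++-identityʳ B′)))
            (↭-trans perm (↭-reflexive (cong (A ++_) (sym (++-identityʳ _)))))

      scan-others : ∀ {A} Cs → Broken p q A → All Through Cs → All (_≢ []) Cs →
        Rewired A Cs ⊎ nbrs q (concat Cs) + nbrs p (concat Cs) ≤ length (concat Cs) + length Cs
      scan-others [] b [] [] = inj₂ z≤n
      scan-others ([] ∷ Cs) b _ (ne ∷ _) = contradiction refl ne
      scan-others {A} ((c ∷ C) ∷ Cs) b (w ∷ ws) (_ ∷ nes) with scan-other b w
      ... | inj₁ (A′ , Cs′ , wA , ne , ws′ , nes′ , len , perm) =
        inj₁ (A′ , Cs′ ++ Cs , wA , ne , All++ ws′ ws , All++ nes′ nes ,
              trans (length-++ Cs′) (cong (_+ length Cs) len) ,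
              ↭-trans (↭-reflexive (cong (A′ ++_) (sym (concat-++ Cs′ Cs))))
                (↭-trans (↭-reflexive (sym (++-assoc A′ _ _)))
                  (↭-trans (++⁺ʳ (concat Cs) perm)
                    (↭-reflexive (trans (++-assoc A _ _)
                      (cong (λ X → A ++ X ++ concat Cs) (++-identityʳ (c ∷ C))))))))
      ... | inj₂ le with scan-others Cs b ws nes
      ...   | inj₁ (A′ , Cs′ , wA , ne , ws′ , nes′ , len , perm) =
        inj₁ (A′ , (c ∷ C) ∷ Cs′ , wA , ne , w ∷ ws′ , (λ ()) ∷ nes′ , cong suc len ,
              ↭-trans (front-swap A′ (concat Cs′))
                (↭-trans (++⁺ˡ (c ∷ C) perm) (↭-sym (front-swap A (concat Cs)))))
        where
        front-swap : ∀ X Y → X ++ (c ∷ C) ++ Y ↭ (c ∷ C) ++ X ++ Y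
        front-swap X Y = ↭-solve 3 (λ X D Y → X ⊕ D ⊕ Y ⊜ D ⊕ X ⊕ Y) ↭-refl X (c ∷ C) Y
      ...   | inj₂ le′ = inj₂ (begin
          nbrs q ((c ∷ C) ++ concat Cs) + nbrs p ((c ∷ C) ++ concat Cs)
            ≡⟨ cong₂ _+_ (nbrs-++ q (c ∷ C) _) (nbrs-++ p (c ∷ C) _) ⟩
          (nbrs q (c ∷ C) + nbrs q (concat Cs)) + (nbrs p (c ∷ C) + nbrs p (concat Cs))
            ≡⟨ solve 4 (λ a b c d → (a :+ b) :+ (c :+ d) := (a :+ c) :+ (b :+ d)) refl
                 (nbrs q (c ∷ C)) (nbrs q (concat Cs)) (nbrs p (c ∷ C)) (nbrs p (concat Cs)) ⟩
          (nbrs q (c ∷ C) + nbrs p (c ∷ C)) + (nbrs q (concat Cs) + nbrs p (concat Cs))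
            ≤⟨ +-mono-≤ le le′ ⟩
          suc (length (c ∷ C)) + (length (concat Cs) + length Cs)
            ≡⟨ solve 3 (λ a b c → con 1 :+ a :+ (b :+ c) := (a :+ b) :+ (con 1 :+ c)) refl
                 (length (c ∷ C)) (length (concat Cs)) (length Cs) ⟩
          (length (c ∷ C) + length (concat Cs)) + suc (length Cs)
            ≡⟨ cong (_+ suc (length Cs)) (sym (length-++ (c ∷ C))) ⟩
          length ((c ∷ C) ++ concat Cs) + suc (length Cs) ∎)
        where open ≤-Reasoning
              open +-*-Solver using (solve; _:+_; con; _:=_)

    pack : ∀ {vs A B Cs} → Through A → Through B → ¬ (A ≡ [] × B ≡ []) →
      All Through Cs → All (_≢ []) Cs → u ∷ v ∷ A ++ B ++ concat Cs ↭ vs →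
      Container R vs u v (2 + length Cs)
    pack {A = A} {[]} {Cs} wA wB ne ws nes perm =
      container {first = []} {A ∷ Cs} wB (wA ∷ ws) ((λ A≡[] → ne (A≡[] , refl)) ∷ nes) refl perm
    pack {A = A} {b ∷ B} {Cs} wA wB ne ws nes perm =
      container wA (wB ∷ ws) ((λ ()) ∷ nes) refl perm

    pack-replaced : ∀ {vs A B Cs} → ∃[ A′ ] (Through A′ × A′ ↭ A) → Through B →
      ¬ (A ≡ [] × B ≡ []) → All Through Cs → All (_≢ []) Cs →
      u ∷ v ∷ A ++ B ++ concat Cs ↭ vs → Container R vs u v (2 + length Cs)
    pack-replaced (A′ , wA′ , A′↭A) wB ne ws nes perm = pack wA′ wB
      (λ { (refl , B≡[]) → ne (↭-empty-inv (↭-sym A′↭A) , B≡[]) }) ws nes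
      (↭-trans (prep u (prep v (++⁺ʳ _ A′↭A))) perm)

    -- `A` is the cut walk and `B` the one partner scanned along its full length; at most one of the
    -- two may be a bare edge. If all four scans fail, their bounds add up to `length vs` + t - 3
    -- with t = 2 + `length Cs`, one less than `large` requires of the two degrees.
    mend : ∀ {vs p q A B} Cs → ¬ R p q → Broken p q A → Through B → ¬ (A ≡ [] × B ≡ []) →
      All Through Cs → All (_≢ []) Cs → u ∷ v ∷ A ++ B ++ concat Cs ↭ vs →
      length vs + (2 + length Cs) ≤ nbrs p vs + nbrs q vs + 2 →
      Container R vs u v (2 + length Cs)
    mend {vs} {p} {q} {A} {B} Cs ¬pq b wB ne ws nes perm large
      with scan q p (Broken.front b) | scan q p (Broken.back b) | scan p q wB | scan-others ¬pq Cs b ws nes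
    ... | inj₁ x | _ | _ | _ = pack-replaced (repair-front ¬pq b x) wB ne ws nes perm
    ... | inj₂ _ | inj₁ x | _ | _ = pack-replaced (repair-back ¬pq b x) wB ne ws nes perm
    ... | inj₂ _ | inj₂ _ | inj₁ x | _ = mend-two (exchange ¬pq b x)
      where
      mend-two : Exchanged ¬pq _ _ _ _ (Crossing.d x) A B → Container R vs u v (2 + length Cs)
      mend-two e@(exchanged {A′} {B′} wA′ wB′ _ _ p) =
        pack wA′ wB′ (exchange-nonempty ¬pq (Crossing.pRd x) e) ws nes
          (↭-trans (prep u (prep v (regroup A′ B′ p))) perm)
        where
        regroup : ∀ A′ B′ → A′ ++ B′ ↭ A ++ B → A′ ++ B′ ++ concat Cs ↭ A ++ B ++ concat Cs
        regroup A′ B′ p = ↭-trans (↭-reflexive (sym (++-assoc A′ B′ _)))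
          (↭-trans (++⁺ʳ (concat Cs) p) (↭-reflexive (++-assoc A B _)))
    ... | inj₂ _ | inj₂ _ | inj₂ _ | inj₁ (A′ , Cs′ , wA′ , ne′ , ws′ , nes′ , len , p) =
      subst (λ k → Container R vs u v (2 + k)) len
        (pack wA′ wB (λ (A′≡[] , _) → ne′ A′≡[]) ws′ nes′
          (↭-trans (prep u (prep v (↭-trans (pull A′ (concat Cs′))
            (↭-trans (++⁺ˡ B p) (↭-sym (pull A (concat Cs))))))) perm))
      where
      pull : ∀ X Y → X ++ B ++ Y ↭ B ++ X ++ Y
      pull X Y = ↭-solve 3 (λ X B Y → X ⊕ B ⊕ Y ⊜ B ⊕ X ⊕ Y) ↭-refl X B Y
    ... | inj₂ le₁ | inj₂ le₂ | inj₂ le₃ | inj₂ le₄ = ⊥-elim (<-irrefl refl (≤-trans contra-bound large))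
      where
      open Broken b
      open ≤-Reasoning
      open +-*-Solver using (solve; _:+_; con; _:=_)
      C = concat Cs

      nbrs-split : ∀ a → nbrs a A + ind a v ≡ nbrs a L₁ + (ind a q + nbrs a L₂)
      nbrs-split a = trans (cong (nbrs a A +_) (sym (+-identityʳ _)))
        (trans (sym (nbrs-++ a A [ v ])) (trans (cong (nbrs a) split) (nbrs-++ a L₁ (q ∷ L₂))))

      length-split : length A ≡ length L₁ + length L₂
      length-split = suc-injective (trans (+-comm 1 (length A)) (trans (sym (length-++ A))
        (trans (cong length split) (trans (length-++ L₁) (+-suc (length L₁) (length L₂))))))

      nbrs-vs : ∀ a → nbrs a vs ≡ ind a u + (ind a v + (nbrs a A + (nbrs a B + nbrs a C)))
      nbrs-vs a = trans (sym (sum-↭ (map⁺ (ind a) perm)))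
        (cong (λ X → ind a u + (ind a v + X))
          (trans (nbrs-++ a A (B ++ C)) (cong (nbrs a A +_) (nbrs-++ a B C))))

      length-vs : length vs ≡ 2 + (length A + (length B + length C))
      length-vs = trans (sym (↭-length perm)) (cong (2 +_)
        (trans (length-++ A) (cong (length A +_) (length-++ B))))

      -- The two pieces have as many steps together as `A` has vertices. The tests of `p` at the end
      -- of the front and of `q` at the start of the back are tests of a vertex against itself and
      -- vanish by irreflexivity; `ind p v` is added on both sides to complete the count over
      -- `A ++ [ v ]`.
      le-A : ind p u + nbrs p A + (nbrs q A + ind q v) ≤ length A
      le-A = +-cancelʳ-≤ (ind p v) _ _ (begin
        ind p u + nbrs p A + (nbrs q A + ind q v) + ind p v
          ≡⟨ solve 4 (λ a b c d → a :+ b :+ c :+ d := a :+ (b :+ d) :+ c) refl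
               (ind p u) (nbrs p A) (nbrs q A + ind q v) (ind p v) ⟩
        ind p u + (nbrs p A + ind p v) + (nbrs q A + ind q v)
          ≡⟨ cong₂ (λ X Y → ind p u + X + Y) (nbrs-split p) (nbrs-split q) ⟩
        ind p u + (nbrs p L₁ + (ind p q + nbrs p L₂)) + (nbrs q L₁ + (ind q q + nbrs q L₂))
          ≡⟨ cong (λ X → ind p u + (nbrs p L₁ + (ind p q + nbrs p L₂)) + (nbrs q L₁ + (X + nbrs q L₂)))
               (ind-no R-irrefl) ⟩
        ind p u + (nbrs p L₁ + (ind p q + nbrs p L₂)) + (nbrs q L₁ + nbrs q L₂)
          ≡⟨ solve 6 (λ a b c d e f → a :+ (b :+ (c :+ d)) :+ (e :+ f) := (a :+ (b :+ e)) :+ (c :+ (d :+ f)))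
               refl (ind p u) (nbrs p L₁) (ind p q) (nbrs p L₂) (nbrs q L₁) (nbrs q L₂) ⟩
        (ind p u + (nbrs p L₁ + nbrs q L₁)) + (ind p q + (nbrs p L₂ + nbrs q L₂))
          ≤⟨ +-mono-≤ le₁ le₂ ⟩
        length L₁ + ind p p + (length L₂ + ind p v)
          ≡⟨ cong (λ X → length L₁ + X + (length L₂ + ind p v)) (ind-no R-irrefl) ⟩
        length L₁ + 0 + (length L₂ + ind p v)
          ≡⟨ solve 3 (λ a b c → a :+ con 0 :+ (b :+ c) := a :+ b :+ c) refl (length L₁) (length L₂) (ind p v) ⟩
        length L₁ + length L₂ + ind p v
          ≡⟨ cong (_+ ind p v) (sym length-split) ⟩
        length A + ind p v ∎)

      le-B : ind q u + ind p v + (nbrs q B + nbrs p B) ≤ suc (length B)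
      le-B = +-cancelʳ-≤ (ind q v) _ _ (begin
        ind q u + ind p v + (nbrs q B + nbrs p B) + ind q v
          ≡⟨ solve 5 (λ a b c d e → a :+ b :+ (c :+ d) :+ e := a :+ ((c :+ (e :+ con 0)) :+ (d :+ (b :+ con 0))))
               refl (ind q u) (ind p v) (nbrs q B) (nbrs p B) (ind q v) ⟩
        ind q u + ((nbrs q B + nbrs q [ v ]) + (nbrs p B + nbrs p [ v ]))
          ≡⟨ cong₂ (λ X Y → ind q u + (X + Y)) (sym (nbrs-++ q B [ v ])) (sym (nbrs-++ p B [ v ])) ⟩
        ind q u + (nbrs q (B ++ [ v ]) + nbrs p (B ++ [ v ]))
          ≤⟨ le₃ ⟩
        length (B ++ [ v ]) + ind q v
          ≡⟨ cong (_+ ind q v) (trans (length-++ B) (+-comm (length B) 1)) ⟩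
        suc (length B) + ind q v ∎)

      contra-bound : suc (nbrs p vs + nbrs q vs + 2) ≤ length vs + (2 + length Cs)
      contra-bound = begin
        suc (nbrs p vs + nbrs q vs + 2)
          ≡⟨ cong₂ (λ X Y → suc (X + Y + 2)) (nbrs-vs p) (nbrs-vs q) ⟩
        suc (ind p u + (ind p v + (nbrs p A + (nbrs p B + nbrs p C)))
           + (ind q u + (ind q v + (nbrs q A + (nbrs q B + nbrs q C)))) + 2)
          ≡⟨ solve 10 (λ pu pv pA pB pC qu qv qA qB qC →
               con 1 :+ (pu :+ (pv :+ (pA :+ (pB :+ pC))) :+ (qu :+ (qv :+ (qA :+ (qB :+ qC)))) :+ con 2)
               := con 3 :+ (pu :+ pA :+ (qA :+ qv)) :+ (qu :+ pv :+ (qB :+ pB)) :+ (qC :+ pC)) refl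
               (ind p u) (ind p v) (nbrs p A) (nbrs p B) (nbrs p C)
               (ind q u) (ind q v) (nbrs q A) (nbrs q B) (nbrs q C) ⟩
        3 + (ind p u + nbrs p A + (nbrs q A + ind q v))
          + (ind q u + ind p v + (nbrs q B + nbrs p B)) + (nbrs q C + nbrs p C)
          ≤⟨ +-mono-≤ (+-mono-≤ (+-monoʳ-≤ 3 le-A) le-B) le₄ ⟩
        3 + length A + suc (length B) + (length C + length Cs)
          ≡⟨ solve 4 (λ a b c d → con 3 :+ a :+ (con 1 :+ b) :+ (c :+ d)
               := (con 2 :+ (a :+ (b :+ c))) :+ (con 2 :+ d)) refl
               (length A) (length B) (length C) (length Cs) ⟩
        2 + (length A + (length B + length C)) + (2 + length Cs)
          ≡⟨ cong (_+ (2 + length Cs)) (sym length-vs) ⟩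
        length vs + (2 + length Cs) ∎

-- Adding an edge between vertices of large degree sum creates no new containers.

module Stability where
  open Walks
  open Rewirings
  open import Data.List.Base using (List; []; _∷_; [_]; _++_; concat; length)
  open import Data.List.Properties using (++-assoc; ∷-injectiveˡ; ∷-injectiveʳ)
  open import Data.List.Membership.Propositional using (_∈_; _∉_)
  open import Data.List.Membership.Propositional.Properties
    using (∈-++⁺ˡ; ∈-++⁺ʳ; ∈-++⁻; ∈-insert; ∈-concat⁺′)
  open import Data.List.Relation.Unary.All using (All; []; _∷_; lookup)
  import Data.List.Relation.Unary.All as All
  open import Data.List.Relation.Unary.AllPairs using (_∷_)
  open import Data.List.Relation.Unary.Any using (here; there)
  open import Data.List.Relation.Unary.Unique.Propositional using (Unique)
  open import Data.List.Relation.Binary.Permutation.Propositional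
    using (_↭_; refl; prep; swap; trans; ↭-refl; ↭-sym; ↭-trans; ↭-reflexive; ↭⇒↭ₛ)
  open import Data.List.Relation.Binary.Permutation.Propositional.Properties
    using (++⁺ˡ; shifts; ↭-length; All-resp-↭)
  import Data.List.Relation.Binary.Permutation.Setoid.Properties as ↭ₛ
  open import Data.Nat.Base
  open import Data.Nat.Properties hiding (_≟_)
  open import Data.Product.Base using (_×_; _,_)
  open import Data.Sum.Base using (_⊎_; inj₁; inj₂)
  open import Data.Empty using (⊥-elim)
  open import Level using (0ℓ)
  open import Relation.Binary.Core using (Rel)
  open import Relation.Binary.Definitions using (Decidable; Symmetric)
  open import Relation.Binary.PropositionalEquality hiding ([_]; trans)
  import Relation.Binary.PropositionalEquality as ≡
  open import Relation.Nullary using (¬_; contradiction)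
  open ↭-Solver using (_⊕_; _⊜_) renaming (solve to ↭-solve)

  unique-resp-↭ : ∀ {V : Set} {L M : List V} → L ↭ M → Unique L → Unique M
  unique-resp-↭ {V} p = ↭ₛ.Unique-resp-↭ (setoid V) (↭⇒↭ₛ p)

  unique-++-disjoint : ∀ {V : Set} (L : List V) {M} → Unique (L ++ M) → ∀ {w} → w ∈ L → w ∉ M
  unique-++-disjoint (_ ∷ L) (w≢ ∷ _) (here refl) w∈M = lookup w≢ (∈-++⁺ʳ L w∈M) refl
  unique-++-disjoint (_ ∷ L) (_ ∷ uq) (there w∈L) w∈M = unique-++-disjoint L uq w∈L w∈M

  ∈-before-split : ∀ {V : Set} {v q : V} A L₁ {L₂} → A ++ [ v ] ≡ L₁ ++ q ∷ L₂ →
    ∀ {w} → w ∈ L₁ → w ∈ A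
  ∈-before-split []      (_ ∷ [])    ()
  ∈-before-split []      (_ ∷ _ ∷ _) ()
  ∈-before-split (_ ∷ A) (_ ∷ L₁) eq (here refl) = here (sym (∷-injectiveˡ eq))
  ∈-before-split (_ ∷ A) (_ ∷ L₁) eq   (there w∈)  =
    there (∈-before-split A L₁ (∷-injectiveʳ eq) w∈)

  concat-↭ : ∀ {V : Set} {Ls Ms : List (List V)} → Ls ↭ Ms → concat Ls ↭ concat Ms
  concat-↭ refl         = ↭-refl
  concat-↭ (prep L p)   = ++⁺ˡ L (concat-↭ p)
  concat-↭ (swap L M p) = ↭-trans (shifts L M) (++⁺ˡ M (++⁺ˡ L (concat-↭ p)))
  concat-↭ (trans p q)  = ↭-trans (concat-↭ p) (concat-↭ q)

  AddEdge : ∀ {V : Set} → V → V → Rel V 0ℓ → Rel V 0ℓ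
  AddEdge x y R a b = R a b ⊎ (a ≡ x × b ≡ y ⊎ a ≡ y × b ≡ x)

  module _ {V : Set} {R : Rel V 0ℓ} (R? : Decidable R) (R-sym : Symmetric R)
           (R-irrefl : ∀ {a} → ¬ R a a) {u v : V} (u≢v : u ≢ v)
           {x y : V} (¬xy : ¬ R x y) where
    open Counting R?

    R⁺ : Rel V 0ℓ
    R⁺ = AddEdge x y R

    NewEdge : Rel V 0ℓ
    NewEdge a b = a ≡ x × b ≡ y ⊎ a ≡ y × b ≡ x

    -- The split is at the earliest new step, so `front` is a walk in the old relation while `back`
    -- may still use the new edge.
    record Uses (a : V) (L : List V) (b : V) : Set where
      constructor uses
      field
        {p q}   : V
        {L₁ L₂} : List V
        front   : Walk R a L₁ p
        new     : NewEdge p q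
        back    : Walk R⁺ q L₂ b
        split   : L ≡ L₁ ++ q ∷ L₂

      p∈ : p ∈ a ∷ L₁
      p∈ = last∈ front

      q∈ : q ∈ L
      q∈ = subst (q ∈_) (sym split) (∈-insert L₁)

    uses? : ∀ {a L b} → Walk R⁺ a L b → Walk R a L b ⊎ Uses a L b
    uses? []             = inj₁ []
    uses? (inj₂ new ∷ w) = inj₂ (uses [] new w refl)
    uses? (inj₁ r ∷ w) with uses? w
    ... | inj₁ w′ = inj₁ (r ∷ w′)
    ... | inj₂ (uses front new back eq) = inj₂ (uses (r ∷ front) new back (cong (_ ∷_) eq))

    same-ends : ∀ {p q p′ q′} → NewEdge p q → NewEdge p′ q′ →
      (p′ ≡ p × q′ ≡ q) ⊎ (p′ ≡ q × q′ ≡ p)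
    same-ends (inj₁ (refl , refl)) (inj₁ (refl , refl)) = inj₁ (refl , refl)
    same-ends (inj₁ (refl , refl)) (inj₂ (refl , refl)) = inj₂ (refl , refl)
    same-ends (inj₂ (refl , refl)) (inj₁ (refl , refl)) = inj₂ (refl , refl)
    same-ends (inj₂ (refl , refl)) (inj₂ (refl , refl)) = inj₁ (refl , refl)

    avoids : ∀ {p q a L b} → NewEdge p q → p ∉ a ∷ L → Walk R⁺ a L b → Walk R a L b
    avoids new p∉ w with uses? w
    ... | inj₁ w′ = w′
    ... | inj₂ e with same-ends new (Uses.new e)
    ...   | inj₁ (refl , _) = ⊥-elim (p∉ (widen (Uses.p∈ e)))
      where
      widen : ∀ {p} → p ∈ _ ∷ Uses.L₁ e → p ∈ _ ∷ _
      widen (here eq)  = here eq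
      widen (there p∈) = there (subst (_ ∈_) (sym (Uses.split e)) (∈-++⁺ˡ p∈))
    ...   | inj₂ (_ , refl) = ⊥-elim (p∉ (there (Uses.q∈ e)))

    ∈-snoc⁻ : ∀ (A : List V) {w} → w ∈ A ++ [ v ] → w ∈ A ⊎ w ≡ v
    ∈-snoc⁻ A w∈ with ∈-++⁻ A w∈
    ... | inj₁ w∈A         = inj₁ w∈A
    ... | inj₂ (here w≡v)  = inj₂ w≡v

    source∈ : ∀ {A} (e : Uses u (A ++ [ v ]) v) → Uses.p e ≡ u ⊎ Uses.p e ∈ A
    source∈ {A} e with Uses.p∈ e
    ... | here eq   = inj₁ eq
    ... | there p∈  = inj₂ (∈-before-split A (Uses.L₁ e) (Uses.split e) p∈)

    source-inner : ∀ {C} (e : Uses u (C ++ [ v ]) v) → Uses.q e ≡ v → C ≢ [] → v ∉ C → Uses.p e ∈ C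
    source-inner {C} (uses (r ∷ w) _ _ split) _ _ _ = ∈-before-split C _ split (last∈ w)
    source-inner {[]} (uses [] _ _ _) _ C≢[] _ = contradiction refl C≢[]
    source-inner {_ ∷ _} (uses [] _ _ refl) refl _ v∉C = ⊥-elim (v∉C (here refl))

    module _ {A C : List V} (u∉C : u ∉ C) (v∉A : v ∉ A) (v∉C : v ∉ C)
             (disjoint : ∀ {w} → w ∈ A → w ∉ C) where

      -- A second walk can share a new edge with the first one only if that
      -- edge is uv, but then the second walk has no internal vertex.
      used-once : C ≢ [] → Uses u (A ++ [ v ]) v → Walk R⁺ u (C ++ [ v ]) v → Walk R u (C ++ [ v ]) v
      used-once C≢[] e w with uses? w
      ... | inj₁ w′ = w′
      ... | inj₂ e′ with same-ends (Uses.new e) (Uses.new e′)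
      ... | inj₂ (refl , refl) with source∈ e | ∈-snoc⁻ C (Uses.q∈ e′)
      ...   | inj₁ p≡u | inj₁ p∈C = ⊥-elim (u∉C (subst (_∈ C) p≡u p∈C))
      ...   | inj₁ p≡u | inj₂ p≡v = ⊥-elim (u≢v (≡.trans (sym p≡u) p≡v))
      ...   | inj₂ p∈A | inj₁ p∈C = ⊥-elim (disjoint p∈A p∈C)
      ...   | inj₂ p∈A | inj₂ p≡v = ⊥-elim (v∉A (subst (_∈ A) p≡v p∈A))
      used-once C≢[] e w | inj₂ e′ | inj₁ (refl , refl) with ∈-snoc⁻ A (Uses.q∈ e) | ∈-snoc⁻ C (Uses.q∈ e′)
      ...   | inj₁ q∈A | inj₁ q∈C = ⊥-elim (disjoint q∈A q∈C)
      ...   | inj₁ q∈A | inj₂ q≡v = ⊥-elim (v∉A (subst (_∈ A) q≡v q∈A))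
      ...   | inj₂ q≡v | inj₁ q∈C = ⊥-elim (v∉C (subst (_∈ C) q≡v q∈C))
      ...   | inj₂ q≡v | inj₂ _ with source∈ e
      ...     | inj₁ p≡u = ⊥-elim (u∉C (subst (_∈ C) p≡u (source-inner e′ q≡v C≢[] v∉C)))
      ...     | inj₂ p∈A = ⊥-elim (disjoint p∈A (source-inner e′ q≡v C≢[] v∉C))

    module _ {A : List V} (Cs : List (List V)) (uq : Unique (u ∷ v ∷ A ++ concat Cs))
             (e : Uses u (A ++ [ v ]) v) where
      open Uses e

      used-once-all : ∀ {C} → C ∈ Cs → Walk R⁺ u (C ++ [ v ]) v → C ≢ [] → Walk R u (C ++ [ v ]) v
      used-once-all {C} C∈ w ne = used-once
        (λ u∈ → ends (here refl) (∈-++⁺ʳ A (inside u∈)))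
        (λ v∈ → ends (there (here refl)) (∈-++⁺ˡ v∈))
        (λ v∈ → ends (there (here refl)) (∈-++⁺ʳ A (inside v∈)))
        (λ w∈A w∈C → unique-++-disjoint (u ∷ v ∷ A) uq (there (there w∈A)) (inside w∈C)) ne e w
        where
        inside : ∀ {w} → w ∈ C → w ∈ concat Cs
        inside w∈C = ∈-concat⁺′ w∈C C∈
        ends : ∀ {w} → w ∈ u ∷ v ∷ [] → w ∉ A ++ concat Cs
        ends = unique-++-disjoint (u ∷ v ∷ []) uq

      -- Another use of the new edge, in either direction, would visit `p` again. Since the vertices
      -- are distinct, the part behind the cut avoids `p` and hence lies in the old relation.
      break : Broken R? R-sym R-irrefl u≢v p q A
      break = broken front (avoids new p∉ back) split
        where
        unique-walk : Unique ((u ∷ L₁) ++ (q ∷ L₂) ++ concat Cs)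
        unique-walk = unique-resp-↭ (↭-trans
          (↭-solve 4 (λ u v A X → u ⊕ v ⊕ A ⊕ X ⊜ u ⊕ (A ⊕ v) ⊕ X) ↭-refl [ u ] [ v ] A (concat Cs))
          (↭-reflexive (cong (u ∷_) (≡.trans (cong (_++ concat Cs) split) (++-assoc L₁ (q ∷ L₂) _))))) uq
        p∉ : p ∉ q ∷ L₂
        p∉ p∈q∷L₂ = unique-++-disjoint (u ∷ L₁) unique-walk p∈ (∈-++⁺ˡ p∈q∷L₂)

      ¬pq : ¬ R p q
      ¬pq with new
      ... | inj₁ (refl , refl) = ¬xy
      ... | inj₂ (refl , refl) = λ yx → ¬xy (R-sym yx)

      degrees : ∀ vs → nbrs x vs + nbrs y vs ≡ nbrs p vs + nbrs q vs
      degrees vs with new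
      ... | inj₁ (refl , refl) = refl
      ... | inj₂ (refl , refl) = +-comm (nbrs x vs) (nbrs y vs)

    record UsesAll (Cs : List (List V)) : Set where
      constructor usesAll
      field
        {C}    : List V
        {Rest} : List (List V)
        perm   : C ∷ Rest ↭ Cs
        use    : Uses u (C ++ [ v ]) v

    usesAll? : ∀ {Cs} → All (λ C → Walk R⁺ u (C ++ [ v ]) v) Cs →
      All (λ C → Walk R u (C ++ [ v ]) v) Cs ⊎ UsesAll Cs
    usesAll? [] = inj₁ []
    usesAll? (w ∷ ws) with uses? w
    ... | inj₂ e = inj₂ (usesAll ↭-refl e)
    ... | inj₁ w′ with usesAll? ws
    ...   | inj₁ ws′ = inj₁ (w′ ∷ ws′)
    ...   | inj₂ (usesAll perm e) = inj₂ (usesAll (↭-trans (swap _ _ ↭-refl) (prep _ perm)) e)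

    all-used-once : ∀ {Cs : List (List V)} →
      (∀ {C} → C ∈ Cs → Walk R⁺ u (C ++ [ v ]) v → C ≢ [] → Walk R u (C ++ [ v ]) v) →
      All (λ C → Walk R⁺ u (C ++ [ v ]) v) Cs → All (_≢ []) Cs → All (λ C → Walk R u (C ++ [ v ]) v) Cs
    all-used-once f []       []         = []
    all-used-once f (w ∷ ws) (ne ∷ nes) = f (here refl) w ne ∷ all-used-once (λ C∈ → f (there C∈)) ws nes

    -- An analogue of the Bondy-Chvátal stability argument. Disjointness lets at most one walk use
    -- the new edge, so a single cut removes it; `2 ≤ t` provides the partner that the cut walk
    -- needs for an exchange.
    container-stable : ∀ {vs t} → Unique vs → 2 ≤ t → length vs + t ≤ nbrs x vs + nbrs y vs + 2 →
      Container R⁺ vs u v t → Container R vs u v t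
    container-stable uq (s≤s ()) large (container {others = []} _ _ _ refl _)
    container-stable {vs} uq 2≤t large (container {A} {B ∷ Cs} wA (wB ∷ ws) (ne ∷ nes) refl covers) with uses? wA
    ... | inj₂ e = mend R? R-sym R-irrefl u≢v Cs (¬pq (B ∷ Cs) uq′ e) (break (B ∷ Cs) uq′ e)
            (once (here refl) wB ne) (λ (_ , B≡[]) → ne B≡[])
            (all-used-once (λ C∈ → once (there C∈)) ws nes) nes covers
            (subst (λ d → length vs + (2 + length Cs) ≤ d + 2) (degrees (B ∷ Cs) uq′ e vs) large)
      where
      uq′ = unique-resp-↭ (↭-sym covers) uq
      once = used-once-all (B ∷ Cs) uq′ e
    ... | inj₁ wA′ with usesAll? (wB ∷ ws)
    ...   | inj₁ (wB′ ∷ ws′) = container wA′ (wB′ ∷ ws′) (ne ∷ nes) refl covers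
    -- The cut walk is now one of the nonempty ones, and the head, possibly the bare edge, becomes
    -- the partner scanned in full.
    ...   | inj₂ (usesAll {C} {Rest} perm e) = subst (Container R vs u v) size
            (mend R? R-sym R-irrefl u≢v Rest (¬pq (A ∷ Rest) uq′ e) (break (A ∷ Rest) uq′ e)
              wA′ (λ (C≡[] , _) → All.head nes′ C≡[])
              (all-used-once (λ C∈ → used-once-all (A ∷ Rest) uq′ e (there C∈)) (All.tail ws′) (All.tail nes′))
              (All.tail nes′) covers′
              (subst₂ (λ k d → length vs + k ≤ d + 2) (sym size) (degrees (A ∷ Rest) uq′ e vs) large))
      where
      ws′ = All-resp-↭ (↭-sym perm) (wB ∷ ws)
      nes′ = All-resp-↭ (↭-sym perm) (ne ∷ nes)
      size : 2 + length Rest ≡ 2 + length Cs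
      size = cong suc (↭-length perm)
      covers′ : u ∷ v ∷ C ++ concat (A ∷ Rest) ↭ vs
      covers′ = ↭-trans (prep u (prep v (↭-trans
        (↭-solve 3 (λ C A X → C ⊕ A ⊕ X ⊜ A ⊕ C ⊕ X) ↭-refl C A (concat Rest))
        (++⁺ˡ A (concat-↭ perm))))) covers
      uq′ : Unique (u ∷ v ∷ C ++ concat (A ∷ Rest))
      uq′ = unique-resp-↭ (↭-sym covers′) uq

-- Finite sums and indicator functions.

module Sums where
  open import Data.Bool.Base using (if_then_else_)
  open import Data.Fin.Base using (Fin; zero; suc)
  open import Data.Fin.Properties using (_≟_)
  open import Data.List.Base using (tabulate; map; allFin)
  open import Data.List.Properties using (map-tabulate)
  open import Data.Nat.Base
  import Data.Nat.ListAction as List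
  open import Data.Nat.Properties hiding (_≟_)
  open import Data.Product.Base using (∃-syntax; _×_; _,_)
  open import Function.Base using (_∘_; id)
  open import Relation.Binary.PropositionalEquality
  open import Relation.Nullary using (does)
  open import Relation.Nullary.Decidable using (dec-true; dec-false)
  open import Algebra.Properties.Semiring.Sum +-*-semiring public
    using (sum; ∑-comm; ∑-distrib-+; *-distribˡ-sum; *-distribʳ-sum; sum-replicate-zero)
    renaming (sum-cong-≗ to sum-cong)

  kron : ∀ {n} → Fin n → Fin n → ℕ → ℕ
  kron i j a = if does (i ≟ j) then a else 0

  sum-mono : ∀ {n} {f g : Fin n → ℕ} → (∀ i → f i ≤ g i) → sum f ≤ sum g
  sum-mono {zero}  f≤g = z≤n
  sum-mono {suc n} f≤g = +-mono-≤ (f≤g zero) (sum-mono (f≤g ∘ suc))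

  sum-const : ∀ n c → sum {n} (λ _ → c) ≡ n * c
  sum-const zero    c = refl
  sum-const (suc n) c = cong (c +_) (sum-const n c)

  sum-kron : ∀ {n} (f : Fin n → ℕ) j → sum (λ i → kron i j (f i)) ≡ f j
  sum-kron {suc n} f zero = trans (cong (f zero +_) (sum-replicate-zero n)) (+-identityʳ (f zero))
  sum-kron {suc n} f (suc j) = sum-kron (f ∘ suc) j

  kron-yes : ∀ {n} {i j : Fin n} a → i ≡ j → kron i j a ≡ a
  kron-yes {i = i} {j} a i≡j = cong (if_then a else 0) (dec-true (i ≟ j) i≡j)

  kron-no : ∀ {n} {i j : Fin n} a → i ≢ j → kron i j a ≡ 0
  kron-no {i = i} {j} a i≢j = cong (if_then a else 0) (dec-false (i ≟ j) i≢j)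

  sum-allFin : ∀ {n} (f : Fin n → ℕ) → List.sum (map f (allFin n)) ≡ sum f
  sum-allFin {n} f = trans (cong List.sum (map-tabulate {n = n} id f)) (go f)
    where
    go : ∀ {n} (f : Fin n → ℕ) → List.sum (tabulate f) ≡ sum f
    go {zero}  f = refl
    go {suc n} f = cong (f zero +_) (go (f ∘ suc))

  -- The edge estimate is for an exact number of selected vertices, while only a lower bound on the
  -- number of low vertices is available; surplus ones are discarded here.
  sub-indicator : ∀ {n} (τ : Fin n → ℕ) → (∀ i → τ i ≤ 1) → ∀ r → r ≤ sum τ →
    ∃[ σ ] ((∀ i → σ i ≤ τ i) × sum σ ≡ r)
  sub-indicator {zero}  τ τ≤1 zero z≤n = τ , (λ _ → ≤-refl) , refl
  sub-indicator {suc n} τ τ≤1 r r≤ with τ zero in eq | τ≤1 zero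
  ... | zero | _ with sub-indicator (τ ∘ suc) (τ≤1 ∘ suc) r r≤
  ...   | σ , σ≤ , eq′ = (λ { zero → 0 ; (suc i) → σ i }) ,
      (λ { zero → z≤n ; (suc i) → σ≤ i }) , eq′
  sub-indicator {suc n} τ τ≤1 zero r≤ | suc zero | _ =
    (λ _ → 0) , (λ _ → z≤n) , sum-replicate-zero (suc n)
  sub-indicator {suc n} τ τ≤1 (suc r) (s≤s r≤) | suc zero | _
    with sub-indicator (τ ∘ suc) (τ≤1 ∘ suc) r r≤
  ... | σ , σ≤ , eq′ = (λ { zero → 1 ; (suc i) → σ i }) ,
      (λ { zero → ≤-reflexive (sym eq) ; (suc i) → σ≤ i }) , cong suc eq′
  sub-indicator {suc n} τ τ≤1 r r≤ | suc (suc _) | s≤s ()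

-- Degree sums and the edge bound from many vertices of low degree.

module Degrees where
  open import Defs using (Graph; module Graph; degree)
  open Walks using (module Counting)
  open Sums
  open import Data.Fin.Base using (Fin)
  open import Data.Fin.Properties using (_≟_)
  open import Data.List.Base using (List; []; _∷_; filter; length; allFin)
  open import Data.Nat.Base
  open import Data.Nat.Properties hiding (_≟_)
  import Data.Nat.ListAction as List
  open import Data.Product.Base using (∃-syntax; _×_; _,_)
  open import Data.Nat.Solver using (module +-*-Solver)
  open import Relation.Binary.PropositionalEquality
  open import Relation.Nullary using (Dec; does; yes; no; contradiction)
  open import Relation.Nullary.Decidable using (dec-true)
  open import Data.Bool.Base using (if_then_else_)
  open import Data.Sum.Base using (_⊎_; inj₁; inj₂)

  module _ {n : ℕ} (G : Graph n) where
    open Graph G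
    open Counting adj? public

    degree≡nbrs : ∀ a → degree G a ≡ nbrs a (allFin n)
    degree≡nbrs a = go (allFin n)
      where
      go : ∀ L → length (filter (adj? a) L) ≡ nbrs a L
      go [] = refl
      go (b ∷ L) with adj? a b
      ... | yes _ = cong suc (go L)
      ... | no  _ = go L

    degree≡sum : ∀ a → degree G a ≡ sum (ind a)
    degree≡sum a = trans (degree≡nbrs a) (sum-allFin (ind a))

    ind-sym : ∀ a b → ind a b ≡ ind b a
    ind-sym a b with adj? a b | adj? b a
    ... | yes _  | yes _  = refl
    ... | no  _  | no  _  = refl
    ... | yes ab | no ¬ba = contradiction (Adj-sym ab) ¬ba
    ... | no ¬ab | yes ba = contradiction (Adj-sym ba) ¬ab

    sum-degrees : ℕ
    sum-degrees = sum (degree G)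

    degree<n : ∀ a → suc (degree G a) ≤ n
    degree<n a = begin
      suc (degree G a)                       ≡⟨ +-comm 1 _ ⟩
      degree G a + 1                         ≡⟨ cong₂ _+_ (degree≡sum a) (sym (sum-kron (λ _ → 1) a)) ⟩
      sum (ind a) + sum (λ b → kron b a 1)   ≡⟨ sym (∑-distrib-+ (ind a) _) ⟩
      sum (λ b → ind a b + kron b a 1)       ≤⟨ sum-mono pointwise ⟩
      sum {n} (λ _ → 1)                          ≡⟨ trans (sum-const n 1) (*-identityʳ n) ⟩
      n                                      ∎
      where
      open ≤-Reasoning
      pointwise : ∀ b → ind a b + kron b a 1 ≤ 1
      pointwise b with b ≟ a
      ... | yes refl = ≤-reflexive (cong (_+ 1) (ind-no (Adj-irrefl refl)))
      ... | no  _    = ≤-trans (≤-reflexive (+-identityʳ _)) (ind≤1 a b)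

    module _ {δ : ℕ} (δ≤ : ∀ a → δ ≤ degree G a) where

      -- Every vertex that is neither j nor adjacent to j contributes at least δ
      -- to the difference of the two degree sums.
      neighbour-degrees : ∀ j → sum (λ i → ind i j * degree G i) + degree G j + n * δ
        ≤ sum-degrees + degree G j * δ + δ
      neighbour-degrees j = begin
        sum (λ i → ind i j * degree G i) + degree G j + n * δ
          ≡⟨ cong₂ (λ X Y → sum (λ i → ind i j * degree G i) + X + Y)
               (sym (sum-kron (degree G) j)) (sym (sum-const n δ)) ⟩
        sum (λ i → ind i j * degree G i) + sum (λ i → kron i j (degree G i)) + sum {n} (λ _ → δ)
          ≡⟨ cong (_+ sum {n} (λ _ → δ)) (sym (∑-distrib-+ (λ i → ind i j * degree G i) (λ i → kron i j (degree G i)))) ⟩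
        sum (λ i → ind i j * degree G i + kron i j (degree G i)) + sum {n} (λ _ → δ)
          ≡⟨ sym (∑-distrib-+ {n} _ (λ _ → δ)) ⟩
        sum (λ i → ind i j * degree G i + kron i j (degree G i) + δ)
          ≤⟨ sum-mono pointwise ⟩
        sum (λ i → degree G i + ind i j * δ + kron i j δ)
          ≡⟨ ∑-distrib-+ (λ i → degree G i + ind i j * δ) _ ⟩
        sum (λ i → degree G i + ind i j * δ) + sum (λ i → kron i j δ)
          ≡⟨ cong₂ _+_ (∑-distrib-+ (degree G) _) (sum-kron (λ _ → δ) j) ⟩
        sum-degrees + sum (λ i → ind i j * δ) + δ
          ≡⟨ cong (λ X → sum-degrees + X + δ) (sym (*-distribʳ-sum δ (λ i → ind i j))) ⟩
        sum-degrees + sum (λ i → ind i j) * δ + δ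
          ≡⟨ cong (λ X → sum-degrees + X * δ + δ)
               (trans (sum-cong (λ i → ind-sym i j)) (sym (degree≡sum j))) ⟩
        sum-degrees + degree G j * δ + δ ∎
        where
        open ≤-Reasoning
        pointwise : ∀ i → ind i j * degree G i + kron i j (degree G i) + δ
          ≤ degree G i + ind i j * δ + kron i j δ
        pointwise i with i ≟ j
        ... | yes refl rewrite ind-no {a = i} (Adj-irrefl refl) = ≤-reflexive
          (cong (_+ δ) (sym (+-identityʳ (degree G i))))
        ... | no _ with adj? i j
        ...   | yes _ = ≤-reflexive (solve 2 (λ d δ → d :+ con 0 :+ con 0 :+ δ
                          := d :+ (δ :+ con 0) :+ con 0) refl (degree G i) δ)
          where open +-*-Solver
        ...   | no  _ = ≤-trans (δ≤ i) (≤-reflexive (sym (trans (+-identityʳ _) (+-identityʳ _))))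

    low : ℕ → Fin n → ℕ
    low k a = if does (degree G a ≤? k) then 1 else 0

    low-yes : ∀ {k a} → degree G a ≤ k → low k a ≡ 1
    low-yes {k} {a} d≤k = cong (if_then 1 else 0) (dec-true (degree G a ≤? k) d≤k)

    low-spec : ∀ k a → low k a ≡ 0 ⊎ (low k a ≡ 1 × degree G a ≤ k)
    low-spec k a = spec (degree G a ≤? k)
      where
      spec : ∀ {P : Set} (P? : Dec P) →
        (if does P? then 1 else 0) ≡ 0 ⊎ ((if does P? then 1 else 0) ≡ 1 × P)
      spec (yes p) = inj₂ (refl , p)
      spec (no _)  = inj₁ refl

    low≤1 : ∀ k a → low k a ≤ 1
    low≤1 k a with low-spec k a
    ... | inj₁ eq       = ≤-trans (≤-reflexive eq) z≤n
    ... | inj₂ (eq , _) = ≤-reflexive eq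

    -- Cover the degree sum by the r′ + 1 chosen vertices of degree at most k,
    -- one of them w, and the complete graph on the other p + 1 vertices.
    sum-degrees-bound : ∀ {k} (w : Fin n) → degree G w ≤ k → ∀ r′ p → n ≡ suc p + suc r′ →
      suc r′ ≤ sum (low k) → sum-degrees ≤ p * suc p + 2 * (r′ * k + degree G w)
    sum-degrees-bound {k} w dw≤k r′ p n≡ r≤ = bound (sub-indicator τ τ≤1 r′ r′≤)
      where
      open ≤-Reasoning
      open +-*-Solver
      d = degree G
      -- `w` is withheld from the selection and restored in `σ`, so that it is certain to be
      -- selected and can be charged `d w` in place of `k`.
      τ : Fin n → ℕ
      τ i = if does (i ≟ w) then 0 else low k i
      τ≤1 : ∀ i → τ i ≤ 1
      τ≤1 i with i ≟ w
      ... | yes _ = z≤n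
      ... | no  _ = low≤1 k i
      low≤ : ∀ i → low k i ≤ τ i + kron i w 1
      low≤ i with i ≟ w
      ... | yes _ = low≤1 k i
      ... | no  _ = ≤-reflexive (sym (+-identityʳ _))
      r′≤ : r′ ≤ sum τ
      r′≤ = s≤s⁻¹ (begin
        suc r′                              ≤⟨ r≤ ⟩
        sum (low k)                         ≤⟨ sum-mono low≤ ⟩
        sum (λ i → τ i + kron i w 1)        ≡⟨ ∑-distrib-+ τ _ ⟩
        sum τ + sum (λ i → kron i w 1)      ≡⟨ cong (sum τ +_) (sum-kron (λ _ → 1) w) ⟩
        sum τ + 1                           ≡⟨ +-comm (sum τ) 1 ⟩
        suc (sum τ)                         ∎)
      bound : ∃[ σ′ ] ((∀ i → σ′ i ≤ τ i) × sum σ′ ≡ r′) → sum-degrees ≤ p * suc p + 2 * (r′ * k + d w)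
      bound (σ′ , σ′≤τ , sum-σ′) = +-cancelʳ-≤ (suc p + 2 * k) _ _ (begin
        sum-degrees + (suc p + 2 * k)
          ≡⟨ solve 3 (λ a b c → a :+ (b :+ c) := (a :+ b) :+ c) refl sum-degrees (suc p) (2 * k) ⟩
        sum-degrees + suc p + 2 * k
          ≤⟨ +-monoˡ-≤ (2 * k) edges ⟩
        (sum σd + sum σd + suc p * suc p) + 2 * k
          ≡⟨ solve 3 (λ a b c → (a :+ a :+ b) :+ con 2 :* c := con 2 :* (a :+ c) :+ b) refl (sum σd) (suc p * suc p) k ⟩
        2 * (sum σd + k) + suc p * suc p
          ≤⟨ +-monoˡ-≤ (suc p * suc p) (*-monoʳ-≤ 2 weighted) ⟩
        2 * (suc r′ * k + d w) + suc p * suc p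
          ≡⟨ solve 4 (λ r k w p → con 2 :* ((con 1 :+ r) :* k :+ w) :+ (con 1 :+ p) :* (con 1 :+ p)
               := (p :* (con 1 :+ p) :+ con 2 :* (r :* k :+ w)) :+ (con 1 :+ p :+ con 2 :* k)) refl r′ k (d w) p ⟩
        p * suc p + 2 * (r′ * k + d w) + (suc p + 2 * k) ∎)
        where
        σ : Fin n → ℕ
        σ i = σ′ i + kron i w 1
        σd : Fin n → ℕ
        σd i = σ i * d i
        ρ : Fin n → ℕ
        ρ i = 1 ∸ σ i

        σ-cases : ∀ i → σ i ≡ 0 ⊎ (σ i ≡ 1 × d i ≤ k)
        σ-cases i with i ≟ w | σ′≤τ i
        ... | yes refl | le rewrite n≤0⇒n≡0 le = inj₂ (refl , dw≤k)
        ... | no  _ | le with low-spec k i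
        ...   | inj₁ eq rewrite eq | n≤0⇒n≡0 le = inj₁ refl
        ...   | inj₂ (eq , d≤k) rewrite eq with σ′ i | le
        ...     | zero      | _ = inj₁ refl
        ...     | suc zero  | _ = inj₂ (refl , d≤k)
        ...     | suc (suc _) | s≤s ()

        sum-σ : sum σ ≡ suc r′
        sum-σ = trans (∑-distrib-+ σ′ _)
          (trans (cong₂ _+_ sum-σ′ (sum-kron (λ _ → 1) w)) (+-comm r′ 1))

        ρ+σ : ∀ i → ρ i + σ i ≡ 1
        ρ+σ i with σ-cases i
        ... | inj₁ eq       = cong (λ s → 1 ∸ s + s) eq
        ... | inj₂ (eq , _) = cong (λ s → 1 ∸ s + s) eq

        sum-ρ : sum ρ ≡ suc p
        sum-ρ = +-cancelʳ-≡ (suc r′) _ _ (trans (cong (sum ρ +_) (sym sum-σ))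
          (trans (sym (∑-distrib-+ ρ σ)) (trans (sum-cong ρ+σ)
            (trans (trans (sum-const n 1) (*-identityʳ n)) n≡))))

        weighted : sum σd + k ≤ suc r′ * k + d w
        weighted = begin
          sum σd + k
            ≡⟨ cong (sum σd +_) (sym (sum-kron (λ _ → k) w)) ⟩
          sum σd + sum (λ i → kron i w k)
            ≡⟨ sym (∑-distrib-+ σd _) ⟩
          sum (λ i → σ i * d i + kron i w k)
            ≤⟨ sum-mono pointwise ⟩
          sum (λ i → σ i * k + kron i w (d i))
            ≡⟨ ∑-distrib-+ (λ i → σ i * k) _ ⟩
          sum (λ i → σ i * k) + sum (λ i → kron i w (d i))
            ≡⟨ cong₂ _+_ (trans (sym (*-distribʳ-sum k σ)) (cong (_* k) sum-σ)) (sum-kron d w) ⟩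
          suc r′ * k + d w ∎
          where
          pointwise : ∀ i → σ i * d i + kron i w k ≤ σ i * k + kron i w (d i)
          pointwise i with i ≟ w | σ′≤τ i | σ-cases i
          ... | yes refl | le | _ rewrite n≤0⇒n≡0 le = ≤-reflexive
            (solve 2 (λ a b → con 1 :* a :+ b := con 1 :* b :+ a) refl (d i) k)
          ... | no _ | _ | inj₁ eq rewrite eq = z≤n
          ... | no _ | _ | inj₂ (eq , d≤k) rewrite eq =
            +-monoˡ-≤ 0 (*-monoʳ-≤ 1 d≤k)

        -- An ordered adjacent pair with a selected end is charged to the degree of such an end, any
        -- other to one of the `suc p * suc p` pairs of unselected vertices. That square also
        -- contains the diagonal, which the added `suc p` on the left takes back.
        edges : sum-degrees + suc p ≤ sum σd + sum σd + suc p * suc p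
        edges = begin
          sum-degrees + suc p
            ≡⟨ cong₂ _+_ (sum-cong degree≡sum) (trans (sym sum-ρ) (sum-cong (λ a → sym (sum-kron (λ _ → ρ a) a)))) ⟩
          sum (λ a → sum (ind a)) + sum (λ a → sum (λ b → kron b a (ρ a)))
            ≡⟨ sym (∑-distrib-+ (λ a → sum (ind a)) _) ⟩
          sum (λ a → sum (ind a) + sum (λ b → kron b a (ρ a)))
            ≡⟨ sum-cong (λ a → sym (∑-distrib-+ (ind a) _)) ⟩
          sum (λ a → sum (λ b → ind a b + kron b a (ρ a)))
            ≤⟨ sum-mono (λ a → sum-mono (pointwise a)) ⟩
          sum (λ a → sum (λ b → σ a * ind a b + σ b * ind a b + ρ a * ρ b))
            ≡⟨ sum-cong (λ a → trans (∑-distrib-+ (λ b → σ a * ind a b + σ b * ind a b) _)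
                 (cong₂ _+_ (trans (∑-distrib-+ (λ b → σ a * ind a b) _)
                   (cong (_+ sum (λ b → σ b * ind a b)) (trans (sym (*-distribˡ-sum (σ a) (ind a)))
                     (cong (σ a *_) (sym (degree≡sum a))))))
                   (sym (*-distribˡ-sum (ρ a) ρ)))) ⟩
          sum (λ a → σd a + sum (λ b → σ b * ind a b) + ρ a * sum ρ)
            ≡⟨ trans (∑-distrib-+ (λ a → σd a + sum (λ b → σ b * ind a b)) _)
                 (cong₂ _+_ (∑-distrib-+ σd _)
                    (trans (sym (*-distribʳ-sum (sum ρ) ρ)) (cong₂ _*_ sum-ρ sum-ρ))) ⟩
          sum σd + sum (λ a → sum (λ b → σ b * ind a b)) + suc p * suc p
            ≡⟨ cong (λ X → sum σd + X + suc p * suc p) (trans (∑-comm (λ a b → σ b * ind a b))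
                 (sum-cong (λ b → trans (sym (*-distribˡ-sum (σ b) (λ a → ind a b)))
                   (cong (σ b *_) (trans (sum-cong (λ a → ind-sym a b)) (sym (degree≡sum b))))))) ⟩
          sum σd + sum σd + suc p * suc p ∎
          where
          pointwise : ∀ a b → ind a b + kron b a (ρ a) ≤ σ a * ind a b + σ b * ind a b + ρ a * ρ b
          pointwise a b with b ≟ a
          ... | yes refl rewrite ind-no {a = a} (Adj-irrefl refl) with σ-cases a
          ...   | inj₁ eq rewrite eq = ≤-refl
          ...   | inj₂ (eq , _) rewrite eq = z≤n
          pointwise a b | no _ with σ-cases a | σ-cases b
          ... | inj₁ ea | inj₁ eb rewrite ea | eb = ≤-trans (≤-reflexive (+-identityʳ _)) (ind≤1 a b)
          ... | inj₁ ea | inj₂ (eb , _) rewrite ea | eb = ≤-reflexive (solve 1 (λ x → x :+ con 0 := con 1 :* x :+ con 0) refl (ind a b))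
          ... | inj₂ (ea , _) | inj₁ eb rewrite ea | eb = ≤-reflexive (solve 1 (λ x → x :+ con 0 := con 1 :* x :+ con 0 :+ con 0) refl (ind a b))
          ... | inj₂ (ea , _) | inj₂ (eb , _) rewrite ea | eb = ≤-trans (m≤m+n _ (ind a b)) (≤-reflexive (solve 1 (λ x → x :+ con 0 :+ x := con 1 :* x :+ con 1 :* x :+ con 0) refl (ind a b)))

-- The (n + t - 2)-closure and a degree condition for reaching the complete graph.

module Closure where
  open import Defs using (Graph; module Graph; degree)
  open Walks using (Walk; []; _∷_; module ↭-Solver)
  open Rewirings using (Container; container)
  open Stability
  open Sums
  open Degrees
  open import Data.Empty using (⊥-elim)
  open import Data.Fin.Base using (Fin)
  open import Data.Fin.Properties using (_≟_)
  open import Data.List.Base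
    using (List; []; _∷_; [_]; _++_; map; concat; take; drop; length; allFin; filter; cartesianProduct)
  open import Data.List.Extrema.Nat using (argmax; argmax-all; f[xs]≤f[argmax]; f[⊥]≤f[argmax])
  open import Data.List.Membership.Propositional using (_∈_)
  open import Data.List.Membership.Propositional.Properties
    using (∈-cartesianProduct⁺; ∈-filter⁺; ∈-allFin; ∈-∃++; ∈-++⁺ˡ)
  open import Data.List.Properties using (length-tabulate; take++drop≡id; length-map; length-take)
  open import Data.List.Relation.Unary.All using (All; []; _∷_; lookup)
  open import Data.List.Relation.Unary.All.Properties using (all-filter) renaming (++⁻ˡ to All++⁻ˡ)
  open import Data.List.Relation.Unary.AllPairs using ([]; _∷_)
  open import Data.List.Relation.Unary.Any using (here; there)
  open import Data.List.Relation.Unary.Unique.Propositional using (Unique)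
  open import Data.List.Relation.Unary.Unique.Propositional.Properties using (allFin⁺)
  open import Data.List.Relation.Binary.Permutation.Propositional
    using (_↭_; prep; ↭-refl; ↭-sym; ↭-trans; ↭-reflexive)
  open import Data.List.Relation.Binary.Permutation.Propositional.Properties
    using (∈-resp-↭; shift; ↭-length)
  open import Data.Nat.Base
  open import Data.Nat.Properties hiding (_≟_)
  open import Data.Nat.Solver using (module +-*-Solver)
  open import Data.Product.Base using (∃-syntax; _×_; _,_)
  open import Data.Sum.Base using (_⊎_; inj₁; inj₂)
  open import Function.Base using (id; _∘_)
  open import Relation.Binary.PropositionalEquality hiding ([_])
  open import Relation.Nullary using (¬_; Dec; yes; no; contradiction)
  open import Relation.Nullary.Decidable using (¬?; _×-dec_; _⊎-dec_; decidable-stable)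
  open ↭-Solver using (_⊕_; _⊜_) renaming (solve to ↭-solve)

  module _ {n : ℕ} (G : Graph n) {x y : Fin n} (x≢y : x ≢ y) where
    open Graph G

    addEdge : Graph n
    addEdge = record
      { Adj        = AddEdge x y Adj
      ; adj?       = λ a b → adj? a b ⊎-dec ((a ≟ x ×-dec b ≟ y) ⊎-dec (a ≟ y ×-dec b ≟ x))
      ; Adj-sym    = λ { (inj₁ ab)                   → inj₁ (Adj-sym ab)
                       ; (inj₂ (inj₁ (a≡x , b≡y))) → inj₂ (inj₂ (b≡y , a≡x))
                       ; (inj₂ (inj₂ (a≡y , b≡x))) → inj₂ (inj₁ (b≡x , a≡y)) }
      ; Adj-irrefl = λ { refl (inj₁ aa)               → Adj-irrefl refl aa
                       ; refl (inj₂ (inj₁ (refl , a≡y))) → x≢y a≡y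
                       ; refl (inj₂ (inj₂ (refl , a≡x))) → x≢y (sym a≡x) }
      }

    ind-addEdge : ∀ a b → ind G a b ≤ ind addEdge a b
    ind-addEdge a b with adj? a b
    ... | yes _ = ≤-refl
    ... | no  _ = z≤n

    degree-addEdge : ∀ a → degree G a ≤ degree addEdge a
    degree-addEdge a = subst₂ _≤_ (sym (degree≡sum G a)) (sym (degree≡sum addEdge a))
      (sum-mono (ind-addEdge a))

    low-addEdge : ∀ k → sum (low addEdge k) ≤ sum (low G k)
    low-addEdge k = sum-mono pointwise
      where
      pointwise : ∀ a → low addEdge k a ≤ low G k a
      pointwise a with low-spec addEdge k a
      ... | inj₁ eq = ≤-trans (≤-reflexive eq) z≤n
      ... | inj₂ (eq , d≤k) = ≤-reflexive (trans eq (sym (low-yes G (≤-trans (degree-addEdge a) d≤k))))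

    -- The degree sum only measures progress of the closure, so counting the increase at `x` alone
    -- suffices.
    sum-degrees-addEdge : ¬ Adj x y → suc (sum-degrees G) ≤ sum-degrees addEdge
    sum-degrees-addEdge ¬xy = begin
      suc (sum-degrees G)                              ≡⟨ +-comm 1 _ ⟩
      sum-degrees G + 1                                ≡⟨ cong (sum-degrees G +_) (sym (sum-kron (λ _ → 1) x)) ⟩
      sum-degrees G + sum (λ a → kron a x 1)           ≡⟨ sym (∑-distrib-+ (degree G) (λ a → kron a x 1)) ⟩
      sum (λ a → degree G a + kron a x 1)              ≤⟨ sum-mono pointwise ⟩
      sum-degrees addEdge                              ∎
      where
      open ≤-Reasoning
      pair : ∀ b → ind G x b + kron b y 1 ≤ ind addEdge x b
      pair b = by-cases (b ≟ y)
        where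
        by-cases : Dec (b ≡ y) → ind G x b + kron b y 1 ≤ ind addEdge x b
        by-cases (no b≢y) = ≤-trans (≤-reflexive (trans (cong (ind G x b +_) (kron-no 1 b≢y)) (+-identityʳ _)))
          (ind-addEdge x b)
        by-cases (yes refl) = ≤-reflexive (trans (cong₂ _+_ (ind-no G ¬xy) (kron-yes 1 (refl {x = y})))
          (sym (ind-yes addEdge (inj₂ (inj₁ (refl , refl))))))
      pointwise : ∀ a → degree G a + kron a x 1 ≤ degree addEdge a
      pointwise a = by-cases (a ≟ x)
        where
        by-cases : Dec (a ≡ x) → degree G a + kron a x 1 ≤ degree addEdge a
        by-cases (no a≢x) = ≤-trans (≤-reflexive (trans (cong (degree G a +_) (kron-no 1 a≢x)) (+-identityʳ _)))
          (degree-addEdge a)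
        by-cases (yes refl) = begin
          degree G x + kron x x 1                     ≡⟨ cong₂ _+_ (degree≡sum G x)
                                                          (trans (kron-yes 1 (refl {x = x})) (sym (sum-kron (λ _ → 1) y))) ⟩
          sum (ind G x) + sum (λ b → kron b y 1)      ≡⟨ sym (∑-distrib-+ (ind G x) (λ b → kron b y 1)) ⟩
          sum (λ b → ind G x b + kron b y 1)          ≤⟨ sum-mono pair ⟩
          sum (ind addEdge x)                         ≡⟨ sym (degree≡sum addEdge x) ⟩
          degree addEdge x                            ∎

  maximal : ∀ {A : Set} {P : A → Set} (P? : ∀ a → Dec (P a)) (f : A → ℕ) (all : List A) →
    (∀ a → a ∈ all) → (∀ a → ¬ P a) ⊎ ∃[ a ] (P a × ∀ b → P b → f b ≤ f a)
  maximal {P = P} P? f all complete = go (filter P? all) (all-filter P? all) (λ b → ∈-filter⁺ P? (complete b))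
    where
    go : ∀ L → All P L → (∀ b → P b → b ∈ L) → (∀ a → ¬ P a) ⊎ ∃[ a ] (P a × ∀ b → P b → f b ≤ f a)
    go [] _ in-L = inj₁ (λ a pa → contradiction (in-L a pa) λ ())
    go (a ∷ L) (pa ∷ ps) in-L = inj₂ (argmax f a L , argmax-all f pa ps , λ b pb → bound (in-L b pb))
      where
      bound : ∀ {b} → b ∈ a ∷ L → f b ≤ f (argmax f a L)
      bound (here refl) = f[⊥]≤f[argmax] {f = f} a L
      bound (there b∈L) = lookup (f[xs]≤f[argmax] {f = f} a L) b∈L

  unique-++ˡ : ∀ {A : Set} (L : List A) {M} → Unique (L ++ M) → Unique L
  unique-++ˡ []      _         = []
  unique-++ˡ (a ∷ L) (a≢ ∷ uq) = All++⁻ˡ L a≢ ∷ unique-++ˡ L uq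

  unique-walk : ∀ {V : Set} {R : V → V → Set} → (∀ {a b} → a ≢ b → R a b) →
    ∀ {a b} A → Unique (a ∷ A ++ [ b ]) → Walk R a (A ++ [ b ]) b
  unique-walk R-complete [] ((a≢b ∷ []) ∷ _) = R-complete a≢b ∷ []
  unique-walk R-complete (c ∷ A) ((a≢c ∷ _) ∷ uq) = R-complete a≢c ∷ unique-walk R-complete A uq

  module _ {n t : ℕ} {u v : Fin n} (u≢v : u ≢ v) (2≤t : 2 ≤ t) (t+2≤n : t + 2 ≤ n) where

    Contains : Graph n → Set
    Contains G = Container (Graph.Adj G) (allFin n) u v t

    -- All walks but the head get one internal vertex each, and the head takes whatever is left;
    -- `t + 2 ≤ n` ensures that the `n - 2` internal vertices suffice.
    complete-contains : (G : Graph n) → (∀ {a b} → a ≢ b → Graph.Adj G a b) → Contains G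
    complete-contains G complete = cut t 2≤t t+2≤n internals
      where
      open Graph G
      extract : ∀ {A : Set} {a : A} {L} → a ∈ L → ∃[ M ] a ∷ M ↭ L
      extract a∈L with ∈-∃++ a∈L
      ... | L₁ , L₂ , refl = L₁ ++ L₂ , ↭-sym (shift _ L₁ L₂)
      internals : ∃[ I ] u ∷ v ∷ I ↭ allFin n
      internals with extract (∈-allFin u)
      ... | M , p with ∈-resp-↭ (↭-sym p) (∈-allFin v)
      ... | here v≡u = contradiction (sym v≡u) u≢v
      ... | there v∈M with extract v∈M
      ... | I , q = I , ↭-trans (prep u q) p
      singles : ∀ L → concat (map [_] L) ≡ L
      singles [] = refl
      singles (a ∷ L) = cong (a ∷_) (singles L)
      cut : ∀ t → 2 ≤ t → t + 2 ≤ n → ∃[ I ] u ∷ v ∷ I ↭ allFin n → Container Adj (allFin n) u v t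
      -- In this clause `t` is one less than the number of walks, that is, the number of walks
      -- besides the head.
      cut (suc t) 2≤t t+2≤n (I , p) = container {first = drop t I} {map [_] (take t I)}
        (unique-walk complete (drop t I) (walk-unique (drop t I) (take t I)
          (↭-trans (↭-solve 2 (λ X Y → X ⊕ Y ⊜ Y ⊕ X) ↭-refl (drop t I) (take t I)) (↭-reflexive (take++drop≡id t I)))))
        (single-walks (take t I) λ a∈ → subst (_ ∈_) (take++drop≡id t I) (∈-++⁺ˡ a∈))
        (single-nonempty (take t I))
        (cong suc (trans (length-map [_] (take t I)) (trans (length-take t I) (m≤n⇒m⊓n≡m t≤))))
        (↭-trans (prep u (prep v (↭-trans (↭-reflexive (cong (drop t I ++_) (singles (take t I))))
          (↭-trans (↭-solve 2 (λ X Y → X ⊕ Y ⊜ Y ⊕ X) ↭-refl (drop t I) (take t I))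
            (↭-reflexive (take++drop≡id t I)))))) p)
        where
        uq : Unique (u ∷ v ∷ I)
        uq = unique-resp-↭ (↭-sym p) (allFin⁺ n)
        t≤ : t ≤ length I
        t≤ = +-cancelʳ-≤ 2 _ _ (begin
          t + 2             ≤⟨ n≤1+n _ ⟩
          suc t + 2         ≤⟨ t+2≤n ⟩
          n                 ≡⟨ sym (trans (↭-length p) (length-tabulate id)) ⟩
          2 + length I      ≡⟨ +-comm 2 _ ⟩
          length I + 2      ∎)
          where open ≤-Reasoning
        walk-unique : ∀ X Y → X ++ Y ↭ I → Unique (u ∷ X ++ [ v ])
        walk-unique X Y q = unique-++ˡ (u ∷ X ++ [ v ]) (unique-resp-↭ (↭-trans (↭-sym (prep u (prep v q)))
          (↭-solve 4 (λ u v X Y → u ⊕ v ⊕ X ⊕ Y ⊜ (u ⊕ X ⊕ v) ⊕ Y) ↭-refl [ u ] [ v ] X Y)) uq)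
        single-walks : ∀ L → (∀ {a} → a ∈ L → a ∈ I) → All (λ A → Walk Adj u (A ++ [ v ]) v) (map [_] L)
        single-walks [] L⊆I = []
        single-walks (a ∷ L) L⊆I =
          (complete (λ { refl → unique-++-disjoint [ u ] uq (here refl) (there (L⊆I (here refl))) })
            ∷ complete (λ { refl → unique-++-disjoint (u ∷ v ∷ []) uq (there (here refl)) (L⊆I (here refl)) }) ∷ [])
          ∷ single-walks L (L⊆I ∘ there)
        single-nonempty : ∀ (L : List (Fin n)) → All (_≢ []) (map [_] L)
        single-nonempty [] = []
        single-nonempty (a ∷ L) = (λ ()) ∷ single-nonempty L

    module _ {δ : ℕ} where

      -- The failure, at k, of Chvátal's degree condition adapted to the
      -- (n + t - 2)-closure.
      Obstructed : Graph n → Set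
      Obstructed G = ∃[ k ] (δ ≤ k × k + k + 3 ≤ n + t × k + 2 ≤ t + sum (low G k))

      -- Every vertex is `y`, a neighbour of `y`, or low for k = d(x), so n ≤ d(y) + 1 +
      -- `sum (low G k)`. Together with d(x) + d(y) + 3 ≤ n + t this leaves at least k - t + 2 low
      -- vertices.
      saturated-obstructed : (G : Graph n) → (∀ a → δ ≤ degree G a) → ∀ {x y} →
        degree G x + degree G y + 3 ≤ n + t → degree G x ≤ degree G y →
        (∀ z → z ≢ y → ¬ Graph.Adj G y z → degree G z ≤ degree G x) → Obstructed G
      saturated-obstructed G δ≤ {x} {y} small dx≤dy most = k , δ≤ x ,
        ≤-trans (+-monoˡ-≤ 3 (+-monoʳ-≤ k dx≤dy)) small ,
        +-cancelˡ-≤ (degree G y + 1) _ _ (begin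
          degree G y + 1 + (k + 2)
            ≡⟨ solve 2 (λ a b → a :+ con 1 :+ (b :+ con 2) := b :+ a :+ con 3) refl (degree G y) k ⟩
          k + degree G y + 3
            ≤⟨ small ⟩
          n + t
            ≤⟨ +-monoˡ-≤ t non-neighbours ⟩
          degree G y + 1 + sum (low G k) + t
            ≡⟨ solve 3 (λ a b c → a :+ b :+ c := a :+ (c :+ b)) refl (degree G y + 1) (sum (low G k)) t ⟩
          degree G y + 1 + (t + sum (low G k)) ∎)
        where
        open ≤-Reasoning
        open +-*-Solver
        k = degree G x
        pointwise : ∀ z → 1 ≤ ind G y z + kron z y 1 + low G k z
        pointwise z with z ≟ y
        ... | yes refl = ≤-trans (m≤n+m 1 (ind G y z)) (m≤m+n _ _)
        ... | no z≢y with Graph.adj? G y z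
        ...   | yes _  = s≤s z≤n
        ...   | no ¬yz = ≤-reflexive (sym (low-yes G (most z z≢y ¬yz)))
        non-neighbours : n ≤ degree G y + 1 + sum (low G k)
        non-neighbours = begin
          n                                                  ≡⟨ sym (trans (sum-const n 1) (*-identityʳ n)) ⟩
          sum {n} (λ _ → 1)                                  ≤⟨ sum-mono pointwise ⟩
          sum (λ z → ind G y z + kron z y 1 + low G k z)
            ≡⟨ ∑-distrib-+ (λ z → ind G y z + kron z y 1) (low G k) ⟩
          sum (λ z → ind G y z + kron z y 1) + sum (low G k)
            ≡⟨ cong (_+ sum (low G k)) (trans (∑-distrib-+ (ind G y) (λ z → kron z y 1))
                 (cong₂ _+_ (sym (degree≡sum G y)) (sum-kron (λ _ → 1) y))) ⟩
          degree G y + 1 + sum (low G k) ∎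

      -- Degrees only grow when an edge is added, so every vertex that is low in the larger graph
      -- was already low: the same `k` obstructs both.
      obstructed-addEdge : ∀ G {x y} (x≢y : x ≢ y) → Obstructed (addEdge G x≢y) → Obstructed G
      obstructed-addEdge G x≢y (k , δ≤k , k≤ , low≥) =
        k , δ≤k , k≤ , ≤-trans low≥ (+-monoʳ-≤ t (low-addEdge G x≢y k))

      sum-degrees≤ : (G : Graph n) → sum-degrees G ≤ n * n
      sum-degrees≤ G = ≤-trans (sum-mono (λ a → ≤-trans (n≤1+n _) (degree<n G a)))
        (≤-reflexive (sum-const n n))

      -- The pair of maximal degree sum decides each stage: if it is too small for the closure step,
      -- its maximality bounds the degrees of all non-neighbours of its larger end. The fuel
      -- dominates `n * n` minus the degree sum, which shrinks with each new edge.
      contains-or-obstructed : ∀ fuel (G : Graph n) → n * n ≤ sum-degrees G + fuel →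
        (∀ a → δ ≤ degree G a) → Contains G ⊎ Obstructed G
      contains-or-obstructed fuel G enough δ≤
        with maximal {P = λ (x , y) → x ≢ y × ¬ Graph.Adj G x y}
               (λ (x , y) → ¬? (x ≟ y) ×-dec ¬? (Graph.adj? G x y))
               (λ (x , y) → degree G x + degree G y)
               (cartesianProduct (allFin n) (allFin n)) (λ (x , y) → ∈-cartesianProduct⁺ (∈-allFin x) (∈-allFin y))
      ... | inj₁ none = inj₁ (complete-contains G λ {a} {b} a≢b →
              decidable-stable (Graph.adj? G a b) (λ ¬ab → none (a , b) (a≢b , ¬ab)))
      ... | inj₂ ((x , y) , (x≢y , ¬xy) , most) with n + t ≤? degree G x + degree G y + 2
      ...   | no ¬large = inj₂ (saturated (≤-total (degree G x) (degree G y)))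
        where
        small : degree G x + degree G y + 3 ≤ n + t
        small = subst (_≤ n + t) (sym (+-suc _ 2)) (≰⇒> ¬large)
        saturated : degree G x ≤ degree G y ⊎ degree G y ≤ degree G x → Obstructed G
        saturated (inj₁ dx≤dy) = saturated-obstructed G δ≤ small dx≤dy λ z z≢y ¬yz →
          +-cancelʳ-≤ (degree G y) _ _ (most (z , y) (z≢y , λ zy → ¬yz (Graph.Adj-sym G zy)))
        saturated (inj₂ dy≤dx) = saturated-obstructed G δ≤
          (subst (λ d → d + 3 ≤ n + t) (+-comm (degree G x) _) small) dy≤dx λ z z≢x ¬xz →
          +-cancelˡ-≤ (degree G x) _ _ (most (x , z) ((λ x≡z → z≢x (sym x≡z)) , ¬xz))
      ...   | yes large = extend fuel enough
        where
        G⁺ = addEdge G x≢y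
        more : suc (sum-degrees G) ≤ sum-degrees G⁺
        more = sum-degrees-addEdge G x≢y ¬xy
        extend : ∀ fuel → n * n ≤ sum-degrees G + fuel → Contains G ⊎ Obstructed G
        extend zero enough = ⊥-elim (<-irrefl refl (≤-trans more (≤-trans (sum-degrees≤ G⁺)
          (≤-trans enough (≤-reflexive (+-identityʳ _))))))
        extend (suc fuel) enough with contains-or-obstructed fuel G⁺
          (≤-trans enough (≤-trans (≤-reflexive (+-suc _ fuel)) (+-monoˡ-≤ fuel more)))
          (λ a → ≤-trans (δ≤ a) (degree-addEdge G x≢y a))
        ... | inj₁ c = inj₁ (container-stable (Graph.adj? G) (Graph.Adj-sym G) (Graph.Adj-irrefl G refl) u≢v ¬xy
                (allFin⁺ n) 2≤t (subst₂ _≤_ (cong (_+ t) (sym (length-tabulate id)))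
                  (cong (_+ 2) (cong₂ _+_ (degree≡nbrs G x) (degree≡nbrs G y))) large) c)
        ... | inj₂ o = inj₂ (obstructed-addEdge G x≢y o)

-- From containers to covers by disjoint paths.

module Coverings where
  open import Defs using (Graph; module Graph; Path; OneToOneDisjointPathCoverable)
  open Walks using (Walk; []; _∷_; module ↭-Solver)
  open Rewirings using (Container; container)
  open Stability using (unique-resp-↭; unique-++-disjoint)
  open Closure using (unique-++ˡ)
  open import Data.Empty using (⊥-elim)
  open import Data.Fin.Base using (Fin; zero; suc)
  open import Data.List.Base using (List; []; _∷_; [_]; _++_; concat; lookup; last; allFin)
  open import Data.List.Membership.Propositional using (_∈_; _∉_)
  open import Data.List.Membership.Propositional.Properties
    using (∈-allFin; ∈-lookup; ∈-++⁺ˡ; ∈-++⁺ʳ; ∈-++⁻; ∈-concat⁺′; ∈-concat⁻′)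
  open import Data.List.Properties using (∷-injectiveʳ; ++-cancelʳ)
  open import Data.List.Relation.Unary.All using (All; []; _∷_)
  import Data.List.Relation.Unary.All as All
  open import Data.List.Relation.Unary.AllPairs using (_∷_)
  open import Data.List.Relation.Unary.Any using (here; there; index)
  import Data.List.Relation.Unary.Any.Properties as Any
  open import Data.List.Relation.Unary.Linked using (Linked; [-]; _∷_)
  open import Data.List.Relation.Unary.Unique.Propositional using (Unique)
  open import Data.List.Relation.Unary.Unique.Propositional.Properties using (allFin⁺)
  open import Data.List.Relation.Binary.Permutation.Propositional using (_↭_; prep; ↭-refl; ↭-sym; ↭-trans)
  open import Data.List.Relation.Binary.Permutation.Propositional.Properties using (∈-resp-↭; ++⁺ˡ)
  open import Data.Maybe.Base using (just)
  open import Data.Nat.Base using (ℕ)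
  open import Data.Product.Base using (∃-syntax; _,_)
  open import Data.Sum.Base using (_⊎_; inj₁; inj₂)
  open import Function.Base using (_∘_)
  open import Relation.Binary.PropositionalEquality hiding ([_])
  open import Relation.Nullary using (contradiction)
  open ↭-Solver using (_⊕_; _⊜_) renaming (solve to ↭-solve)

  private
    variable
      V : Set

  unique-++ʳ : ∀ (L : List V) {M} → Unique (L ++ M) → Unique M
  unique-++ʳ []      uq       = uq
  unique-++ʳ (_ ∷ L) (_ ∷ uq) = unique-++ʳ L uq

  lookup-disjoint : ∀ (Ls : List (List V)) → Unique (concat Ls) → ∀ i j → i ≢ j →
    ∀ {w} → w ∈ lookup Ls i → w ∉ lookup Ls j
  lookup-disjoint (L ∷ Ls) uq zero    zero    i≢j = contradiction refl i≢j
  lookup-disjoint (L ∷ Ls) uq zero    (suc j) i≢j w∈ w∈′ =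
    unique-++-disjoint L uq w∈ (∈-concat⁺′ w∈′ (∈-lookup {xs = Ls} j))
  lookup-disjoint (L ∷ Ls) uq (suc i) zero    i≢j w∈ w∈′ =
    unique-++-disjoint L uq w∈′ (∈-concat⁺′ w∈ (∈-lookup {xs = Ls} i))
  lookup-disjoint (L ∷ Ls) uq (suc i) (suc j) i≢j =
    lookup-disjoint Ls (unique-++ʳ L uq) i j (i≢j ∘ cong suc)

  -- Two equal lists with an internal vertex would share it, against disjointness; two empty ones
  -- cannot occur at different positions, because only the head may be empty.
  lookup-distinct : ∀ (L : List V) Ls → All (_≢ []) Ls → Unique (concat (L ∷ Ls)) →
    ∀ i j → i ≢ j → lookup (L ∷ Ls) i ≢ lookup (L ∷ Ls) j
  lookup-distinct {V} L Ls nonempty uq = go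
    where
    inhabited : (A : List V) → A ≢ [] → ∃[ w ] w ∈ A
    inhabited []      ne = contradiction refl ne
    inhabited (w ∷ A) _  = w , here refl
    clash : ∀ i j → i ≢ j → lookup (L ∷ Ls) i ≢ [] → lookup (L ∷ Ls) i ≢ lookup (L ∷ Ls) j
    clash i j i≢j ne eq with inhabited _ ne
    ... | w , w∈ = lookup-disjoint (L ∷ Ls) uq i j i≢j w∈ (subst (w ∈_) eq w∈)
    go : ∀ i j → i ≢ j → lookup (L ∷ Ls) i ≢ lookup (L ∷ Ls) j
    go zero    zero    i≢j eq = i≢j refl
    go (suc i) j       i≢j eq = clash (suc i) j i≢j (All.lookup nonempty (∈-lookup i)) eq
    go zero    (suc j) i≢j eq = clash (suc j) zero (i≢j ∘ sym) (All.lookup nonempty (∈-lookup j)) (sym eq)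

  module _ {n t : ℕ} (G : Graph n) where
    open Graph G

    linked : ∀ {a b L} → Walk Adj a L b → Linked Adj (a ∷ L)
    linked []          = [-]
    linked (r ∷ [])    = r ∷ [-]
    linked (r ∷ s ∷ w) = r ∷ linked (s ∷ w)

    last-∷ʳ : ∀ (A : List V) v → last (A ++ [ v ]) ≡ just v
    last-∷ʳ []          v = refl
    last-∷ʳ (_ ∷ [])    v = refl
    last-∷ʳ (_ ∷ b ∷ A) v = last-∷ʳ (b ∷ A) v

    path : ∀ {u v A} → Walk Adj u (A ++ [ v ]) v → Unique (u ∷ A ++ [ v ]) → Path G u v
    path {u} {v} {A} w uq = record
      { vertices = u ∷ A ++ [ v ]
      ; starts   = refl
      ; ends     = last-∷ʳ (u ∷ A) v
      ; linked   = linked w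
      ; simple   = uq
      }

    containers⇒coverable : (∀ {u v} → u ≢ v → Container Adj (allFin n) u v t) →
      OneToOneDisjointPathCoverable G t
    containers⇒coverable contain u v u≢v with contain u≢v
    ... | container {first} {others} w ws nonempty refl covers = P , distinct , cover , disjoint
      where
      As = first ∷ others
      walks : ∀ i → Walk Adj u (lookup As i ++ [ v ]) v
      walks i = All.lookup (w ∷ ws) (∈-lookup i)
      uq : Unique (u ∷ v ∷ concat As)
      uq = unique-resp-↭ (↭-sym covers) (allFin⁺ n)
      uqAs : Unique (concat As)
      uqAs = unique-++ʳ (u ∷ v ∷ []) uq

      -- Bringing one internal list to the front of the concatenation makes distinctness along a
      -- single path a consequence of distinctness in the whole container.
      remove : ∀ (Ls : List (List (Fin n))) i → ∃[ M ] lookup Ls i ++ M ↭ concat Ls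
      remove (L ∷ Ls) zero = concat Ls , ↭-refl
      remove (L ∷ Ls) (suc i) with remove Ls i
      ... | M , p = L ++ M , ↭-trans
        (↭-solve 3 (λ X L M → X ⊕ L ⊕ M ⊜ L ⊕ X ⊕ M) ↭-refl (lookup Ls i) L M) (++⁺ˡ L p)

      unique-path : ∀ i → Unique (u ∷ lookup As i ++ [ v ])
      unique-path i with remove As i
      ... | M , p = unique-++ˡ (u ∷ lookup As i ++ [ v ]) (unique-resp-↭
        (↭-trans (prep u (prep v (↭-sym p)))
          (↭-solve 4 (λ u v A M → u ⊕ v ⊕ A ⊕ M ⊜ (u ⊕ A ⊕ v) ⊕ M) ↭-refl [ u ] [ v ] (lookup As i) M)) uq)

      P : Fin t → Path G u v
      P i = path (walks i) (unique-path i)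

      distinct : ∀ i j → i ≢ j → Path.vertices (P i) ≢ Path.vertices (P j)
      distinct i j i≢j eq = lookup-distinct first others nonempty uqAs i j i≢j
        (++-cancelʳ [ v ] _ _ (∷-injectiveʳ eq))

      cover : ∀ x → ∃[ i ] x ∈ Path.vertices (P i)
      cover x with ∈-resp-↭ (↭-sym covers) (∈-allFin x)
      ... | here refl         = zero , here refl
      ... | there (here refl) = zero , there (∈-++⁺ʳ first (here refl))
      ... | there (there x∈) with ∈-concat⁻′ As x∈
      ...   | A , x∈A , A∈ = index A∈ , there (∈-++⁺ˡ (subst (x ∈_) (Any.lookup-index A∈) x∈A))

      inside : ∀ i {x} → x ∈ Path.vertices (P i) → (x ≡ u ⊎ x ≡ v) ⊎ x ∈ lookup As i
      inside i (here eq) = inj₁ (inj₁ eq)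
      inside i (there x∈) with ∈-++⁻ (lookup As i) x∈
      ... | inj₁ x∈A       = inj₂ x∈A
      ... | inj₂ (here eq) = inj₁ (inj₂ eq)

      disjoint : ∀ i j → i ≢ j → ∀ x → x ∈ Path.vertices (P i) → x ∈ Path.vertices (P j) → x ≡ u ⊎ x ≡ v
      disjoint i j i≢j x x∈i x∈j with inside i x∈i | inside j x∈j
      ... | inj₁ end | _        = end
      ... | inj₂ _   | inj₁ end = end
      ... | inj₂ x∈  | inj₂ x∈′ = ⊥-elim (lookup-disjoint As uqAs i j i≢j x∈ x∈′)

-- Convexity of the edge bound and its comparison with `h₂`.

module Arithmetic where
  open import Defs using (Graph; degree; HasMinDegree; f₂; g₂; h₂; h)
  open Degrees
  open Closure using (Obstructed)
  open import Data.Nat.Base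
  open import Data.Nat.Combinatorics using (_C_; nCk+nC[k+1]≡[n+1]C[k+1]; nC1≡n)
  open import Data.Nat.DivMod using (_/_; m*n/n≡m; m/n*n≤m; /-monoˡ-≤)
  open import Data.Nat.Properties
  open import Data.Nat.Solver using (module +-*-Solver)
  open import Data.Product.Base using (∃-syntax; _,_)
  open import Relation.Binary.PropositionalEquality

  2*[1+p]C2 : ∀ p → 2 * (suc p C 2) ≡ p * suc p
  2*[1+p]C2 zero    = refl
  2*[1+p]C2 (suc p) = begin
    2 * (suc (suc p) C 2)               ≡⟨ cong (2 *_) (sym (nCk+nC[k+1]≡[n+1]C[k+1] (suc p) 1)) ⟩
    2 * (suc p C 1 + suc p C 2)         ≡⟨ cong (λ c → 2 * (c + suc p C 2)) (nC1≡n (suc p)) ⟩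
    2 * (suc p + suc p C 2)             ≡⟨ *-distribˡ-+ 2 (suc p) _ ⟩
    2 * suc p + 2 * (suc p C 2)         ≡⟨ cong (2 * suc p +_) (2*[1+p]C2 p) ⟩
    2 * suc p + p * suc p               ≡⟨ solve 1 (λ p → con 2 :* (con 1 :+ p) :+ p :* (con 1 :+ p)
                                             := (con 1 :+ p) :* (con 2 :+ p)) refl p ⟩
    suc p * suc (suc p) ∎
    where open ≡-Reasoning
          open +-*-Solver

  -- Twice the edge bound for k = t + κ, where n = κ + p + 3.
  bound : ℕ → ℕ → ℕ → ℕ → ℕ
  bound t δ κ p = p * suc p + 2 * (suc κ * (t + κ) + δ)

  -- Convexity along κ + p = const: (i + j) times the middle value falls short of
  -- the weighted sum of the end values by 3ij(i + j).
  bound-convex : ∀ t δ κ p i j {M} → bound t δ κ (p + i + j) ≤ M → bound t δ (κ + i + j) p ≤ M →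
    bound t δ (κ + i) (p + j) ≤ M
  -- The general case cancels `i + j`, which must be nonzero; for `i` zero the middle value is
  -- itself the first end value.
  bound-convex t δ κ p zero j {M} le _ =
    subst (_≤ M) (cong₂ (λ κ p → bound t δ κ (p + j)) (sym (+-identityʳ κ)) (+-identityʳ p)) le
  bound-convex t δ κ p i@(suc _) j {M} le₁ le₂ = *-cancelˡ-≤ (i + j) (begin
    (i + j) * bound t δ (κ + i) (p + j)
      ≤⟨ m≤m+n _ (3 * (i * j * (i + j))) ⟩
    (i + j) * bound t δ (κ + i) (p + j) + 3 * (i * j * (i + j))
      ≡⟨ solve 6 (λ t δ κ p i j → let b = λ κ p → p :* (con 1 :+ p) :+ con 2 :* ((con 1 :+ κ) :* (t :+ κ) :+ δ) in
           (i :+ j) :* b (κ :+ i) (p :+ j) :+ con 3 :* (i :* j :* (i :+ j))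
           := j :* b κ (p :+ i :+ j) :+ i :* b (κ :+ i :+ j) p) refl t δ κ p i j ⟩
    j * bound t δ κ (p + i + j) + i * bound t δ (κ + i + j) p
      ≤⟨ +-mono-≤ (*-monoʳ-≤ j le₁) (*-monoʳ-≤ i le₂) ⟩
    j * M + i * M
      ≡⟨ solve 3 (λ i j M → j :* M :+ i :* M := (i :+ j) :* M) refl i j M ⟩
    (i + j) * M ∎)
    where open ≤-Reasoning
          open +-*-Solver

  module _ {n t : ℕ} where

    h-≤ : ∀ {k} → k + k + 3 ≤ n + t → k ≤ h n t
    h-≤ {k} k≤ = begin
      k                  ≡⟨ sym (m*n/n≡m k 2) ⟩
      k * 2 / 2          ≤⟨ /-monoˡ-≤ 2 (m+n≤o⇒m≤o∸n (k * 2) (≤-trans (≤-reflexive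
                              (solve 1 (λ k → k :* con 2 :+ con 3 := k :+ k :+ con 3) refl k)) k≤)) ⟩
      (n + t ∸ 3) / 2    ∎
      where open ≤-Reasoning
            open +-*-Solver

    -- Together with `h-≤`, this makes `h n t` the largest `k` with `k + k + 3 ≤ n + t`; `3 ≤ n`
    -- keeps the truncated subtraction exact.
    h-bound : 3 ≤ n → h n t + h n t + 3 ≤ n + t
    h-bound 3≤n = begin
      h n t + h n t + 3       ≡⟨ solve 1 (λ h → h :+ h :+ con 3 := h :* con 2 :+ con 3) refl (h n t) ⟩
      h n t * 2 + 3           ≤⟨ +-monoˡ-≤ 3 (m/n*n≤m (n + t ∸ 3) 2) ⟩
      n + t ∸ 3 + 3           ≡⟨ m∸n+n≡m (≤-trans 3≤n (m≤m+n n t)) ⟩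
      n + t                   ∎
      where open ≤-Reasoning
            open +-*-Solver

    t+2≤n : 3 ≤ n → t ≤ h n t → t + 2 ≤ n
    t+2≤n 3≤n t≤h = +-cancelʳ-≤ t _ _ (begin
      t + 2 + t              ≡⟨ solve 1 (λ t → t :+ con 2 :+ t := t :+ t :+ con 2) refl t ⟩
      t + t + 2              ≤⟨ +-mono-≤ (+-mono-≤ t≤h t≤h) (n≤1+n 2) ⟩
      h n t + h n t + 3      ≤⟨ h-bound 3≤n ⟩
      n + t                  ∎)
      where open ≤-Reasoning
            open +-*-Solver

  -- The end k = δ of the range: there the special vertex of degree δ costs as much as every other
  -- selected vertex, so (ε + 1) δ + δ becomes (ε + 2) δ.
  f₂≡bound : ∀ t ε p → 2 * f₂ (ε + p + 3) t (t + ε) ≡ bound t (t + ε) ε p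
  f₂≡bound t ε p = begin
    2 * (((ε + p + 3 + t ∸ (t + ε) ∸ 2) C 2) + (t + ε ∸ t + 2) * (t + ε))
      ≡⟨ cong₂ (λ X Y → 2 * ((X C 2) + (Y + 2) * (t + ε))) size (m+n∸m≡n t ε) ⟩
    2 * ((suc p C 2) + (ε + 2) * (t + ε))
      ≡⟨ *-distribˡ-+ 2 (suc p C 2) _ ⟩
    2 * (suc p C 2) + 2 * ((ε + 2) * (t + ε))
      ≡⟨ cong₂ _+_ (2*[1+p]C2 p) (solve 2 (λ t ε → con 2 :* ((ε :+ con 2) :* (t :+ ε))
           := con 2 :* ((con 1 :+ ε) :* (t :+ ε) :+ (t :+ ε))) refl t ε) ⟩
    bound t (t + ε) ε p ∎
    where
    open ≡-Reasoning
    open +-*-Solver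
    size : ε + p + 3 + t ∸ (t + ε) ∸ 2 ≡ suc p
    size = trans (∸-+-assoc _ (t + ε) 2) (trans (cong (_∸ (t + ε + 2))
      (solve 3 (λ t ε p → ε :+ p :+ con 3 :+ t := (t :+ ε :+ con 2) :+ (con 1 :+ p)) refl t ε p))
      (m+n∸m≡n (t + ε + 2) (suc p)))

  g₂≡bound : ∀ n t δ η p → n ≡ η + p + 3 → h n t ≡ t + η → 2 * g₂ n t δ ≡ bound t δ η p
  g₂≡bound n t δ η p refl eq rewrite eq = begin
    2 * (((η + p + 3 + t ∸ (t + η) ∸ 2) C 2) + (t + η ∸ t + 1) * (t + η) + δ)
      ≡⟨ cong₂ (λ X Y → 2 * ((X C 2) + (Y + 1) * (t + η) + δ)) size (m+n∸m≡n t η) ⟩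
    2 * ((suc p C 2) + (η + 1) * (t + η) + δ)
      ≡⟨ trans (cong (2 *_) (+-assoc (suc p C 2) _ δ)) (*-distribˡ-+ 2 (suc p C 2) _) ⟩
    2 * (suc p C 2) + 2 * ((η + 1) * (t + η) + δ)
      ≡⟨ cong₂ _+_ (2*[1+p]C2 p) (cong (λ X → 2 * (X * (t + η) + δ)) (+-comm η 1)) ⟩
    bound t δ η p ∎
    where
    open ≡-Reasoning
    open +-*-Solver
    size : η + p + 3 + t ∸ (t + η) ∸ 2 ≡ suc p
    size = trans (∸-+-assoc _ (t + η) 2) (trans (cong (_∸ (t + η + 2))
      (solve 3 (λ t η p → η :+ p :+ con 3 :+ t := (t :+ η :+ con 2) :+ (con 1 :+ p)) refl t η p))
      (m+n∸m≡n (t + η + 2) (suc p)))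

  -- `i` and `j` are the distances from δ up to k and from k up to `h n t`. The two ends of this
  -- interval give `f₂` and `g₂`, and convexity handles what lies between.
  bound≤2h₂ : ∀ n t ε i j p → n ≡ (ε + i + j) + p + 3 → h n t ≡ t + (ε + i + j) →
    bound t (t + ε) (ε + i) (p + j) ≤ 2 * h₂ n t (t + ε)
  bound≤2h₂ n t ε i j p n≡ h≡ = bound-convex t (t + ε) ε p i j
    (≤-trans (≤-reflexive (trans (sym (f₂≡bound t ε (p + i + j)))
        (cong (λ n → 2 * f₂ n t (t + ε)) (trans (solve 4 (λ ε p i j → ε :+ (p :+ i :+ j) :+ con 3
           := ε :+ i :+ j :+ p :+ con 3) refl ε p i j) (sym n≡)))))
      (*-monoʳ-≤ 2 (m≤m⊔n (f₂ n t (t + ε)) (g₂ n t (t + ε)))))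
    (≤-trans (≤-reflexive (sym (g₂≡bound n t (t + ε) (ε + i + j) p n≡ h≡)))
      (*-monoʳ-≤ 2 (m≤n⊔m (f₂ n t (t + ε)) (g₂ n t (t + ε)))))
    where open +-*-Solver

  obstructed⇒sum-degrees≤ : ∀ {n t δ} {u v} (u≢v : u ≢ v) (2≤t : 2 ≤ t) (t+2≤n : t + 2 ≤ n) →
    3 ≤ n → t ≤ δ → (G : Graph n) → HasMinDegree G δ →
    Obstructed u≢v 2≤t t+2≤n {δ} G → sum-degrees G ≤ 2 * h₂ n t δ
  obstructed⇒sum-degrees≤ {n} {t} u≢v 2≤t t+2≤n 3≤n t≤δ G ((w , dw≡δ) , _) (k , δ≤k , k≤ , low≥)
    with m≤n⇒∃[o]m+o≡n t≤δ | m≤n⇒∃[o]m+o≡n δ≤k | m≤n⇒∃[o]m+o≡n (h-≤ {n} {t} {k} k≤) | m≤n⇒∃[o]m+o≡n (h-bound {n} {t} 3≤n)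
  ... | ε , refl | i , refl | j , eqh | q , eqn = begin
    sum-degrees G
      -- `suc (ε + i)` is k - t + 1: of the k - t + 2 low vertices that are selected, one is `w`,
      -- whose degree δ is counted separately.
      ≤⟨ sum-degrees-bound G w (≤-trans (≤-reflexive dw≡δ) δ≤k) (suc (ε + i)) (p + j)
           (trans n≡ (solve 4 (λ ε i j p → (ε :+ i :+ j) :+ p :+ con 3
             := con 1 :+ (p :+ j) :+ (con 2 :+ (ε :+ i))) refl ε i j p))
           (+-cancelˡ-≤ t _ _ (≤-trans (≤-reflexive (solve 3 (λ t ε i →
             t :+ (con 2 :+ (ε :+ i)) := t :+ ε :+ i :+ con 2) refl t ε i)) low≥)) ⟩
    (p + j) * suc (p + j) + 2 * (suc (ε + i) * (t + ε + i) + degree G w)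
      ≡⟨ cong₂ (λ X Y → (p + j) * suc (p + j) + 2 * (suc (ε + i) * X + Y)) (+-assoc t ε i) dw≡δ ⟩
    bound t (t + ε) (ε + i) (p + j)
      ≤⟨ bound≤2h₂ n t ε i j p n≡ h≡ ⟩
    2 * h₂ n t (t + ε) ∎
    where
    open ≤-Reasoning
    open +-*-Solver
    -- With h = t + η and h + h + 3 + q = n + t one gets n = η + (h + q) + 3, so `p` is h + q; `q`
    -- is the remainder lost in the floor.
    p = t + (ε + i + j) + q
    h≡ : h n t ≡ t + (ε + i + j)
    h≡ = trans (sym eqh) (solve 4 (λ t ε i j → t :+ ε :+ i :+ j := t :+ (ε :+ i :+ j)) refl t ε i j)
    n≡ : n ≡ (ε + i + j) + p + 3
    n≡ = +-cancelʳ-≡ t _ _ (trans (sym eqn) (trans (cong (λ h → h + h + 3 + q) h≡)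
      (solve 3 (λ t η q → t :+ η :+ (t :+ η) :+ con 3 :+ q := η :+ (t :+ η :+ q) :+ con 3 :+ t)
        refl t (ε + i + j) q)))

-- Naturals inside the rationals, signs and absolute values.

module Rationals where
  open import Data.Integer.Base as ℤ using (+_)
  import Data.Integer.Properties as ℤ
  open import Data.Nat.Base as ℕ using (ℕ)
  import Data.Nat.Properties as ℕ
  open import Data.Rational.Base
  open import Data.Rational.Properties
  open import Data.Rational.Solver using (module +-*-Solver)
  import Data.Rational.Unnormalised.Base as ℚᵘ
  import Data.Rational.Unnormalised.Properties as ℚᵘ
  open import Data.Product.Base using (∃-syntax; _×_; _,_)
  open import Data.Sum.Base using (inj₁; inj₂)
  open import Relation.Binary.PropositionalEquality
  open +-*-Solver using (solve; _:=_; _:+_; _:-_; :-_)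

  ⟦_⟧ : ℕ → ℚ
  ⟦ m ⟧ = + m / 1

  ⟦⟧-toℚᵘ : ∀ m → toℚᵘ ⟦ m ⟧ ℚᵘ.≃ ℚᵘ.mkℚᵘ (+ m) 0
  ⟦⟧-toℚᵘ m = toℚᵘ-fromℚᵘ (ℚᵘ.mkℚᵘ (+ m) 0)

  ⟦⟧-+ : ∀ m n → ⟦ m ℕ.+ n ⟧ ≡ ⟦ m ⟧ + ⟦ n ⟧
  ⟦⟧-+ m n = toℚᵘ-injective (begin
    toℚᵘ ⟦ m ℕ.+ n ⟧                                ≈⟨ ⟦⟧-toℚᵘ (m ℕ.+ n) ⟩
    ℚᵘ.mkℚᵘ (+ (m ℕ.+ n)) 0                         ≈⟨ ℚᵘ.*≡* (cong (ℤ._* + 1) (sym (cong₂ ℤ._+_ (ℤ.*-identityʳ (+ m)) (ℤ.*-identityʳ (+ n))))) ⟩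
    ℚᵘ.mkℚᵘ (+ m) 0 ℚᵘ.+ ℚᵘ.mkℚᵘ (+ n) 0            ≈⟨ ℚᵘ.+-cong (ℚᵘ.≃-sym (⟦⟧-toℚᵘ m)) (ℚᵘ.≃-sym (⟦⟧-toℚᵘ n)) ⟩
    toℚᵘ ⟦ m ⟧ ℚᵘ.+ toℚᵘ ⟦ n ⟧                      ≈⟨ ℚᵘ.≃-sym (toℚᵘ-homo-+ ⟦ m ⟧ ⟦ n ⟧) ⟩
    toℚᵘ (⟦ m ⟧ + ⟦ n ⟧)                            ∎)
    where open ℚᵘ.≃-Reasoning

  ⟦⟧-* : ∀ m n → ⟦ m ℕ.* n ⟧ ≡ ⟦ m ⟧ * ⟦ n ⟧
  ⟦⟧-* m n = toℚᵘ-injective (begin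
    toℚᵘ ⟦ m ℕ.* n ⟧                                ≈⟨ ⟦⟧-toℚᵘ (m ℕ.* n) ⟩
    ℚᵘ.mkℚᵘ (+ (m ℕ.* n)) 0                         ≈⟨ ℚᵘ.*≡* (cong (ℤ._* + 1) (ℤ.pos-* m n)) ⟩
    ℚᵘ.mkℚᵘ (+ m) 0 ℚᵘ.* ℚᵘ.mkℚᵘ (+ n) 0            ≈⟨ ℚᵘ.*-cong (ℚᵘ.≃-sym (⟦⟧-toℚᵘ m)) (ℚᵘ.≃-sym (⟦⟧-toℚᵘ n)) ⟩
    toℚᵘ ⟦ m ⟧ ℚᵘ.* toℚᵘ ⟦ n ⟧                      ≈⟨ ℚᵘ.≃-sym (toℚᵘ-homo-* ⟦ m ⟧ ⟦ n ⟧) ⟩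
    toℚᵘ (⟦ m ⟧ * ⟦ n ⟧)                            ∎)
    where open ℚᵘ.≃-Reasoning

  0≤⟦_⟧ : ∀ m → 0ℚ ≤ ⟦ m ⟧
  0≤⟦ m ⟧ = nonNegative⁻¹ ⟦ m ⟧ {{normalize-nonNeg m 1}}

  0≤p+q : ∀ {p q} → 0ℚ ≤ p → 0ℚ ≤ q → 0ℚ ≤ p + q
  0≤p+q {p} {q} 0≤p 0≤q = nonNegative⁻¹ (p + q)
    {{nonNeg+nonNeg⇒nonNeg p {{nonNegative 0≤p}} q {{nonNegative 0≤q}}}}

  0≤p*q : ∀ {p q} → 0ℚ ≤ p → 0ℚ ≤ q → 0ℚ ≤ p * q
  0≤p*q {p} {q} 0≤p 0≤q = nonNegative⁻¹ (p * q)
    {{nonNeg*nonNeg⇒nonNeg p {{nonNegative 0≤p}} q {{nonNegative 0≤q}}}}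

  0<p*q : ∀ {p q} → 0ℚ < p → 0ℚ < q → 0ℚ < p * q
  0<p*q {p} {q} 0<p 0<q = positive⁻¹ (p * q) {{pos*pos⇒pos p {{positive 0<p}} q {{positive 0<q}}}}

  p≤q⇒0≤q-p : ∀ {p q} → p ≤ q → 0ℚ ≤ q - p
  p≤q⇒0≤q-p {p} {q} p≤q = subst (_≤ q - p) (+-inverseʳ p) (+-monoˡ-≤ (- p) p≤q)

  0≤q-p⇒p≤q : ∀ {p q} → 0ℚ ≤ q - p → p ≤ q
  0≤q-p⇒p≤q {p} {q} le = subst₂ _≤_ (+-identityˡ p)
    (solve 2 (λ p q → q :- p :+ p := q) refl p q) (+-monoˡ-≤ p le)

  p≤∣p∣ : ∀ p → p ≤ ∣ p ∣
  p≤∣p∣ p with ≤-total 0ℚ p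
  ... | inj₁ 0≤p = ≤-reflexive (sym (0≤p⇒∣p∣≡p 0≤p))
  ... | inj₂ p≤0 = ≤-trans p≤0 (0≤∣p∣ p)

  ∣p∣≤ : ∀ {p r} → p ≤ r → - p ≤ r → ∣ p ∣ ≤ r
  ∣p∣≤ {p} p≤r -p≤r with ∣p∣≡p∨∣p∣≡-p p
  ... | inj₁ eq = ≤-trans (≤-reflexive eq) p≤r
  ... | inj₂ eq = ≤-trans (≤-reflexive eq) -p≤r

  ∣p∣≤∣p-q∣+∣q∣ : ∀ p q → ∣ p ∣ ≤ ∣ p - q ∣ + ∣ q ∣
  ∣p∣≤∣p-q∣+∣q∣ p q = ≤-trans (≤-reflexive (cong ∣_∣ (solve 2 (λ p q → p := p :- q :+ q) refl p q)))
    (∣p+q∣≤∣p∣+∣q∣ (p - q) q)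

  ∣∣p∣-∣q∣∣≤∣p-q∣ : ∀ p q → ∣ ∣ p ∣ - ∣ q ∣ ∣ ≤ ∣ p - q ∣
  ∣∣p∣-∣q∣∣≤∣p-q∣ p q = ∣p∣≤ (half p q)
    (subst₂ _≤_ (solve 2 (λ p q → q :- p := :- (p :- q)) refl ∣ p ∣ ∣ q ∣)
      (trans (cong ∣_∣ (solve 2 (λ p q → q :- p := :- (p :- q)) refl p q)) (∣-p∣≡∣p∣ (p - q))) (half q p))
    where
    half : ∀ p q → ∣ p ∣ - ∣ q ∣ ≤ ∣ p - q ∣
    half p q = subst (∣ p ∣ - ∣ q ∣ ≤_) (solve 2 (λ a b → a :+ b :- b := a) refl ∣ p - q ∣ ∣ q ∣)
      (+-monoˡ-≤ (- ∣ q ∣) (∣p∣≤∣p-q∣+∣q∣ p q))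

  0<½*p : ∀ {p} → 0ℚ < p → 0ℚ < ½ * p
  0<½*p = 0<p*q (positive⁻¹ ½)

  divide : ∀ {b ε} → 0ℚ < b → 0ℚ < ε → ∃[ η ] (0ℚ < η × η * b ≡ ε)
  divide {b} {ε} 0<b 0<ε = ε * 1/ b , 0<p*q 0<ε (positive⁻¹ (1/ b)) ,
    trans (*-assoc ε (1/ b) b) (trans (cong (ε *_) (*-inverseˡ b)) (*-identityʳ ε))
    where
    instance
      _ = positive 0<b
      _ = pos⇒nonZero b
      _ = 1/pos⇒pos b

-- Order and absolute value for Cauchy reals.

module Reals where
  open Rationals
  open import Defs
  open import Data.Fin.Base using (Fin; zero; suc)
  open import Data.Nat.Base as ℕ using (ℕ; zero; suc; _⊔_)
  import Data.Nat.Properties as ℕ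
  open import Data.Rational.Base as ℚ using (ℚ; 0ℚ; 1ℚ; ½; ∣_∣)
  import Data.Rational.Properties as ℚ
  open import Data.Rational.Solver using (module +-*-Solver)
  open import Data.Product.Base using (∃-syntax; _×_; _,_)
  open import Data.Sum.Base using (_⊎_; inj₁; inj₂)
  open import Function.Base using (_∘_)
  open import Relation.Binary.PropositionalEquality
  open import Relation.Nullary using (contradiction)
  open +-*-Solver using (solve; _:=_; _:+_; _:*_; _:-_; :-_; con)

  Eventually : (ℕ → Set) → Set
  Eventually P = ∃[ N ] (∀ k → N ℕ.≤ k → P k)

  map-ev : ∀ {P Q : ℕ → Set} → (∀ k → P k → Q k) → Eventually P → Eventually Q
  map-ev f (N , p) = N , λ k N≤k → f k (p k N≤k)

  zip-ev : ∀ {P Q R : ℕ → Set} → (∀ k → P k → Q k → R k) → Eventually P → Eventually Q → Eventually R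
  zip-ev f (M , p) (N , q) = M ⊔ N , λ k ≤k →
    f k (p k (ℕ.≤-trans (ℕ.m≤m⊔n M N) ≤k)) (q k (ℕ.≤-trans (ℕ.m≤n⊔m M N) ≤k))

  0≤-pointwise : ∀ {x} → (∀ k → 0ℚ ℚ.≤ seq x k) → 0ℝ ≤ x
  0≤-pointwise 0≤x ε 0<ε = 0 , λ k _ → 0≤p+q (0≤x k) (ℚ.<⇒≤ 0<ε)

  -- Operations on reals are termwise, so ring identities hold at every index and the rational
  -- solver proves them. Most inequalities below are reduced to nonnegativity of an expression and
  -- transported along such an identity.
  0≤-resp : ∀ {x y} → (∀ k → seq x k ≡ seq y k) → 0ℝ ≤ x → 0ℝ ≤ y
  0≤-resp x≡y 0≤x ε 0<ε = map-ev (λ k → subst (λ s → 0ℚ ℚ.≤ s ℚ.+ ε) (x≡y k)) (0≤x ε 0<ε)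

  0≤+ : ∀ {x y} → 0ℝ ≤ x → 0ℝ ≤ y → 0ℝ ≤ x + y
  0≤+ {x} {y} 0≤x 0≤y ε 0<ε = zip-ev
    (λ k p q → subst (0ℚ ℚ.≤_) (solve 3 (λ x y ε →
        (x :+ con ½ :* ε) :+ (y :+ con ½ :* ε) := x :+ y :+ ε) refl (seq x k) (seq y k) ε) (0≤p+q p q))
    (0≤x (½ ℚ.* ε) (0<½*p 0<ε)) (0≤y (½ ℚ.* ε) (0<½*p 0<ε))

  bounded : ∀ x → ∃[ B ] (0ℚ ℚ.< B × Eventually (λ k → ∣ seq x k ∣ ℚ.≤ B))
  bounded x with isCauchy x 1ℚ (ℚ.positive⁻¹ 1ℚ)
  ... | N , near = 1ℚ ℚ.+ ∣ seq x N ∣ ,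
    ℚ.+-mono-<-≤ (ℚ.positive⁻¹ 1ℚ) (ℚ.0≤∣p∣ (seq x N)) ,
    N , λ k N≤k → ℚ.≤-trans (∣p∣≤∣p-q∣+∣q∣ (seq x k) (seq x N))
      (ℚ.+-monoˡ-≤ ∣ seq x N ∣ (near k N N≤k ℕ.≤-refl))

  -- A nonnegative real may have slightly negative terms, so the other factor must be bounded to
  -- control the error. For `a ≤ 0` the estimate is the identity (- a)(C - b) + (a + η) C = a b + η
  -- C with both summands nonnegative.
  product-bound : ∀ ε a b {B C η θ} → 0ℚ ℚ.< B → 0ℚ ℚ.< C → 0ℚ ℚ.< ε →
    η ℚ.* C ≡ ε → θ ℚ.* B ≡ ε → 0ℚ ℚ.≤ a ℚ.+ η → 0ℚ ℚ.≤ b ℚ.+ θ → ∣ a ∣ ℚ.≤ B → ∣ b ∣ ℚ.≤ C →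
    0ℚ ℚ.≤ a ℚ.* b ℚ.+ ε
  product-bound ε a b 0<B 0<C 0<ε η≡ θ≡ 0≤a+η 0≤b+θ a≤B b≤C = by-sign (ℚ.≤-total 0ℚ a) (ℚ.≤-total 0ℚ b)
    where
    one-negative : ∀ a b {C η} → a ℚ.≤ 0ℚ → 0ℚ ℚ.< C → 0ℚ ℚ.≤ a ℚ.+ η → ∣ b ∣ ℚ.≤ C →
      η ℚ.* C ≡ ε → 0ℚ ℚ.≤ a ℚ.* b ℚ.+ ε
    one-negative a b {C} {η} a≤0 0<C 0≤a+η b≤C eq = subst (0ℚ ℚ.≤_)
      (trans (solve 4 (λ a b C η → (con 0ℚ :- a) :* (C :- b) :+ (a :+ η) :* C := a :* b :+ η :* C) refl a b C η)
        (cong (a ℚ.* b ℚ.+_) eq))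
      (0≤p+q (0≤p*q (p≤q⇒0≤q-p a≤0) (p≤q⇒0≤q-p (ℚ.≤-trans (p≤∣p∣ b) b≤C))) (0≤p*q 0≤a+η (ℚ.<⇒≤ 0<C)))
    by-sign : 0ℚ ℚ.≤ a ⊎ a ℚ.≤ 0ℚ → 0ℚ ℚ.≤ b ⊎ b ℚ.≤ 0ℚ → 0ℚ ℚ.≤ a ℚ.* b ℚ.+ ε
    by-sign (inj₂ a≤0) _          = one-negative a b a≤0 0<C 0≤a+η b≤C η≡
    by-sign (inj₁ _)   (inj₂ b≤0) = subst (λ p → 0ℚ ℚ.≤ p ℚ.+ ε) (ℚ.*-comm b a)
                                      (one-negative b a b≤0 0<B 0≤b+θ a≤B θ≡)
    by-sign (inj₁ 0≤a) (inj₁ 0≤b) = 0≤p+q (0≤p*q 0≤a 0≤b) (ℚ.<⇒≤ 0<ε)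

  0≤* : ∀ {x y} → 0ℝ ≤ x → 0ℝ ≤ y → 0ℝ ≤ x * y
  0≤* {x} {y} 0≤x 0≤y ε 0<ε =
    let B , 0<B , N₁ , x≤B = bounded x
        C , 0<C , N₂ , y≤C = bounded y
        η , 0<η , η≡       = divide 0<C 0<ε
        θ , 0<θ , θ≡       = divide 0<B 0<ε
        N₃ , 0≤x+η         = 0≤x η 0<η
        N₄ , 0≤y+θ         = 0≤y θ 0<θ
    in (N₁ ⊔ N₂) ⊔ (N₃ ⊔ N₄) , λ k ≤k →
      product-bound ε (seq x k) (seq y k) 0<B 0<C 0<ε η≡ θ≡
        (0≤x+η k (ℕ.m⊔n≤o⇒m≤o N₃ N₄ (ℕ.m⊔n≤o⇒n≤o (N₁ ⊔ N₂) (N₃ ⊔ N₄) ≤k)))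
        (0≤y+θ k (ℕ.m⊔n≤o⇒n≤o N₃ N₄ (ℕ.m⊔n≤o⇒n≤o (N₁ ⊔ N₂) (N₃ ⊔ N₄) ≤k)))
        (x≤B k (ℕ.m⊔n≤o⇒m≤o N₁ N₂ (ℕ.m⊔n≤o⇒m≤o (N₁ ⊔ N₂) (N₃ ⊔ N₄) ≤k)))
        (y≤C k (ℕ.m⊔n≤o⇒n≤o N₁ N₂ (ℕ.m⊔n≤o⇒m≤o (N₁ ⊔ N₂) (N₃ ⊔ N₄) ≤k)))

  ≤⇒0≤ : ∀ {x y} → x ≤ y → 0ℝ ≤ y - x
  ≤⇒0≤ {x} {y} x≤y ε 0<ε = map-ev (λ k p → subst (0ℚ ℚ.≤_)
    (solve 3 (λ x y ε → y :+ ε :- x := y :- x :+ ε) refl (seq x k) (seq y k) ε) (p≤q⇒0≤q-p p)) (x≤y ε 0<ε)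

  0≤⇒≤ : ∀ {x y} → 0ℝ ≤ y - x → x ≤ y
  0≤⇒≤ {x} {y} le ε 0<ε = map-ev (λ k p → 0≤q-p⇒p≤q (subst (0ℚ ℚ.≤_)
    (solve 3 (λ x y ε → y :- x :+ ε := y :+ ε :- x) refl (seq x k) (seq y k) ε) p)) (le ε 0<ε)

  ≤-pointwise : ∀ {x y} → (∀ k → seq x k ℚ.≤ seq y k) → x ≤ y
  ≤-pointwise {x} {y} x≤y = 0≤⇒≤ {x} {y} (0≤-pointwise {y - x} (λ k → p≤q⇒0≤q-p (x≤y k)))

  ≤-reflexive : ∀ {x y} → (∀ k → seq x k ≡ seq y k) → x ≤ y
  ≤-reflexive {x} {y} x≡y = ≤-pointwise {x} {y} (λ k → ℚ.≤-reflexive (x≡y k))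

  ≤-trans : ∀ {x y z} → x ≤ y → y ≤ z → x ≤ z
  ≤-trans {x} {y} {z} x≤y y≤z = 0≤⇒≤ {x} {z} (0≤-resp {(y - x) + (z - y)} {z - x}
    (λ k → solve 3 (λ x y z → (y :- x) :+ (z :- y) := z :- x) refl (seq x k) (seq y k) (seq z k))
    (0≤+ {y - x} {z - y} (≤⇒0≤ {x} {y} x≤y) (≤⇒0≤ {y} {z} y≤z)))

  +-mono-≤ : ∀ {x y z w} → x ≤ y → z ≤ w → x + z ≤ y + w
  +-mono-≤ {x} {y} {z} {w} x≤y z≤w = 0≤⇒≤ {x + z} {y + w} (0≤-resp {(y - x) + (w - z)} {(y + w) - (x + z)}
    (λ k → solve 4 (λ x y z w → (y :- x) :+ (w :- z) := (y :+ w) :- (x :+ z)) refl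
      (seq x k) (seq y k) (seq z k) (seq w k))
    (0≤+ {y - x} {w - z} (≤⇒0≤ {x} {y} x≤y) (≤⇒0≤ {z} {w} z≤w)))

  *-monoˡ-≤ : ∀ {c x y} → 0ℝ ≤ c → x ≤ y → c * x ≤ c * y
  *-monoˡ-≤ {c} {x} {y} 0≤c x≤y = 0≤⇒≤ {c * x} {c * y} (0≤-resp {c * (y - x)} {c * y - c * x}
    (λ k → solve 3 (λ c x y → c :* (y :- x) := c :* y :- c :* x) refl (seq c k) (seq x k) (seq y k))
    (0≤* {c} {y - x} 0≤c (≤⇒0≤ {x} {y} x≤y)))

  ∑-mono-≤ : ∀ {n} {f g : Fin n → ℝ} → (∀ i → f i ≤ g i) → ∑ f ≤ ∑ g
  ∑-mono-≤ {zero}  f≤g = ≤-reflexive {0ℝ} {0ℝ} (λ _ → refl)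
  ∑-mono-≤ {suc n} {f} {g} f≤g = +-mono-≤ {f zero} {g zero} {∑ (f ∘ suc)} {∑ (g ∘ suc)}
    (f≤g zero) (∑-mono-≤ (f≤g ∘ suc))

  <⇒≤ : ∀ {x y} → x < y → x ≤ y
  <⇒≤ {x} {y} (ε , 0<ε , N , gap) η 0<η = N , λ k N≤k → ℚ.≤-trans
    (ℚ.≤-trans (ℚ.≤-reflexive (sym (ℚ.+-identityʳ (seq x k)))) (ℚ.+-monoʳ-≤ (seq x k) (ℚ.<⇒≤ 0<ε)))
    (ℚ.≤-trans (gap k N≤k) (ℚ.≤-trans (ℚ.≤-reflexive (sym (ℚ.+-identityʳ (seq y k))))
      (ℚ.+-monoʳ-≤ (seq y k) (ℚ.<⇒≤ 0<η))))

  abs : ℝ → ℝ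
  abs x = mkℝ (λ k → ∣ seq x k ∣) cauchy
    where
    cauchy : IsCauchy (λ k → ∣ seq x k ∣)
    cauchy ε 0<ε with isCauchy x ε 0<ε
    ... | N , near = N , λ m n N≤m N≤n →
      ℚ.≤-trans (∣∣p∣-∣q∣∣≤∣p-q∣ (seq x m) (seq x n)) (near m n N≤m N≤n)

  ≃⇒≤ : ∀ {x y} → x ≃ y → x ≤ y
  ≃⇒≤ {x} {y} x≃y ε 0<ε = map-ev (λ k near → subst (ℚ._≤ seq y k ℚ.+ ε)
    (solve 2 (λ x y → y :+ (x :- y) := x) refl (seq x k) (seq y k))
    (ℚ.+-monoʳ-≤ (seq y k) (ℚ.≤-trans (p≤∣p∣ _) near))) (x≃y ε 0<ε)

  ≃-sym : ∀ {x y} → x ≃ y → y ≃ x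
  ≃-sym {x} {y} x≃y ε 0<ε = map-ev (λ k → ℚ.≤-trans (ℚ.≤-reflexive
    (trans (cong ∣_∣ (solve 2 (λ x y → y :- x := :- (x :- y)) refl (seq x k) (seq y k)))
      (ℚ.∣-p∣≡∣p∣ _)))) (x≃y ε 0<ε)

  abs-cong : ∀ {x y} → x ≃ y → abs x ≃ abs y
  abs-cong {x} {y} x≃y ε 0<ε = map-ev (λ k → ℚ.≤-trans (∣∣p∣-∣q∣∣≤∣p-q∣ (seq x k) (seq y k))) (x≃y ε 0<ε)

  abs≤0⇒≃0 : ∀ {x} → abs x ≤ 0ℝ → x ≃ 0ℝ
  abs≤0⇒≃0 {x} le ε 0<ε = map-ev (λ k → subst₂ ℚ._≤_
    (cong ∣_∣ (solve 1 (λ x → x := x :- con 0ℚ) refl (seq x k))) (ℚ.+-identityˡ ε)) (le ε 0<ε)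

  -- The only problem is a negative term; adding x + ε/2 ≥ 0 to itself gives - x ≤ x + ε.
  0≤⇒abs≤ : ∀ {x} → 0ℝ ≤ x → abs x ≤ x
  0≤⇒abs≤ {x} 0≤x ε 0<ε = map-ev (λ k 0≤x+½ε → ∣p∣≤
    (ℚ.≤-trans (ℚ.≤-reflexive (sym (ℚ.+-identityʳ (seq x k)))) (ℚ.+-monoʳ-≤ (seq x k) (ℚ.<⇒≤ 0<ε)))
    (0≤q-p⇒p≤q (subst (0ℚ ℚ.≤_) (solve 2 (λ x ε →
      (x :+ con ½ :* ε) :+ (x :+ con ½ :* ε) := x :+ ε :- (:- x)) refl (seq x k) ε) (0≤p+q 0≤x+½ε 0≤x+½ε))))
    (0≤x (½ ℚ.* ε) (0<½*p 0<ε))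

  -- If b > q + ε and q ≥ -η with ε = 4η, then b² - q² = (b - q)(b + q) > 4η · 2η.
  square-bound : ∀ b q ε → let η = ½ ℚ.* (½ ℚ.* ε) in 0ℚ ℚ.< ε → 0ℚ ℚ.≤ q ℚ.+ η →
    0ℚ ℚ.≤ (q ℚ.* q ℚ.- b ℚ.* b) ℚ.+ η ℚ.* η → b ℚ.≤ q ℚ.+ ε
  square-bound b q ε 0<ε 0≤q+η 0≤squares = by-cases (ℚ.≤-total b (q ℚ.+ ε))
    where
    η = ½ ℚ.* (½ ℚ.* ε)
    0<η : 0ℚ ℚ.< η
    0<η  = 0<½*p (0<½*p 0<ε)
    0≤η  = ℚ.<⇒≤ 0<η
    0≤ε  = ℚ.<⇒≤ 0<ε
    0≤2Z = 0≤p+q 0≤q+η 0≤q+η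
    0≤6η = 0≤p+q 0≤ε (0≤p+q 0≤η 0≤η)
    -- Under the assumption `X ≥ 0` to be refuted, every summand on the left is nonnegative, whereas
    -- the right side is - η².
    identity : ∀ b q ε → let η = ½ ℚ.* (½ ℚ.* ε) ; X = b ℚ.- (q ℚ.+ ε) ; Z = q ℚ.+ η in
      ((q ℚ.* q ℚ.- b ℚ.* b) ℚ.+ η ℚ.* η)
        ℚ.+ ((X ℚ.* ((X ℚ.+ (Z ℚ.+ Z)) ℚ.+ (ε ℚ.+ (η ℚ.+ η))) ℚ.+ ε ℚ.* (Z ℚ.+ Z)) ℚ.+ (ε ℚ.+ (η ℚ.+ η)) ℚ.* η)
      ≡ 0ℚ ℚ.- η ℚ.* η
    identity = solve 3 (λ b q ε → let η = con ½ :* (con ½ :* ε) ; X = b :- (q :+ ε) ; Z = q :+ η in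
      ((q :* q :- b :* b) :+ η :* η)
        :+ ((X :* ((X :+ (Z :+ Z)) :+ (ε :+ (η :+ η))) :+ ε :* (Z :+ Z)) :+ (ε :+ (η :+ η)) :* η)
      := con 0ℚ :- η :* η) refl
    by-cases : b ℚ.≤ q ℚ.+ ε ⊎ q ℚ.+ ε ℚ.≤ b → b ℚ.≤ q ℚ.+ ε
    by-cases (inj₁ b≤) = b≤
    by-cases (inj₂ b≥) = contradiction (ℚ.<-≤-trans (0<p*q 0<η 0<η) (0≤q-p⇒p≤q (subst (0ℚ ℚ.≤_)
      (identity b q ε) (0≤p+q 0≤squares (0≤p+q (0≤p+q
        (0≤p*q 0≤X (0≤p+q (0≤p+q 0≤X 0≤2Z) 0≤6η)) (0≤p*q 0≤ε 0≤2Z)) (0≤p*q 0≤6η 0≤η))))))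
      (ℚ.<-irrefl refl)
      where 0≤X = p≤q⇒0≤q-p b≥

  square-cancel-≤ : ∀ {b q} → 0ℝ ≤ q → 0ℝ ≤ q * q - b * b → b ≤ q
  square-cancel-≤ {b} {q} 0≤q le ε 0<ε =
    let 0<η = 0<½*p (0<½*p 0<ε) in
    zip-ev (λ k → square-bound (seq b k) (seq q k) ε 0<ε) (0≤q _ 0<η) (le _ (0<p*q 0<η 0<η))

-- The bound on the spectral radius of a graph with few edges.

module Spectral where
  open Rationals
  open Reals
  open import Defs
  open Sums using (kron; sum-kron; sum-const; sum-mono) renaming (sum to sumℕ; sum-cong to sum-congℕ)
  open Degrees using (ind; degree≡sum; ind-sym; sum-degrees; neighbour-degrees; degree<n)
  open import Algebra.Bundles using (CommutativeRing)
  open import Data.Bool.Base using (true; false; if_then_else_)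
  open import Data.Fin.Base using (Fin; zero; suc)
  open import Data.Fin.Properties using (_≟_)
  open import Data.Nat.Base as ℕ using (ℕ; zero; suc)
  import Data.Nat.Properties as ℕ
  open import Data.Rational.Base as ℚ using (ℚ; 0ℚ; 1ℚ; ½; ∣_∣)
  import Data.Rational.Properties as ℚ
  open import Data.Rational.Solver using (module +-*-Solver)
  open import Data.Product.Base using (∃-syntax; _×_; _,_)
  open import Function.Base using (_∘_)
  open import Relation.Binary.PropositionalEquality
  open import Relation.Nullary using (does)
  open +-*-Solver using (solve; _:=_; _:+_; _:*_; _:-_; :-_; con)
  open import Algebra.Properties.Semiring.Sum (CommutativeRing.semiring ℚ.+-*-commutativeRing)
    using (sum; ∑-comm; ∑-distrib-+; *-distribˡ-sum; *-distribʳ-sum) renaming (sum-cong-≗ to sum-cong)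

  absᵥ : ∀ {n} → (Fin n → ℝ) → Fin n → ℝ
  absᵥ x i = abs (x i)

  seq-∑ : ∀ {n} (f : Fin n → ℝ) k → seq (∑ f) k ≡ sum (λ i → seq (f i) k)
  seq-∑ {zero}  f k = refl
  seq-∑ {suc n} f k = cong (seq (f zero) k ℚ.+_) (seq-∑ (f ∘ suc) k)

  ⟦⟧-sum : ∀ {n} (f : Fin n → ℕ) → sum (λ i → ⟦ f i ⟧) ≡ ⟦ sumℕ f ⟧
  ⟦⟧-sum {zero}  f = refl
  ⟦⟧-sum {suc n} f = trans (cong (⟦ f zero ⟧ ℚ.+_) (⟦⟧-sum (f ∘ suc))) (sym (⟦⟧-+ (f zero) _))

  ∣sum∣≤ : ∀ {n} (f : Fin n → ℚ) → ∣ sum f ∣ ℚ.≤ sum (λ i → ∣ f i ∣)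
  ∣sum∣≤ {zero}  f = ℚ.≤-refl
  ∣sum∣≤ {suc n} f = ℚ.≤-trans (ℚ.∣p+q∣≤∣p∣+∣q∣ (f zero) _) (ℚ.+-monoʳ-≤ ∣ f zero ∣ (∣sum∣≤ (f ∘ suc)))

  abs-∑-≤ : ∀ {n} (f : Fin n → ℝ) → abs (∑ f) ≤ ∑ (abs ∘ f)
  abs-∑-≤ f = ≤-pointwise {abs (∑ f)} {∑ (abs ∘ f)} λ k → subst₂ ℚ._≤_
    (cong ∣_∣ (sym (seq-∑ f k))) (sym (seq-∑ (abs ∘ f) k)) (∣sum∣≤ (λ i → seq (f i) k))

  term≤∑ : ∀ {n} (f : Fin n → ℝ) → (∀ i → 0ℝ ≤ f i) → ∀ i → f i ≤ ∑ f
  term≤∑ {suc n} f 0≤f zero = 0≤⇒≤ {f zero} {∑ f} (0≤-resp {∑ (f ∘ suc)} {∑ f - f zero}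
    (λ k → solve 2 (λ a b → b := a :+ b :- a) refl (seq (f zero) k) (seq (∑ (f ∘ suc)) k)) (0≤∑ (f ∘ suc) (0≤f ∘ suc)))
    where
    0≤∑ : ∀ {n} (f : Fin n → ℝ) → (∀ i → 0ℝ ≤ f i) → 0ℝ ≤ ∑ f
    0≤∑ {zero}  f 0≤f = ≤-reflexive {0ℝ} {0ℝ} (λ _ → refl)
    0≤∑ {suc n} f 0≤f = 0≤+ {f zero} {∑ (f ∘ suc)} (0≤f zero) (0≤∑ (f ∘ suc) (0≤f ∘ suc))
  term≤∑ {suc n} f 0≤f (suc i) = ≤-trans {f (suc i)} {∑ (f ∘ suc)} {∑ f} (term≤∑ (f ∘ suc) (0≤f ∘ suc) i)
    (0≤⇒≤ {∑ (f ∘ suc)} {∑ f} (0≤-resp {f zero} {∑ f - ∑ (f ∘ suc)}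
      (λ k → solve 2 (λ a b → a := a :+ b :- b) refl (seq (f zero) k) (seq (∑ (f ∘ suc)) k)) (0≤f zero)))

  0≤fromℕ : ∀ m → 0ℝ ≤ fromℕ m
  0≤fromℕ m = 0≤-pointwise {fromℕ m} (λ _ → 0≤⟦ m ⟧)

  -- With q = 2ρ - b the hypothesis reads q > s, and 4 (ρ (ρ - b) - a) = q² - s².
  above-root : ∀ {b a ρ s} → 0ℝ ≤ a → s IsSqrtOf (b * b + fromℕ 4 * a) → (b + s) /2 < ρ →
    0ℝ ≤ ρ - b × ∃[ η ] (0ℚ ℚ.< η × fromℚ η ≤ ρ * (ρ - b) - a)
  above-root {b} {a} {ρ} {s} 0≤a (0≤s , s²≃) (ε , 0<ε , N , gap) =
    0≤-resp {fromℚ ½ * (q - b)} {ρ - b}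
      (λ k → solve 2 (λ b ρ → con ½ :* (ρ :+ ρ :- b :- b) := ρ :- b) refl (seq b k) (seq ρ k))
      (0≤* {fromℚ ½} {q - b} (0≤-pointwise {fromℚ ½} (λ _ → ℚ.<⇒≤ (ℚ.positive⁻¹ ½)))
        (≤⇒0≤ {b} {q} (square-cancel-≤ {b} {q} 0≤q 0≤q²-b²))) ,
    -- The gap ε between (b + s)/2 and ρ gives q ≥ s + 2ε, hence q² - s² ≥ 4ε²; a quarter of that is
    -- the gap for ρ (ρ - b) - a.
    ε ℚ.* ε , 0<p*q 0<ε 0<ε ,
    0≤⇒≤ {fromℚ (ε ℚ.* ε)} {ρ * (ρ - b) - a} (0≤-resp {fromℚ (½ ℚ.* ½) * excess} {ρ * (ρ - b) - a - fromℚ (ε ℚ.* ε)}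
      (λ k → solve 4 (λ b a ρ ε → con (½ ℚ.* ½) :* ((ρ :+ ρ :- b) :* (ρ :+ ρ :- b) :- (b :* b :+ con ⟦ 4 ⟧ :* a) :- con ⟦ 4 ⟧ :* (ε :* ε))
             := ρ :* (ρ :- b) :- a :- ε :* ε) refl (seq b k) (seq a k) (seq ρ k) ε)
      (0≤* {fromℚ (½ ℚ.* ½)} {excess} (0≤-pointwise {fromℚ (½ ℚ.* ½)} (λ _ → ℚ.<⇒≤ (ℚ.positive⁻¹ (½ ℚ.* ½)))) 0≤excess))
    where
    q = ρ + ρ - b
    excess = q * q - (b * b + fromℕ 4 * a) - fromℕ 4 * fromℚ (ε ℚ.* ε)
    E = fromℚ ε
    0≤E : 0ℝ ≤ E
    0≤E = 0≤-pointwise {E} (λ _ → ℚ.<⇒≤ 0<ε)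
    room : 0ℝ ≤ q - s - (E + E)
    room = 0≤-resp {(ρ - ((b + s) /2 + E)) + (ρ - ((b + s) /2 + E))} {q - s - (E + E)}
      (λ k → solve 4 (λ b s ρ ε → (ρ :- ((b :+ s) :* con ½ :+ ε)) :+ (ρ :- ((b :+ s) :* con ½ :+ ε))
        := (ρ :+ ρ :- b) :- s :- (ε :+ ε)) refl (seq b k) (seq s k) (seq ρ k) ε)
      (0≤+ {ρ - ((b + s) /2 + E)} {ρ - ((b + s) /2 + E)} half half)
      where
      half : 0ℝ ≤ ρ - ((b + s) /2 + E)
      half = ≤⇒0≤ {(b + s) /2 + E} {ρ} λ η 0<η → N , λ k N≤k → ℚ.≤-trans (gap k N≤k)
        (ℚ.≤-trans (ℚ.≤-reflexive (sym (ℚ.+-identityʳ (seq ρ k)))) (ℚ.+-monoʳ-≤ (seq ρ k) (ℚ.<⇒≤ 0<η)))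
    0≤q : 0ℝ ≤ q
    0≤q = 0≤-resp {(q - s - (E + E)) + (s + (E + E))} {q}
      (λ k → solve 3 (λ q s ε → (q :- s :- (ε :+ ε)) :+ (s :+ (ε :+ ε)) := q) refl (seq q k) (seq s k) ε)
      (0≤+ {q - s - (E + E)} {s + (E + E)} room (0≤+ {s} {E + E} 0≤s (0≤+ {E} {E} 0≤E 0≤E)))
    0≤excess : 0ℝ ≤ excess
    0≤excess = 0≤-resp
      {((q - s - (E + E)) * (q + s + (E + E)) + fromℕ 4 * (E * s)) + (s * s - (b * b + fromℕ 4 * a))} {excess}
      (λ k → solve 5 (λ b a q s ε →
          (q :- s :- (ε :+ ε)) :* (q :+ s :+ (ε :+ ε)) :+ con ⟦ 4 ⟧ :* (ε :* s) :+ (s :* s :- (b :* b :+ con ⟦ 4 ⟧ :* a))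
          := q :* q :- (b :* b :+ con ⟦ 4 ⟧ :* a) :- con ⟦ 4 ⟧ :* (ε :* ε)) refl (seq b k) (seq a k) (seq q k) (seq s k) ε)
      (0≤+ {(q - s - (E + E)) * (q + s + (E + E)) + fromℕ 4 * (E * s)} {s * s - (b * b + fromℕ 4 * a)}
        (0≤+ {(q - s - (E + E)) * (q + s + (E + E))} {fromℕ 4 * (E * s)}
          (0≤* {q - s - (E + E)} {q + s + (E + E)} room
            (0≤+ {q + s} {E + E} (0≤+ {q} {s} 0≤q 0≤s) (0≤+ {E} {E} 0≤E 0≤E)))
          (0≤* {fromℕ 4} {E * s} (0≤fromℕ 4) (0≤* {E} {s} 0≤E 0≤s)))
        (≤⇒0≤ {b * b + fromℕ 4 * a} {s * s}
          (≃⇒≤ {b * b + fromℕ 4 * a} {s * s} (≃-sym {s * s} {b * b + fromℕ 4 * a} s²≃))))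
    0≤q²-b² : 0ℝ ≤ q * q - b * b
    0≤q²-b² = 0≤-resp {excess + fromℕ 4 * (a + E * E)} {q * q - b * b}
      (λ k → solve 4 (λ b a q ε →
          (q :* q :- (b :* b :+ con ⟦ 4 ⟧ :* a) :- con ⟦ 4 ⟧ :* (ε :* ε)) :+ con ⟦ 4 ⟧ :* (a :+ ε :* ε)
          := q :* q :- b :* b) refl (seq b k) (seq a k) (seq q k) ε)
      (0≤+ {excess} {fromℕ 4 * (a + E * E)} 0≤excess
        (0≤* {fromℕ 4} {a + E * E} (0≤fromℕ 4) (0≤+ {a} {E * E} 0≤a (0≤* {E} {E} 0≤E 0≤E))))

  scale-∑ : ∀ {n} r (w z : Fin n → ℝ) k → seq (r * ∑ (λ i → w i * z i)) k ≡ seq (∑ (λ i → w i * (r * z i))) k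
  scale-∑ {zero}  r w z k = ℚ.*-zeroʳ (seq r k)
  scale-∑ {suc n} r w z k = trans
    (solve 4 (λ r w z S → r :* (w :* z :+ S) := w :* (r :* z) :+ r :* S) refl
      (seq r k) (seq (w zero) k) (seq (z zero) k) (seq (∑ (λ i → w (suc i) * z (suc i))) k))
    (cong (seq (w zero) k ℚ.* (seq r k ℚ.* seq (z zero) k) ℚ.+_) (scale-∑ r (w ∘ suc) (z ∘ suc) k))

  module _ {n : ℕ} (G : Graph n) where

    entry : ∀ α i j k → seq (Aα G α i j) k ≡
      seq α k ℚ.* ⟦ kron i j (degree G i) ⟧ ℚ.+ (1ℚ ℚ.- seq α k) ℚ.* ⟦ ind G i j ⟧
    entry α i j k = cong₂ (λ X Y → seq α k ℚ.* X ℚ.+ (1ℚ ℚ.- seq α k) ℚ.* Y)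
      (branch (does (i ≟ j)) (degree G i)) (branch (does (Graph.adj? G i j)) 1)
      where
      branch : ∀ b m → seq (if b then fromℕ m else 0ℝ) k ≡ ⟦ if b then m else 0 ⟧
      branch true  m = refl
      branch false m = refl

    neighbour-sum : (Fin n → ℕ) → Fin n → ℕ
    neighbour-sum w j = sumℕ (λ i → ind G i j ℕ.* w i)

    -- Interchanging the sums replaces row weights by column weights: the diagonal of column j
    -- contributes α dⱼ wⱼ, and its adjacency part 1 - α times the weight of the neighbours of j. It
    -- is an identity of rationals, applied at each index of the Cauchy sequences.
    weighted-columns : ∀ a (w : Fin n → ℕ) (z : Fin n → ℚ) →
      sum (λ i → ⟦ w i ⟧ ℚ.* sum (λ j →
        (a ℚ.* ⟦ kron i j (degree G i) ⟧ ℚ.+ (1ℚ ℚ.- a) ℚ.* ⟦ ind G i j ⟧) ℚ.* z j))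
      ≡ sum (λ j → (a ℚ.* ⟦ degree G j ℕ.* w j ⟧ ℚ.+ (1ℚ ℚ.- a) ℚ.* ⟦ neighbour-sum w j ⟧) ℚ.* z j)
    weighted-columns a w z = begin
      sum (λ i → ⟦ w i ⟧ ℚ.* sum (λ j → M i j ℚ.* z j))
        ≡⟨ sum-cong (λ i → *-distribˡ-sum ⟦ w i ⟧ (λ j → M i j ℚ.* z j)) ⟩
      sum (λ i → sum (λ j → ⟦ w i ⟧ ℚ.* (M i j ℚ.* z j)))
        ≡⟨ ∑-comm (λ i j → ⟦ w i ⟧ ℚ.* (M i j ℚ.* z j)) ⟩
      sum (λ j → sum (λ i → ⟦ w i ⟧ ℚ.* (M i j ℚ.* z j)))
        ≡⟨ sum-cong column ⟩
      sum (λ j → (a ℚ.* ⟦ degree G j ℕ.* w j ⟧ ℚ.+ (1ℚ ℚ.- a) ℚ.* ⟦ neighbour-sum w j ⟧) ℚ.* z j) ∎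
      where
      open ≡-Reasoning
      M : Fin n → Fin n → ℚ
      M i j = a ℚ.* ⟦ kron i j (degree G i) ⟧ ℚ.+ (1ℚ ℚ.- a) ℚ.* ⟦ ind G i j ⟧
      D A : Fin n → Fin n → ℕ
      D j i = kron i j (degree G i ℕ.* w i)
      A j i = ind G i j ℕ.* w i
      kron-* : ∀ i j → kron i j (degree G i) ℕ.* w i ≡ D j i
      kron-* i j with does (i ≟ j)
      ... | true  = refl
      ... | false = refl
      expand : ∀ i j → ⟦ w i ⟧ ℚ.* (M i j ℚ.* z j) ≡ (a ℚ.* ⟦ D j i ⟧ ℚ.+ (1ℚ ℚ.- a) ℚ.* ⟦ A j i ⟧) ℚ.* z j
      expand i j = trans
        (solve 6 (λ w a b d e z → w :* ((a :* d :+ b :* e) :* z) := (a :* (d :* w) :+ b :* (e :* w)) :* z) refl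
          ⟦ w i ⟧ a (1ℚ ℚ.- a) ⟦ kron i j (degree G i) ⟧ ⟦ ind G i j ⟧ (z j))
        (cong₂ (λ X Y → (a ℚ.* X ℚ.+ (1ℚ ℚ.- a) ℚ.* Y) ℚ.* z j)
          (trans (sym (⟦⟧-* (kron i j (degree G i)) (w i))) (cong ⟦_⟧ (kron-* i j)))
          (sym (⟦⟧-* (ind G i j) (w i))))
      column : ∀ j → sum (λ i → ⟦ w i ⟧ ℚ.* (M i j ℚ.* z j)) ≡
        (a ℚ.* ⟦ degree G j ℕ.* w j ⟧ ℚ.+ (1ℚ ℚ.- a) ℚ.* ⟦ neighbour-sum w j ⟧) ℚ.* z j
      column j = begin
        sum (λ i → ⟦ w i ⟧ ℚ.* (M i j ℚ.* z j))
          ≡⟨ sum-cong (λ i → expand i j) ⟩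
        sum (λ i → (a ℚ.* ⟦ D j i ⟧ ℚ.+ (1ℚ ℚ.- a) ℚ.* ⟦ A j i ⟧) ℚ.* z j)
          ≡⟨ sym (*-distribʳ-sum (z j) (λ i → a ℚ.* ⟦ D j i ⟧ ℚ.+ (1ℚ ℚ.- a) ℚ.* ⟦ A j i ⟧)) ⟩
        sum (λ i → a ℚ.* ⟦ D j i ⟧ ℚ.+ (1ℚ ℚ.- a) ℚ.* ⟦ A j i ⟧) ℚ.* z j
          ≡⟨ cong (ℚ._* z j) (∑-distrib-+ (λ i → a ℚ.* ⟦ D j i ⟧) (λ i → (1ℚ ℚ.- a) ℚ.* ⟦ A j i ⟧)) ⟩
        (sum (λ i → a ℚ.* ⟦ D j i ⟧) ℚ.+ sum (λ i → (1ℚ ℚ.- a) ℚ.* ⟦ A j i ⟧)) ℚ.* z j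
          ≡⟨ cong₂ (λ X Y → (X ℚ.+ Y) ℚ.* z j)
               (trans (sym (*-distribˡ-sum a (λ i → ⟦ D j i ⟧))) (cong (a ℚ.*_) (⟦⟧-sum (D j))))
               (trans (sym (*-distribˡ-sum (1ℚ ℚ.- a) (λ i → ⟦ A j i ⟧))) (cong ((1ℚ ℚ.- a) ℚ.*_) (⟦⟧-sum (A j)))) ⟩
        (a ℚ.* ⟦ sumℕ (D j) ⟧ ℚ.+ (1ℚ ℚ.- a) ℚ.* ⟦ neighbour-sum w j ⟧) ℚ.* z j
          ≡⟨ cong (λ m → (a ℚ.* ⟦ m ⟧ ℚ.+ (1ℚ ℚ.- a) ℚ.* ⟦ neighbour-sum w j ⟧) ℚ.* z j)
               (sum-kron (λ i → degree G i ℕ.* w i) j) ⟩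
        (a ℚ.* ⟦ degree G j ℕ.* w j ⟧ ℚ.+ (1ℚ ℚ.- a) ℚ.* ⟦ neighbour-sum w j ⟧) ℚ.* z j ∎

    module _ (α : ℝ) (w : Fin n → ℕ) (z : Fin n → ℝ) where

      rows columns : Fin n → ℝ
      rows i = fromℕ (w i) * ∑ (λ j → Aα G α i j * z j)
      columns j = (α * fromℕ (degree G j ℕ.* w j) + (1ℝ - α) * fromℕ (neighbour-sum w j)) * z j

      row-sum : ∀ k i → seq (rows i) k ≡ ⟦ w i ⟧ ℚ.* sum (λ j →
        (seq α k ℚ.* ⟦ kron i j (degree G i) ⟧ ℚ.+ (1ℚ ℚ.- seq α k) ℚ.* ⟦ ind G i j ⟧) ℚ.* seq (z j) k)
      row-sum k i = cong (⟦ w i ⟧ ℚ.*_) (trans (seq-∑ (λ j → Aα G α i j * z j) k)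
        (sum-cong (λ j → cong (ℚ._* seq (z j) k) (entry α i j k))))

      rows≡columns : ∀ k → seq (∑ rows) k ≡ seq (∑ columns) k
      rows≡columns k = trans (seq-∑ rows k) (trans (sum-cong (row-sum k))
        (trans (weighted-columns (seq α k) w (λ j → seq (z j) k)) (sym (seq-∑ columns k))))

    module _ {α : ℝ} (0≤α : 0ℝ ≤ α) (0≤1-α : 0ℝ ≤ 1ℝ - α) where

      0≤entry : ∀ i j → 0ℝ ≤ Aα G α i j
      0≤entry i j = 0≤-resp {α * fromℕ (kron i j (degree G i)) + (1ℝ - α) * fromℕ (ind G i j)} {Aα G α i j}
        (λ k → sym (entry α i j k))
        (0≤+ {α * fromℕ (kron i j (degree G i))} {(1ℝ - α) * fromℕ (ind G i j)}
          (0≤* {α} {fromℕ (kron i j (degree G i))} 0≤α (0≤fromℕ (kron i j (degree G i))))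
          (0≤* {1ℝ - α} {fromℕ (ind G i j)} 0≤1-α (0≤fromℕ (ind G i j))))

      module _ {ρ : ℝ} {x : Fin n → ℝ} (eigen : ∀ i → (Aα G α ·ᵥ x) i ≃ ρ * x i) where

        0≤∣x∣ : ∀ i → 0ℝ ≤ absᵥ x i
        0≤∣x∣ i = 0≤-pointwise {absᵥ x i} (λ k → ℚ.0≤∣p∣ (seq (x i) k))

        -- Since ρ |xᵢ| ≤ |ρ xᵢ| for ρ of either sign, the triangle inequality for row i and
        -- nonnegative entries finish the estimate.
        subeigen : ∀ i → ρ * absᵥ x i ≤ ∑ (λ j → Aα G α i j * absᵥ x j)
        subeigen i =
          ≤-trans {ρ * absᵥ x i} {abs (ρ * x i)} {∑ (λ j → Aα G α i j * absᵥ x j)}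
            (≤-pointwise {ρ * absᵥ x i} {abs (ρ * x i)} (λ k → scale (seq ρ k) (seq (x i) k)))
          (≤-trans {abs (ρ * x i)} {abs (∑ Mx)} {∑ (λ j → Aα G α i j * absᵥ x j)}
            (≃⇒≤ {abs (ρ * x i)} {abs (∑ Mx)} (abs-cong {ρ * x i} {∑ Mx} (≃-sym {∑ Mx} {ρ * x i} (eigen i))))
          (≤-trans {abs (∑ Mx)} {∑ (λ j → abs (Mx j))} {∑ (λ j → Aα G α i j * absᵥ x j)}
            (abs-∑-≤ Mx)
            (∑-mono-≤ {f = λ j → abs (Mx j)} {g = λ j → Aα G α i j * absᵥ x j} nonneg-entry)))
          where
          Mx : Fin n → ℝ
          Mx j = Aα G α i j * x j
          scale : ∀ r y → r ℚ.* ∣ y ∣ ℚ.≤ ∣ r ℚ.* y ∣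
          scale r y = ℚ.≤-trans (ℚ.*-monoʳ-≤-nonNeg ∣ y ∣ {{ℚ.∣-∣-nonNeg y}} (p≤∣p∣ r))
            (ℚ.≤-reflexive (sym (ℚ.∣p*q∣≡∣p∣*∣q∣ r y)))
          nonneg-entry : ∀ j → abs (Mx j) ≤ Aα G α i j * absᵥ x j
          nonneg-entry j = ≤-trans {abs (Mx j)} {absᵥ x j * abs m} {m * absᵥ x j}
            (≤-reflexive {abs (Mx j)} {absᵥ x j * abs m}
              (λ k → trans (ℚ.∣p*q∣≡∣p∣*∣q∣ (seq m k) (seq (x j) k)) (ℚ.*-comm ∣ seq m k ∣ ∣ seq (x j) k ∣)))
            (≤-trans {absᵥ x j * abs m} {absᵥ x j * m} {m * absᵥ x j}
              (*-monoˡ-≤ {absᵥ x j} {abs m} {m} (0≤∣x∣ j) (0≤⇒abs≤ {m} (0≤entry i j)))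
              (≤-reflexive {absᵥ x j * m} {m * absᵥ x j} (λ k → ℚ.*-comm (seq (absᵥ x j) k) (seq m k))))
            where m = Aα G α i j

        scaled : (Fin n → ℕ) → Fin n → ℝ
        scaled w i = fromℕ (w i) * (ρ * absᵥ x i)

        scaled≤rows : ∀ w i → scaled w i ≤ rows α w (absᵥ x) i
        scaled≤rows w i = *-monoˡ-≤ {fromℕ (w i)} {ρ * absᵥ x i} {∑ (λ j → Aα G α i j * absᵥ x j)} (0≤fromℕ (w i)) (subeigen i)

        weighted-subeigen : ∀ w → ρ * ∑ (λ i → fromℕ (w i) * absᵥ x i) ≤ ∑ (columns α w (absᵥ x))
        weighted-subeigen w = ≤-trans {ρ * ∑ (λ i → fromℕ (w i) * absᵥ x i)} {∑ (scaled w)} {∑ (columns α w (absᵥ x))}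
          (≤-reflexive {ρ * ∑ (λ i → fromℕ (w i) * absᵥ x i)} {∑ (scaled w)} (scale-∑ ρ (λ i → fromℕ (w i)) (absᵥ x)))
          (≤-trans {∑ (scaled w)} {∑ (rows α w (absᵥ x))} {∑ (columns α w (absᵥ x))}
            (∑-mono-≤ {f = scaled w} {g = rows α w (absᵥ x)} (scaled≤rows w))
            (≤-reflexive {∑ (rows α w (absᵥ x))} {∑ (columns α w (absᵥ x))} (rows≡columns α w (absᵥ x))))

  combine-∑ : ∀ {n} b a (w z : Fin n → ℝ) k →
    seq (∑ (λ j → (b * w j + a) * z j)) k ≡ seq (b * ∑ (λ j → w j * z j) + a * ∑ (λ j → fromℕ 1 * z j)) k
  combine-∑ {zero}  b a w z k = solve 2 (λ b a → con 0ℚ := b :* con 0ℚ :+ a :* con 0ℚ) refl (seq b k) (seq a k)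
  combine-∑ {suc n} b a w z k = trans
    (cong ((seq b k ℚ.* seq (w zero) k ℚ.+ seq a k) ℚ.* seq (z zero) k ℚ.+_) (combine-∑ b a (w ∘ suc) (z ∘ suc) k))
    (solve 6 (λ b a w z T S → (b :* w :+ a) :* z :+ (b :* T :+ a :* S)
        := b :* (w :* z :+ T) :+ a :* (con 1ℚ :* z :+ S)) refl
      (seq b k) (seq a k) (seq (w zero) k) (seq (z zero) k)
      (seq (∑ (λ j → w (suc j) * z (suc j))) k) (seq (∑ (λ j → fromℕ 1 * z (suc j))) k))

  -- Weighting T - ρ S by ρ - b ≥ 0 and adding the slack of the second inequality eliminates T. With
  -- the gap times S also added, everything collapses to - η S, and `θ` = 1/η rescales this to - S.
  vanishing-sum : ∀ {b a ρ S T η} → 0ℝ ≤ ρ - b → 0ℚ ℚ.< η → fromℚ η ≤ ρ * (ρ - b) - a →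
    0ℝ ≤ S → ρ * S ≤ T → ρ * T ≤ b * T + a * S → S ≤ 0ℝ
  vanishing-sum {b} {a} {ρ} {S} {T} {η} 0≤ρ-b 0<η gap 0≤S ρS≤T ρT≤ =
    let θ , 0<θ , θη≡1 = divide 0<η (ℚ.positive⁻¹ 1ℚ) in
    0≤⇒≤ {S} {0ℝ} (0≤-resp {fromℚ θ * total} {0ℝ - S}
      (λ k → trans (solve 7 (λ b a ρ S T η θ →
            θ :* (((ρ :- b) :* (T :- ρ :* S) :+ (b :* T :+ a :* S :- ρ :* T)) :+ (ρ :* (ρ :- b) :- a :- η) :* S)
            := con 0ℚ :- (θ :* η) :* S) refl (seq b k) (seq a k) (seq ρ k) (seq S k) (seq T k) η θ)
        (trans (cong (λ u → 0ℚ ℚ.- u ℚ.* seq S k) θη≡1) (cong (λ u → 0ℚ ℚ.- u) (ℚ.*-identityˡ (seq S k)))))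
      (0≤* {fromℚ θ} {total} (0≤-pointwise {fromℚ θ} (λ _ → ℚ.<⇒≤ 0<θ)) 0≤total))
    where
    total : ℝ
    total = ((ρ - b) * (T - ρ * S) + (b * T + a * S - ρ * T)) + (ρ * (ρ - b) - a - fromℚ η) * S
    0≤total : 0ℝ ≤ total
    0≤total = 0≤+ {(ρ - b) * (T - ρ * S) + (b * T + a * S - ρ * T)} {(ρ * (ρ - b) - a - fromℚ η) * S}
      (0≤+ {(ρ - b) * (T - ρ * S)} {b * T + a * S - ρ * T}
        (0≤* {ρ - b} {T - ρ * S} 0≤ρ-b (≤⇒0≤ {ρ * S} {T} ρS≤T))
        (≤⇒0≤ {ρ * T} {b * T + a * S} ρT≤))
      (0≤* {ρ * (ρ - b) - a - fromℚ η} {S} (≤⇒0≤ {fromℚ η} {ρ * (ρ - b) - a} gap) 0≤S)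

  -- The coefficient of `d` is α (n - 1) + (1 - α)(δ - 1). Hence the claimed upper bound for a
  -- column exceeds its weight by α d times the slack `e₁` in d ≤ n - 1 plus 1 - α times the slack
  -- `e₂` in `neighbour-degrees`.
  row-identity : ∀ α d e₁ e₂ δ R n H → n ≡ d ℚ.+ 1ℚ ℚ.+ e₁ →
    R ℚ.+ d ℚ.+ n ℚ.* δ ℚ.+ e₂ ≡ ⟦ 2 ⟧ ℚ.* H ℚ.+ d ℚ.* δ ℚ.+ δ →
    α ℚ.* (d ℚ.* e₁) ℚ.+ (1ℚ ℚ.- α) ℚ.* e₂ ≡
      ((δ ℚ.+ α ℚ.* n ℚ.- α ℚ.* δ ℚ.- 1ℚ) ℚ.* d ℚ.+ (1ℚ ℚ.- α) ℚ.* (⟦ 2 ⟧ ℚ.* H ℚ.- n ℚ.* δ ℚ.+ δ))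
      ℚ.- (α ℚ.* (d ℚ.* d) ℚ.+ (1ℚ ℚ.- α) ℚ.* R)
  row-identity α d e₁ e₂ δ R n H refl eq = trans
    (solve 6 (λ α d e₁ e₂ δ R → let n = d :+ con 1ℚ :+ e₁ in
      α :* (d :* e₁) :+ (con 1ℚ :- α) :* e₂ :=
      ((δ :+ α :* n :- α :* δ :- con 1ℚ) :* d
        :+ (con 1ℚ :- α) :* ((R :+ d :+ n :* δ :+ e₂) :- (d :* δ :+ δ) :- n :* δ :+ δ))
      :- (α :* (d :* d) :+ (con 1ℚ :- α) :* R)) refl α d e₁ e₂ δ R)
    (cong (λ X → ((δ ℚ.+ α ℚ.* n ℚ.- α ℚ.* δ ℚ.- 1ℚ) ℚ.* d ℚ.+ (1ℚ ℚ.- α) ℚ.* (X ℚ.- n ℚ.* δ ℚ.+ δ))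
      ℚ.- (α ℚ.* (d ℚ.* d) ℚ.+ (1ℚ ℚ.- α) ℚ.* R))
      (trans (cong (ℚ._- (d ℚ.* δ ℚ.+ δ)) eq)
        (solve 3 (λ h x y → h :+ x :+ y :- (x :+ y) := h) refl (⟦ 2 ⟧ ℚ.* H) (d ℚ.* δ) δ)))

  sqrt-resp : ∀ {s x y} → (∀ k → seq x k ≡ seq y k) → s IsSqrtOf x → s IsSqrtOf y
  sqrt-resp {s} x≡y (0≤s , s²≃x) = 0≤s , λ ε 0<ε →
    map-ev (λ k → subst (λ u → ∣ seq s k ℚ.* seq s k ℚ.- u ∣ ℚ.≤ ε) (x≡y k)) (s²≃x ε 0<ε)

  module _ {n : ℕ} (G : Graph n) {δ H : ℕ} (δ≤ : ∀ a → δ ℕ.≤ degree G a)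
           (sparse : sum-degrees G ℕ.≤ 2 ℕ.* H) {α : ℝ} (0≤α : 0ℝ ≤ α) (α<1 : α < 1ℝ) where

    b c a : ℝ
    b = fromℕ δ + α * fromℕ n - α * fromℕ δ - 1ℝ
    c = fromℕ 2 * fromℕ H - fromℕ n * fromℕ δ + fromℕ δ
    a = (1ℝ - α) * c

    0≤1-α : 0ℝ ≤ 1ℝ - α
    0≤1-α = ≤⇒0≤ {α} {1ℝ} (<⇒≤ {α} {1ℝ} α<1)

    -- This makes `c` and `a` nonnegative, so the larger root is at least `b`; that gives ρ - b the
    -- sign it needs as a weight.
    nδ≤2H : n ℕ.* δ ℕ.≤ 2 ℕ.* H
    nδ≤2H = ℕ.≤-trans (ℕ.≤-reflexive (sym (sum-const n δ))) (ℕ.≤-trans (sum-mono δ≤) sparse)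

    0≤c : 0ℝ ≤ c
    0≤c = from-witness (ℕ.m≤n⇒∃[o]m+o≡n nδ≤2H)
      where
      from-witness : ∃[ e ] n ℕ.* δ ℕ.+ e ≡ 2 ℕ.* H → 0ℝ ≤ c
      from-witness (e , eq) = 0≤-resp {fromℕ e + fromℕ δ} {c}
        (λ _ → trans (solve 3 (λ p e δ → e :+ δ := (p :+ e) :- p :+ δ) refl (⟦ n ⟧ ℚ.* ⟦ δ ⟧) ⟦ e ⟧ ⟦ δ ⟧)
          (cong (λ u → u ℚ.- ⟦ n ⟧ ℚ.* ⟦ δ ⟧ ℚ.+ ⟦ δ ⟧) cast))
        (0≤+ {fromℕ e} {fromℕ δ} (0≤fromℕ e) (0≤fromℕ δ))
        where
        cast : ⟦ n ⟧ ℚ.* ⟦ δ ⟧ ℚ.+ ⟦ e ⟧ ≡ ⟦ 2 ⟧ ℚ.* ⟦ H ⟧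
        cast = trans (cong (ℚ._+ ⟦ e ⟧) (sym (⟦⟧-* n δ))) (trans (sym (⟦⟧-+ (n ℕ.* δ) e))
          (trans (cong ⟦_⟧ eq) (⟦⟧-* 2 H)))

    0≤a : 0ℝ ≤ a
    0≤a = 0≤* {1ℝ - α} {c} 0≤1-α 0≤c

    column-excess : ∀ j → 0ℝ ≤ (b * fromℕ (degree G j) + a) -
      (α * fromℕ (degree G j ℕ.* degree G j) + (1ℝ - α) * fromℕ (neighbour-sum G (degree G) j))
    column-excess j = from-witnesses (ℕ.m≤n⇒∃[o]m+o≡n (degree<n G j))
      (ℕ.m≤n⇒∃[o]m+o≡n (ℕ.≤-trans (neighbour-degrees G δ≤ j)
        (ℕ.+-monoˡ-≤ δ (ℕ.+-monoˡ-≤ (degree G j ℕ.* δ) sparse))))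
      where
      d R : ℕ
      d = degree G j
      R = neighbour-sum G (degree G) j
      from-witnesses : ∃[ e₁ ] suc d ℕ.+ e₁ ≡ n →
        ∃[ e₂ ] R ℕ.+ d ℕ.+ n ℕ.* δ ℕ.+ e₂ ≡ 2 ℕ.* H ℕ.+ d ℕ.* δ ℕ.+ δ →
        0ℝ ≤ (b * fromℕ d + a) - (α * fromℕ (d ℕ.* d) + (1ℝ - α) * fromℕ R)
      from-witnesses (e₁ , eq₁) (e₂ , eq₂) = 0≤-resp
        {α * (fromℕ d * fromℕ e₁) + (1ℝ - α) * fromℕ e₂}
        {(b * fromℕ d + a) - (α * fromℕ (d ℕ.* d) + (1ℝ - α) * fromℕ R)}
        (λ k → trans (row-identity (seq α k) ⟦ d ⟧ ⟦ e₁ ⟧ ⟦ e₂ ⟧ ⟦ δ ⟧ ⟦ R ⟧ ⟦ n ⟧ ⟦ H ⟧ cast₁ cast₂)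
          (cong (λ u → seq (b * fromℕ d + a) k ℚ.- (seq α k ℚ.* u ℚ.+ (1ℚ ℚ.- seq α k) ℚ.* ⟦ R ⟧))
            (sym (⟦⟧-* d d))))
        (0≤+ {α * (fromℕ d * fromℕ e₁)} {(1ℝ - α) * fromℕ e₂}
          (0≤* {α} {fromℕ d * fromℕ e₁} 0≤α (0≤* {fromℕ d} {fromℕ e₁} (0≤fromℕ d) (0≤fromℕ e₁)))
          (0≤* {1ℝ - α} {fromℕ e₂} 0≤1-α (0≤fromℕ e₂)))
        where
        cast₁ : ⟦ n ⟧ ≡ ⟦ d ⟧ ℚ.+ 1ℚ ℚ.+ ⟦ e₁ ⟧
        cast₁ = trans (cong ⟦_⟧ (sym eq₁)) (trans (⟦⟧-+ (suc d) e₁)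
          (cong (ℚ._+ ⟦ e₁ ⟧) (trans (⟦⟧-+ 1 d) (ℚ.+-comm 1ℚ ⟦ d ⟧))))
        cast₂ : ⟦ R ⟧ ℚ.+ ⟦ d ⟧ ℚ.+ ⟦ n ⟧ ℚ.* ⟦ δ ⟧ ℚ.+ ⟦ e₂ ⟧ ≡ ⟦ 2 ⟧ ℚ.* ⟦ H ⟧ ℚ.+ ⟦ d ⟧ ℚ.* ⟦ δ ⟧ ℚ.+ ⟦ δ ⟧
        cast₂ = trans (sym (trans (⟦⟧-+ (R ℕ.+ d ℕ.+ n ℕ.* δ) e₂) (cong (ℚ._+ ⟦ e₂ ⟧)
            (trans (⟦⟧-+ (R ℕ.+ d) (n ℕ.* δ)) (cong₂ ℚ._+_ (⟦⟧-+ R d) (⟦⟧-* n δ))))))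
          (trans (cong ⟦_⟧ eq₂) (trans (⟦⟧-+ (2 ℕ.* H ℕ.+ d ℕ.* δ) δ) (cong (ℚ._+ ⟦ δ ⟧)
            (trans (⟦⟧-+ (2 ℕ.* H) (d ℕ.* δ)) (cong₂ ℚ._+_ (⟦⟧-* 2 H) (⟦⟧-* d δ))))))

    module _ {ρ : ℝ} {x : Fin n → ℝ} (eigen : ∀ i → (Aα G α ·ᵥ x) i ≃ ρ * x i) where

      private
        0≤ᵥ : ∀ i → 0ℝ ≤ absᵥ x i
        0≤ᵥ = 0≤∣x∣ G {α} 0≤α 0≤1-α {ρ} {x} eigen

        weighted : (w : Fin n → ℕ) → ρ * ∑ (λ i → fromℕ (w i) * absᵥ x i) ≤ ∑ (columns G α w (absᵥ x))
        weighted = weighted-subeigen G {α} 0≤α 0≤1-α {ρ} {x} eigen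

      S T : ℝ
      S = ∑ (λ j → fromℕ 1 * absᵥ x j)
      T = ∑ (λ j → fromℕ (degree G j) * absᵥ x j)

      -- With unit weights the degree part and the adjacency part of column j both sum to dⱼ, so α
      -- drops out.
      ρS≤T : ρ * S ≤ T
      ρS≤T = ≤-trans {ρ * S} {∑ (columns G α (λ _ → 1) (absᵥ x))} {T} (weighted (λ _ → 1))
        (∑-mono-≤ {f = columns G α (λ _ → 1) (absᵥ x)} {g = λ j → fromℕ (degree G j) * absᵥ x j} λ j →
          ≤-reflexive {columns G α (λ _ → 1) (absᵥ x) j} {fromℕ (degree G j) * absᵥ x j} (λ k → column j k))
        where
        neighbour-count : ∀ j → neighbour-sum G (λ _ → 1) j ≡ degree G j
        neighbour-count j = trans (sum-congℕ (λ i → trans (ℕ.*-identityʳ (ind G i j)) (ind-sym G i j)))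
          (sym (degree≡sum G j))
        average : ∀ a d z → (a ℚ.* d ℚ.+ (1ℚ ℚ.- a) ℚ.* d) ℚ.* z ≡ d ℚ.* z
        average = solve 3 (λ a d z → (a :* d :+ (con 1ℚ :- a) :* d) :* z := d :* z) refl
        column : ∀ j k → seq (columns G α (λ _ → 1) (absᵥ x) j) k ≡ seq (fromℕ (degree G j) * absᵥ x j) k
        column j k = trans
          (cong₂ (λ X Y → (seq α k ℚ.* ⟦ X ⟧ ℚ.+ (1ℚ ℚ.- seq α k) ℚ.* ⟦ Y ⟧) ℚ.* seq (absᵥ x j) k)
            (ℕ.*-identityʳ (degree G j)) (neighbour-count j))
          (average (seq α k) ⟦ degree G j ⟧ (seq (absᵥ x j) k))

      ρT≤bT+aS : ρ * T ≤ b * T + a * S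
      ρT≤bT+aS = ≤-trans {ρ * T} {∑ (columns G α (degree G) (absᵥ x))} {b * T + a * S} (weighted (degree G))
        (≤-trans {∑ (columns G α (degree G) (absᵥ x))} {∑ upper} {b * T + a * S}
          (∑-mono-≤ {f = columns G α (degree G) (absᵥ x)} {g = upper} column)
          (≤-reflexive {∑ upper} {b * T + a * S} (combine-∑ b a (λ j → fromℕ (degree G j)) (absᵥ x))))
        where
        upper : Fin n → ℝ
        upper j = (b * fromℕ (degree G j) + a) * absᵥ x j
        column : ∀ j → columns G α (degree G) (absᵥ x) j ≤ upper j
        column j = 0≤⇒≤ {columns G α (degree G) (absᵥ x) j} {upper j} (0≤-resp {(U - L) * absᵥ x j} {U * absᵥ x j - L * absᵥ x j}
          (λ k → solve 3 (λ u l z → (u :- l) :* z := u :* z :- l :* z) refl (seq U k) (seq L k) (seq (absᵥ x j) k))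
          (0≤* {U - L} {absᵥ x j} (column-excess j) (0≤ᵥ j)))
          where
          U L : ℝ
          U = b * fromℕ (degree G j) + a
          L = α * fromℕ (degree G j ℕ.* degree G j) + (1ℝ - α) * fromℕ (neighbour-sum G (degree G) j)

      term≤S : ∀ i → absᵥ x i ≤ S
      term≤S i = ≤-trans {absᵥ x i} {fromℕ 1 * absᵥ x i} {S}
        (≤-reflexive {absᵥ x i} {fromℕ 1 * absᵥ x i} (λ k → sym (ℚ.*-identityˡ (seq (absᵥ x i) k))))
        (term≤∑ (λ j → fromℕ 1 * absᵥ x j) nonneg i)
        where
        nonneg : ∀ j → 0ℝ ≤ fromℕ 1 * absᵥ x j
        nonneg j = 0≤* {fromℕ 1} {absᵥ x j} (0≤fromℕ 1) (0≤ᵥ j)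

      eigenvector-vanishes : ∀ {s} → s IsSqrtOf (b * b + fromℕ 4 * (1ℝ - α) * c) → (b + s) /2 < ρ →
        ∀ i → x i ≃ 0ℝ
      eigenvector-vanishes {s} sqrt above i =
        let 0≤ρ-b , η , 0<η , gap = above-root {b} {a} {ρ} {s} 0≤a
              (sqrt-resp {s} {b * b + fromℕ 4 * (1ℝ - α) * c} {b * b + fromℕ 4 * a}
                (λ k → solve 3 (λ b u c → b :* b :+ con ⟦ 4 ⟧ :* u :* c := b :* b :+ con ⟦ 4 ⟧ :* (u :* c)) refl
                  (seq b k) (seq (1ℝ - α) k) (seq c k)) sqrt) above
        in abs≤0⇒≃0 {x i} (≤-trans {absᵥ x i} {S} {0ℝ} (term≤S i)
             (vanishing-sum {b} {a} {ρ} {S} {T} {η} 0≤ρ-b 0<η gap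
               (≤-trans {0ℝ} {absᵥ x i} {S} (0≤ᵥ i) (term≤S i)) ρS≤T ρT≤bT+aS))

-- The theorem: sparse graphs contradict the spectral hypothesis, dense ones are coverable.

open import Defs
open import Data.Nat.Base as ℕ using (ℕ)
open import Data.Empty using (⊥-elim)
open import Data.Product.Base using (_,_)
open import Data.Sum.Base using ([_,_]′)
open import Function.Base using (id)
open import Relation.Binary.PropositionalEquality using (_≢_)
open import Relation.Nullary using (¬_; Dec; yes; no)
import Data.Nat.Properties as ℕ

corollary2p4 :
    (n t δ : ℕ) → 3 ℕ.≤ n → 2 ℕ.≤ t → t ℕ.≤ δ → δ ℕ.≤ h n t →
    (α : ℝ) → 0ℝ ≤ α → α < 1ℝ →
    (G : Graph n) → Connected G → HasMinDegree G δ →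
    let b = fromℕ δ + α * fromℕ n - α * fromℕ δ - 1ℝ
        c = fromℕ 2 * fromℕ (h₂ n t δ) - fromℕ n * fromℕ δ + fromℕ δ
    in
    (ρ s : ℝ) →
    IsSpectralRadius G α ρ →
    s IsSqrtOf (b * b + fromℕ 4 * (1ℝ - α) * c) →
    (b + s) /2 < ρ →
    OneToOneDisjointPathCoverable G t
corollary2p4 n t δ 3≤n 2≤t t≤δ δ≤h α 0≤α α<1 G _ minDegree@(_ , δ≤) ρ s ((x , x≢0 , eigen) , _) sqrt above =
  by-density (Degrees.sum-degrees G ℕ.≤? 2 ℕ.* h₂ n t δ)
  where
  t+2≤n : t ℕ.+ 2 ℕ.≤ n
  t+2≤n = Arithmetic.t+2≤n 3≤n (ℕ.≤-trans t≤δ δ≤h)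
  contains : ¬ (Degrees.sum-degrees G ℕ.≤ 2 ℕ.* h₂ n t δ) →
    ∀ {u v} (u≢v : u ≢ v) → Closure.Contains u≢v 2≤t t+2≤n G
  contains dense u≢v = [ id , (λ obstructed → ⊥-elim (dense
      (Arithmetic.obstructed⇒sum-degrees≤ u≢v 2≤t t+2≤n 3≤n t≤δ G minDegree obstructed))) ]′
    (Closure.contains-or-obstructed u≢v 2≤t t+2≤n {δ} (n ℕ.* n) G (ℕ.m≤n+m (n ℕ.* n) _) δ≤)
  by-density : Dec (Degrees.sum-degrees G ℕ.≤ 2 ℕ.* h₂ n t δ) → OneToOneDisjointPathCoverable G t
  -- An eigenvector is only required not to vanish identically, so showing every entry equal to zero
  -- contradicts it without locating a nonzero entry.
  by-density (yes sparse) = ⊥-elim (x≢0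
    (Spectral.eigenvector-vanishes G {δ} {h₂ n t δ} δ≤ sparse {α} 0≤α α<1 {ρ} {x} eigen {s} sqrt above))
  by-density (no dense) = Coverings.containers⇒coverable G (contains dense)
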